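{- Let $n\ge2$ and let $q$ be a prime power. Each of the $m$-covers $\mathcal F,\mathcal O_1,\mathcal O_2$ of $\mathcal W(4n-1,q)$ is $(4n-3)$-dual of symplectic type.
   Context: $\theta_{n,q}=q^n+\dots+q+1$ for $n\ge0$, $\theta_{ -1,q}=0$. Setting. Let $V=\mathbb F_{q^2}^{2n}$ with a nondegenerate alternating $\mathbb F_{q^2}$-bilinear form $f$, and regard $V$ as a $4n$-dimensional $\mathbb F_q$-space, so that $\Sigma=\mathrm{PG}(V)=\mathrm{PG}(4n-1,q)$. For $\lambda\in\mathbb F_{q^2}^*$ the form $b_\lambda(x,y)=\mathrm{Tr}_{\mathbb F_{q^2}/\mathbb F_q}(\lambda f(x,y))$ is a nondegenerate alternating $\mathbb F_q$-form on $V$; up to $\mathbb F_q^*$-multiples this gives $q+1$ symplectic polar spaces (linear complexes) of $\Sigma$, a pencil stabilised by the group $G\simeq\mathrm{PSp}(2n,q^2)$ induced by the isometries of $f$. $\mathcal W(4n-1,q)$ is one of them, with polarity $\perp$. Its lines are the totally isotropic lines. $\mathcal F$ is the line spread of $\Sigma$ (constructed by Dye) whose members are the $1$-dimensional $\mathbb F_{q^2}$-subspaces of $V$, viewed as lines of $\Sigma$; all are lines of $\mathcal W(4n-1,q)$. Call a line $\ell$ conjugate to a line $r$ if $\ell\subseteq r^\perp$. $\mathcal O_1$ is the set of lines of $\mathcal W(4n-1,q)$ not in $\mathcal F$ that are not conjugate to the members of $\mathcal F$ that they meet non-trivially; $\mathcal O_2$ is the set of lines of $\mathcal W(4n-1,q)$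 not in $\mathcal F$ that are conjugate to each member of $\mathcal F$ that they meet non-trivially. The sets $\mathcal F,\mathcal O_1,\mathcal O_2$ are the three $G$-orbits on the lines of $\mathcal W(4n-1,q)$. An $m$-cover of $\mathcal W(r,q)$ ($r$ odd, $m>0$) is a set of lines of $\mathcal W(r,q)$ such that every point of $\mathrm{PG}(r,q)$ lies on exactly $m$ of them. Each of $\mathcal F,\mathcal O_1,\mathcal O_2$ is an $m$-cover for its own value of $m$ (because $G$ is transitive on points of $\Sigma$). An $m$-cover $\mathcal L$ of $\mathcal W(r,q)$ is $(r-2)$-dual of symplectic type if for every line $\ell$ of $\mathrm{PG}(r,q)$ the number of lines of $\mathcal L$ contained in $\ell^\perp$ equals $\frac{m\theta_{r-4,q}}{q+1}+q^{r-3}$ if $\ell\in\mathcal L$, and $\frac{m\theta_{r-4,q}}{q+1}$ if $\ell\notin\mathcal L$. -}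

module Defs where

open import Algebra.Bundles using (CommutativeRing; RawRing)
open import Algebra.Core using (Op₁; Op₂)
open import Algebra.Definitions using (Invertible)
import Algebra.Definitions.RawSemiring as RawSemiringDefs
open import Algebra.Morphism.Structures using (module RingMorphisms)
open import Algebra.Structures using (IsCommutativeRing)
open import Data.Fin.Base using (Fin)
open import Data.Nat.Base using (ℕ; zero; suc; _+_; _*_; _∸_; _^_; _≤_; _<_)
open import Data.Nat.DivMod using (_/_)
open import Data.Nat.Primality using (Prime)
open import Data.Product.Base using (Σ; ∃; ∃₂; _×_; _,_; proj₁; proj₂)
open import Data.Vec.Base using (Vec; map; zipWith; replicate; foldr′)
open import Function.Base using (id)
open import Function.Bundles using (_⇔_; _↔_; Inverse)
open import Level using (0ℓ; Level; _⊔_) renaming (suc to lsuc)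
open import Relation.Binary.Bundles using (Setoid)
import Relation.Binary.Construct.On as On
open import Relation.Binary.PropositionalEquality using (_≡_; _≢_; setoid)
open import Relation.Nullary.Negation using (¬_)
open import Relation.Unary using (Pred; _∈_; _∉_; _⊆_; _≐_)

-- θ q k = θ_{k,q} for k ≥ 0; the value θ_{-1,q} = 0 is never used below.
θ : ℕ → ℕ → ℕ
θ q zero    = 1
θ q (suc k) = q ^ suc k + θ q k

IsPrimePower : ℕ → Set
IsPrimePower q = ∃₂ λ p h → Prime p × 1 ≤ h × q ≡ p ^ h

record Field : Set₁ where
  infixl 7 _*ᶠ_
  infixl 6 _+ᶠ_
  field
    Carrier           : Set
    _+ᶠ_ _*ᶠ_         : Op₂ Carrier
    -ᶠ_               : Op₁ Carrier
    0# 1#             : Carrier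
    isCommutativeRing : IsCommutativeRing _≡_ _+ᶠ_ _*ᶠ_ -ᶠ_ 0# 1#
    1#≢0#             : 1# ≢ 0#
    invertible        : ∀ x → x ≢ 0# → Invertible _≡_ 1# _*ᶠ_ x

  commutativeRing : CommutativeRing 0ℓ 0ℓ
  commutativeRing = record { isCommutativeRing = isCommutativeRing }

  open CommutativeRing commutativeRing public using (rawRing)
  open RawSemiringDefs (RawRing.rawSemiring rawRing) public
    using () renaming (_^_ to _^ᶠ_)

HasOrder : Field → ℕ → Set
HasOrder K k = Field.Carrier K ↔ Fin k

IsFieldHomomorphism : (F E : Field) → (Field.Carrier F → Field.Carrier E) → Set
IsFieldHomomorphism F E =
  RingMorphisms.IsRingHomomorphism (Field.rawRing F) (Field.rawRing E)

module VectorSpace (E : Field) (N : ℕ) where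
  open Field E

  infixl 6 _+ᵥ_
  infixr 7 _•_

  V : Set
  V = Vec Carrier N

  0ᵥ : V
  0ᵥ = replicate N 0#

  _+ᵥ_ : V → V → V
  _+ᵥ_ = zipWith _+ᶠ_

  _•_ : Carrier → V → V
  a • v = map (a *ᶠ_) v

  record IsNondegenerateAlternating (f : V → V → Carrier) : Set where
    field
      +-homoˡ       : ∀ x y z → f (x +ᵥ y) z ≡ f x z +ᶠ f y z
      •-homoˡ       : ∀ a x y → f (a • x) y ≡ a *ᶠ f x y
      +-homoʳ       : ∀ x y z → f x (y +ᵥ z) ≡ f x y +ᶠ f x z
      •-homoʳ       : ∀ a x y → f x (a • y) ≡ a *ᶠ f x y
      alternating   : ∀ x → f x x ≡ 0#
      nondegenerate : ∀ x → (∀ y → f x y ≡ 0#) → x ≡ 0ᵥ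

  -- A d-dimensional K-subspace of V, where K acts on V through j : K → E.
  -- The chosen basis only witnesses the dimension: subspaces are always
  -- compared by _≐_ on their sets of members.
  record Subspace (K : Field) (j : Field.Carrier K → Carrier) (d : ℕ) : Set₁ where
    combination : Vec (Field.Carrier K) d → Vec V d → V
    combination c vs = foldr′ _+ᵥ_ 0ᵥ (zipWith (λ a v → j a • v) c vs)

    field
      Member      : Pred V 0ℓ
      basis       : Vec V d
      independent : ∀ c → combination c basis ≡ 0ᵥ → c ≡ replicate d (Field.0# K)
      spans       : ∀ v → v ∈ Member ⇔ ∃ λ c → combination c basis ≡ v

  open Subspace public using (Member)

-- F and E play the roles of 𝔽_q and 𝔽_{q²}, with F embedded in E by ι.
module Geometry
  (n q : ℕ) (F E : Field) (ι : Field.Carrier F → Field.Carrier E)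
  (f : VectorSpace.V E (2 * n) → VectorSpace.V E (2 * n) → Field.Carrier E)
  (λ₀ : Field.Carrier E)
  where

  open Field E
  open VectorSpace E (2 * n) public

  -- The trace of E over F, with values viewed in E through ι.
  Tr : Carrier → Carrier
  Tr x = x +ᶠ x ^ᶠ q

  b : V → V → Carrier
  b x y = Tr (λ₀ *ᶠ f x y)

  -- Σ = PG(r,q) is the projective space of V regarded over F.
  r : ℕ
  r = 4 * n ∸ 1

  Point Line : Set₁
  Point = Subspace F ι 1
  Line  = Subspace F ι 2

  perp : Pred V 0ℓ → Pred V 0ℓ
  perp U v = ∀ w → w ∈ U → b v w ≡ 0#

  IsotropicLine : Pred Line 0ℓ
  IsotropicLine ℓ = Member ℓ ⊆ perp (Member ℓ)

  Conjugate : Line → Line → Set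
  Conjugate ℓ s = Member ℓ ⊆ perp (Member s)

  MeetsNontrivially : Line → Line → Set
  MeetsNontrivially ℓ s = ∃ λ v → v ≢ 0ᵥ × v ∈ Member ℓ × v ∈ Member s

  𝓕 : Pred Line (lsuc 0ℓ)
  𝓕 ℓ = Σ (Subspace E id 1) λ S → Member ℓ ≐ Member S

  𝓞₁ : Pred Line (lsuc 0ℓ)
  𝓞₁ ℓ = IsotropicLine ℓ × ℓ ∉ 𝓕 ×
    (∀ s → s ∈ 𝓕 → MeetsNontrivially ℓ s → ¬ Conjugate ℓ s)

  𝓞₂ : Pred Line (lsuc 0ℓ)
  𝓞₂ ℓ = IsotropicLine ℓ × ℓ ∉ 𝓕 ×
    (∀ s → s ∈ 𝓕 → MeetsNontrivially ℓ s → Conjugate ℓ s)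

  lineSetoid : Setoid (lsuc 0ℓ) 0ℓ
  lineSetoid = record
    { Carrier       = Line
    ; _≈_           = λ ℓ s → Member ℓ ≐ Member s
    ; isEquivalence = record
      { refl  = id , id
      ; sym   = λ (p , p′) → p′ , p
      ; trans = λ (p , p′) (s , s′) → (λ x → s (p x)) , (λ x → p′ (s′ x))
      }
    }

  -- Exactly k lines, counted up to equality of their sets of members,
  -- satisfy P.
  NumberOfLines : ∀ {a} → Pred Line a → ℕ → Set (lsuc 0ℓ ⊔ a)
  NumberOfLines P k =
    Inverse (On.setoid lineSetoid (proj₁ {B = P})) (setoid (Fin k))

  IsCover : ∀ {a} → ℕ → Pred Line a → Set (lsuc 0ℓ ⊔ a)
  IsCover m 𝓛 =
    0 < m ×
    (∀ ℓ → ℓ ∈ 𝓛 → IsotropicLine ℓ) ×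
    (∀ (P : Point) → NumberOfLines (λ ℓ → ℓ ∈ 𝓛 × Member P ⊆ Member ℓ) m)

  -- r is odd, so q + 1 divides θ q (r ∸ 4) and the division is exact; for
  -- n ≥ 2 the subtractions do not truncate.
  IsDualOfSymplecticType : ∀ {a} → ℕ → Pred Line a → Set (lsuc 0ℓ ⊔ a)
  IsDualOfSymplecticType m 𝓛 = ∀ (ℓ : Line) →
    (ℓ ∈ 𝓛 → NumberOfLines (inPerpOf ℓ) (m * θ q (r ∸ 4) / suc q + q ^ (r ∸ 3))) ×
    (ℓ ∉ 𝓛 → NumberOfLines (inPerpOf ℓ) (m * θ q (r ∸ 4) / suc q))
    where
    inPerpOf : Line → Pred Line _
    inPerpOf ℓ s = s ∈ 𝓛 × Member s ⊆ perp (Member ℓ)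

  IsDualCoverOfSymplecticType : ∀ {a} → Pred Line a → Set (lsuc 0ℓ ⊔ a)
  IsDualCoverOfSymplecticType 𝓛 =
    ∃ λ m → IsCover m 𝓛 × IsDualOfSymplecticType m 𝓛

{-# OPTIONS --safe #-}
module Submission where

-- Let W be the perpendicular of ℓ = ⟨x , y⟩. Whether a line ⟨u , v⟩ of W lies
-- in 𝓕, 𝓞₁ or 𝓞₂ depends only on f u v and on v ∈ ⟨u⟩_E, so the lines are
-- counted through their bases. Every count needed is an instance of one
-- identity: a bilinear pairing A × B → F of finite spaces with radicals L and R
-- satisfies |L| |B| = |R| |A|, by counting orthogonal pairs in both orders. For
-- S = F and S = E it turns the number of v ∈ W with v ⊥ S u into the number of
-- relations c x + d y + s u = 0, and exchanging the order of summation over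
-- u ∈ W reduces everything to counts on ℓ, which only depend on whether
-- f x y = 0, Tr (λ₀ f x y) = 0 and y ∈ ⟨x⟩_E.

-- The form of the dual condition comes from one jump. Let `T-F`, `T-E`, `T-∥` count the pairs (u ,
-- v) of `W` with u ≠ 0 and, respectively, Tr (λ₀ f v u) = 0, f v u = 0, v ∈ ⟨u⟩_E. As ℓ varies,
-- each of them takes two values only: it is larger by `X * G` exactly when the basis x, y of ℓ
-- satisfies the same relation. Here `X` = q^(r-3), and `G` = (q² - 1)(q² - q) is the number of
-- ordered bases of a line. The three relations are nested, and the differences T-F - T-E and T-E -
-- T-∥ count bases of lines of 𝓞₁ and of 𝓞₂. Such a difference therefore jumps only if x, y satisfy
-- the weaker relation and not the stronger one, that is, if ℓ lies in the family; the jump is the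
-- summand q^(r-3). Lines form a large type compared by members, whereas bases form a finite set;
-- this is why every count is one of bases. In ℕ, differences are stated as sums, and quotients by
-- cancelling a factor.

open import Defs
open import Algebra.Bundles using (CommutativeMonoid; CommutativeRing)
import Algebra.Morphism.Construct.Identity as Identity
open import Algebra.Morphism.Structures using (module RingMorphisms)
import Algebra.Properties.CommutativeMonoid.Sum as CommutativeMonoidSum
import Algebra.Properties.CommutativeSemiring.Binomial as Binomial
import Algebra.Properties.CommutativeSemiring.Exp as CommutativeExp
import Algebra.Properties.Ring as RingProperties
import Algebra.Properties.Semiring.Exp as Exp
import Algebra.Properties.Semiring.Mult as Mult
import Algebra.Properties.Semiring.Sum as SemiringSum
open import Data.Bool.Base using (if_then_else_)
open import Data.Fin.Base as Fin using (Fin; zero; suc; toℕ; inject₁; fromℕ)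
open import Data.Fin.Permutation using (permutation)
import Data.Fin.Properties as Fin
open import Data.Nat.Base using (ℕ; zero; suc; _+_; _*_; _∸_; _^_; _≤_; _<_; z≤n; s≤s; NonZero; ≢-nonZero; ≢-nonZero⁻¹; nonTrivial⇒n>1)
open import Data.Nat.Combinatorics using (nCn≡1; nCk+nC[k+1]≡[n+1]C[k+1]) renaming (_C_ to _choose_)
open import Data.Nat.Combinatorics.Specification using (k>n⇒nCk≡0)
open import Data.Nat.Divisibility using (_∣_; divides; ∣⇒≤; m∣m*n)
open import Data.Nat.DivMod using (_/_; m*n/n≡m)
open import Data.Nat.Primality using (Prime; euclidsLemma; prime⇒nonZero; prime⇒nonTrivial)
import Data.Nat.Properties as ℕ
import Data.Nat.Tactic.RingSolver as ℕSolver
open import Data.Product.Base using (Σ; ∃; _×_; _,_; proj₁; proj₂)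
open import Data.Sum.Base using (inj₁; inj₂)
open import Data.Vec.Base using (Vec; []; _∷_; head; tail; replicate; map; zipWith)
open import Data.Vec.Functional using (removeAt)
open import Data.Vec.Properties using (zipWith-assoc; zipWith-comm; zipWith-identityˡ; zipWith-identityʳ; zipWith-inverseˡ; zipWith-inverseʳ; map-cong; map-∘; map-id; map-const; map-replicate)
open import Function.Base using (_∘_; id)
open import Function.Bundles using (_↔_; Inverse; mk↔ₛ′; mk⇔; Equivalence)
open import Level using (0ℓ; _⊔_) renaming (suc to lsuc)
open import Relation.Binary.PropositionalEquality
open import Relation.Nullary
open import Relation.Unary using (Pred; _∈_; _⊆_; _≐_)

-- Counting in finite types

private
  module ℕΣ = SemiringSum ℕ.+-*-semiring

record Finite (X : Set) : Set where
  constructor finite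
  field
    size  : ℕ
    index : X ↔ Fin size

  open Inverse index public using (to; from)

  from-to : ∀ x → from (to x) ≡ x
  from-to x = Inverse.inverseʳ index refl

  to-from : ∀ i → to (from i) ≡ i
  to-from i = Inverse.inverseˡ index refl

module _ {X : Set} {{finX : Finite X}} where
  open Finite finX

  infix 4 _≟_

  opaque
    _≟_ : (x y : X) → Dec (x ≡ y)
    x ≟ y with to x Fin.≟ to y
    ... | yes p = yes (trans (sym (from-to x)) (trans (cong from p) (from-to y)))
    ... | no ¬p = no (¬p ∘ cong to)

    any? : {P : X → Set} → (∀ x → Dec (P x)) → Dec (∃ P)
    any? {P} P? with Fin.any? (P? ∘ from)
    ... | yes (i , p) = yes (from i , p)
    ... | no ¬p = no λ (x , p) → ¬p (to x , subst P (sym (from-to x)) p)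

    all? : {P : X → Set} → (∀ x → Dec (P x)) → Dec (∀ x → P x)
    all? {P} P? with Fin.all? (P? ∘ from)
    ... | yes p = yes λ x → subst P (from-to x) (p (to x))
    ... | no ¬p = no λ p → ¬p (p ∘ from)

∣_∣ : (X : Set) → {{Finite X}} → ℕ
∣ X ∣ {{fin}} = Finite.size fin

module _ {c ℓ} (M : CommutativeMonoid c ℓ) where
  open CommutativeMonoid M using (Carrier; _≈_; _∙_; ε; ∙-congˡ; identityʳ; reflexive)
  open CommutativeMonoidSum M using (sum-permute; sum-remove; sum-replicate-zero)
    renaming (sum to fsum; sum-cong-≋ to fsum-cong)

  -- The monoid is arbitrary because three instances occur: sums in ℕ, and sums and products over
  -- all elements of a field.
  sumOver : {X : Set} → {{Finite X}} → (X → Carrier) → Carrier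
  sumOver {{fin}} f = fsum (f ∘ Finite.from fin)

  sumOver-reindex : {X Y : Set} {{_ : Finite X}} {{_ : Finite Y}} (φ : X → Y) (ψ : Y → X) →
    (∀ y → φ (ψ y) ≡ y) → (∀ x → ψ (φ x) ≡ x) →
    (f : Y → Carrier) → sumOver (f ∘ φ) ≈ sumOver f
  sumOver-reindex {X} {Y} {{finX}} {{finY}} φ ψ φψ ψφ f =
    CommutativeMonoid.sym M (CommutativeMonoid.trans M (sum-permute (f ∘ Y.from) π)
      (fsum-cong λ i → reflexive (cong f (Y.from-to (φ (X.from i))))))
    where
    module X = Finite finX
    module Y = Finite finY
    π = permutation (Y.to ∘ φ ∘ X.from) (X.to ∘ ψ ∘ Y.from)
      (λ j → trans (cong (Y.to ∘ φ) (X.from-to _)) (trans (cong Y.to (φψ _)) (Y.to-from j)))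
      (λ i → trans (cong (X.to ∘ ψ) (Y.from-to _)) (trans (cong X.to (ψφ _)) (X.to-from i)))

  sumOver-single : {X : Set} {{_ : Finite X}} (a : X) {f : X → Carrier} →
    (∀ x → x ≢ a → f x ≈ ε) → sumOver f ≈ f a
  sumOver-single {{finX}} a {f} p =
    CommutativeMonoid.trans M
      (go (f ∘ X.from) (X.to a) λ i i≢ → p (X.from i) λ eq → i≢ (trans (sym (X.to-from i)) (cong X.to eq)))
      (reflexive (cong f (X.from-to a)))
    where
    module X = Finite finX
    open import Relation.Binary.Reasoning.Setoid (CommutativeMonoid.setoid M)
    go : ∀ {n} (g : Fin n → Carrier) i → (∀ j → j ≢ i → g j ≈ ε) → fsum g ≈ g i
    go {suc n} g i z = begin
      fsum g                       ≈⟨ sum-remove {i = i} g ⟩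
      g i ∙ fsum (removeAt g i)    ≈⟨ ∙-congˡ (fsum-cong λ j → z (Fin.punchIn i j) (Fin.punchInᵢ≢i i j)) ⟩
      g i ∙ fsum {n} (λ _ → ε)     ≈⟨ ∙-congˡ (sum-replicate-zero n) ⟩
      g i ∙ ε                      ≈⟨ identityʳ (g i) ⟩
      g i                          ∎

opaque
  ∑ : {X : Set} {{_ : Finite X}} → (X → ℕ) → ℕ
  ∑ = sumOver ℕ.+-0-commutativeMonoid

infixr 10 ∑
syntax ∑ (λ x → e) = ∑[ x ] e

module _ {X : Set} {{finX : Finite X}} where
  private module X = Finite finX

  opaque
    unfolding ∑

    ∑-cong : {f g : X → ℕ} → (∀ x → f x ≡ g x) → ∑ f ≡ ∑ g
    ∑-cong p = ℕΣ.sum-cong-≗ (p ∘ X.from)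

    ∑-const : ∀ c → ∑ {X} (λ _ → c) ≡ ∣ X ∣ * c
    ∑-const c = go X.size
      where
      go : ∀ n → ℕΣ.sum {n} (λ _ → c) ≡ n * c
      go zero    = refl
      go (suc n) = cong (c +_) (go n)

    ∑-zero : {f : X → ℕ} → (∀ x → f x ≡ 0) → ∑ f ≡ 0
    ∑-zero p = trans (∑-cong p) (trans (∑-const 0) (ℕ.*-zeroʳ X.size))

    ∑-+ : (f g : X → ℕ) → ∑[ x ] (f x + g x) ≡ ∑ f + ∑ g
    ∑-+ f g = ℕΣ.∑-distrib-+ (f ∘ X.from) (g ∘ X.from)

    ∑-*ˡ : ∀ c (f : X → ℕ) → ∑[ x ] (c * f x) ≡ c * ∑ f
    ∑-*ˡ c f = sym (ℕΣ.*-distribˡ-sum c (f ∘ X.from))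

    ∑-*ʳ : ∀ c (f : X → ℕ) → ∑[ x ] (f x * c) ≡ ∑ f * c
    ∑-*ʳ c f = sym (ℕΣ.*-distribʳ-sum c (f ∘ X.from))

    ∑-swap : {Y : Set} {{_ : Finite Y}} (f : X → Y → ℕ) →
      ∑[ x ] ∑[ y ] f x y ≡ ∑[ y ] ∑[ x ] f x y
    ∑-swap {{finY}} f = ℕΣ.∑-comm (λ i j → f (X.from i) (Finite.from finY j))

    ∑-single : ∀ a {f : X → ℕ} → (∀ x → x ≢ a → f x ≡ 0) → ∑ f ≡ f a
    ∑-single a = sumOver-single ℕ.+-0-commutativeMonoid a

    ∑-mono : {f g : X → ℕ} → (∀ x → f x ≤ g x) → ∑ f ≤ ∑ g
    ∑-mono p = go (p ∘ X.from)
      where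
      go : ∀ {n} {f g : Fin n → ℕ} → (∀ i → f i ≤ g i) → ℕΣ.sum f ≤ ℕΣ.sum g
      go {zero}  p = z≤n
      go {suc n} p = ℕ.+-mono-≤ (p zero) (go (p ∘ suc))

opaque
  unfolding ∑

  ∑-reindex : {X Y : Set} {{_ : Finite X}} {{_ : Finite Y}} (φ : X → Y) (ψ : Y → X) →
    (∀ y → φ (ψ y) ≡ y) → (∀ x → ψ (φ x) ≡ x) →
    (f : Y → ℕ) → ∑[ x ] f (φ x) ≡ ∑ f
  ∑-reindex = sumOver-reindex ℕ.+-0-commutativeMonoid

opaque
  𝟙 : {P : Set} → Dec P → ℕ
  𝟙 d = if does d then 1 else 0

module _ {P : Set} where
  opaque
    unfolding 𝟙

    𝟙-yes : (d : Dec P) → P → 𝟙 d ≡ 1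
    𝟙-yes (yes _) _ = refl
    𝟙-yes (no ¬p) p = contradiction p ¬p

    𝟙-no : (d : Dec P) → ¬ P → 𝟙 d ≡ 0
    𝟙-no (yes p) ¬p = contradiction p ¬p
    𝟙-no (no _)  _  = refl

    𝟙-¬ : (d : Dec P) → 𝟙 d + 𝟙 (¬? d) ≡ 1
    𝟙-¬ (yes _) = refl
    𝟙-¬ (no _)  = refl

opaque
  unfolding 𝟙

  𝟙-≤ : {P Q : Set} (d : Dec P) (e : Dec Q) → (P → Q) → 𝟙 d ≤ 𝟙 e
  𝟙-≤ (yes p) e f = ℕ.≤-reflexive (sym (𝟙-yes e (f p)))
  𝟙-≤ (no _)  e f = z≤n

  𝟙-cong : {P Q : Set} (d : Dec P) (e : Dec Q) → (P → Q) → (Q → P) → 𝟙 d ≡ 𝟙 e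
  𝟙-cong d e f g = ℕ.≤-antisym (𝟙-≤ d e f) (𝟙-≤ e d g)

  𝟙-× : {P Q : Set} (d : Dec P) (e : Dec Q) → 𝟙 (d ×-dec e) ≡ 𝟙 d * 𝟙 e
  𝟙-× (yes _) (yes _) = refl
  𝟙-× (yes _) (no _)  = refl
  𝟙-× (no _)  _       = refl

  𝟙-×-cong : {P Q : Set} (d : Dec P) (e : Dec Q) {m n : ℕ} →
    (P → Q) → (Q → P) → (P → m ≡ n) → 𝟙 d * m ≡ 𝟙 e * n
  𝟙-×-cong (yes p) e f g h = cong₂ _*_ (sym (𝟙-yes e (f p))) (h p)
  𝟙-×-cong (no ¬p) e {n = n} f g h = cong (_* n) (sym (𝟙-no e (¬p ∘ g)))

  𝟙-∖ : {P Q : Set} (d : Dec P) (e : Dec Q) → (P → Q) → 𝟙 (e ×-dec ¬? d) + 𝟙 d ≡ 𝟙 e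
  𝟙-∖ (yes p) (yes q) f = refl
  𝟙-∖ (yes p) (no ¬q) f = contradiction (f p) ¬q
  𝟙-∖ (no ¬p) (yes q) f = refl
  𝟙-∖ (no ¬p) (no ¬q) f = refl

𝟙-*-cong : {P : Set} (d : Dec P) {m n : ℕ} → (P → m ≡ n) → 𝟙 d * m ≡ 𝟙 d * n
𝟙-*-cong d h = 𝟙-×-cong d d id id h

count : {X : Set} {{_ : Finite X}} {P : X → Set} → (∀ x → Dec (P x)) → ℕ
count P? = ∑[ x ] 𝟙 (P? x)

module _ {X : Set} {{_ : Finite X}} where

  ∑-at : ∀ a (f : X → ℕ) → ∑[ x ] (𝟙 (a ≟ x) * f x) ≡ f a
  ∑-at a f = begin
    ∑[ x ] (𝟙 (a ≟ x) * f x) ≡⟨ ∑-single a (λ x x≢a → cong (_* f x) (𝟙-no (a ≟ x) (x≢a ∘ sym))) ⟩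
    𝟙 (a ≟ a) * f a          ≡⟨ cong (_* f a) (𝟙-yes (a ≟ a) refl) ⟩
    1 * f a                  ≡⟨ ℕ.*-identityˡ (f a) ⟩
    f a                      ∎
    where open ≡-Reasoning

  ∑-remove : ∀ a (f : X → ℕ) → ∑ f ≡ f a + (∑[ x ] (𝟙 (¬? (a ≟ x)) * f x))
  ∑-remove a f = begin
    ∑ f
      ≡⟨ ∑-cong (λ x → trans (sym (ℕ.*-identityˡ (f x)))
                        (trans (cong (_* f x) (sym (𝟙-¬ (a ≟ x)))) (ℕ.*-distribʳ-+ (f x) (𝟙 (a ≟ x)) _))) ⟩
    ∑[ x ] (𝟙 (a ≟ x) * f x + 𝟙 (¬? (a ≟ x)) * f x)
      ≡⟨ ∑-+ {X = X} _ _ ⟩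
    (∑[ x ] (𝟙 (a ≟ x) * f x)) + (∑[ x ] (𝟙 (¬? (a ≟ x)) * f x))
      ≡⟨ cong₂ _+_ (∑-at a f) refl ⟩
    f a + (∑[ x ] (𝟙 (¬? (a ≟ x)) * f x)) ∎
    where open ≡-Reasoning

  count-cong : {P Q : X → Set} (P? : ∀ x → Dec (P x)) (Q? : ∀ x → Dec (Q x)) →
    (∀ x → P x → Q x) → (∀ x → Q x → P x) → count P? ≡ count Q?
  count-cong P? Q? f g = ∑-cong λ x → 𝟙-cong (P? x) (Q? x) (f x) (g x)

  count-all : {P : X → Set} (P? : ∀ x → Dec (P x)) → (∀ x → P x) → count P? ≡ ∣ X ∣
  count-all P? p = trans (∑-cong λ x → 𝟙-yes (P? x) (p x)) (trans (∑-const 1) (ℕ.*-identityʳ _))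

  count-unique : {P : X → Set} (P? : ∀ x → Dec (P x)) → (a : X) → P a → (∀ x → P x → x ≡ a) → count P? ≡ 1
  count-unique P? a p u = trans (∑-single a (λ x x≢a → 𝟙-no (P? x) (x≢a ∘ u x))) (𝟙-yes (P? a) p)

  count-≤1 : {P : X → Set} (P? : ∀ x → Dec (P x)) → (∀ x y → P x → P y → x ≡ y) → count P? ≡ 𝟙 (any? P?)
  count-≤1 P? u with any? P?
  ... | yes (a , p) = trans (count-unique P? a p (λ x q → u x a q p)) (sym (𝟙-yes (yes (a , p)) (a , p)))
  ... | no ¬p       = trans (∑-zero λ x → 𝟙-no (P? x) λ p → ¬p (x , p)) (sym (𝟙-no (no ¬p) ¬p))

  count-< : {P Q : X → Set} (P? : ∀ x → Dec (P x)) (Q? : ∀ x → Dec (Q x)) →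
    (∀ x → P x → Q x) → ∀ a → Q a → ¬ P a → count P? < count Q?
  count-< P? Q? f a q ¬p = subst₂ _<_ (sym lhs) (sym rhs) (s≤s (∑-mono λ x → ℕ.*-monoʳ-≤ (𝟙 (¬? (a ≟ x))) (𝟙-≤ (P? x) (Q? x) (f x))))
    where
    lhs = trans (∑-remove a (𝟙 ∘ P?)) (cong₂ _+_ (𝟙-no (P? a) ¬p) refl)
    rhs = trans (∑-remove a (𝟙 ∘ Q?)) (cong₂ _+_ (𝟙-yes (Q? a) q) refl)

  count-⊆-≡ : {P Q : X → Set} (P? : ∀ x → Dec (P x)) (Q? : ∀ x → Dec (Q x)) →
    (∀ x → P x → Q x) → count P? ≡ count Q? → ∀ x → Q x → P x
  count-⊆-≡ P? Q? f eq x q with P? x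
  ... | yes p = p
  ... | no ¬p = contradiction eq (ℕ.<⇒≢ (count-< P? Q? f x q ¬p))

  count-∖ : {P Q : X → Set} (P? : ∀ x → Dec (P x)) (Q? : ∀ x → Dec (Q x)) →
    (∀ x → P x → Q x) → count (λ x → Q? x ×-dec ¬? (P? x)) + count P? ≡ count Q?
  count-∖ P? Q? f = trans (sym (∑-+ _ _)) (∑-cong λ x → 𝟙-∖ (P? x) (Q? x) (f x))

module _ {X Y : Set} {{_ : Finite X}} {{_ : Finite Y}} where

  ∑-image : (h : X → Y) → (∀ x x′ → h x ≡ h x′ → x ≡ x′) → (f : Y → ℕ) →
    ∑[ y ] (𝟙 (any? λ x → h x ≟ y) * f y) ≡ ∑[ x ] f (h x)
  ∑-image h inj f = begin
    ∑[ y ] (𝟙 (any? λ x → h x ≟ y) * f y)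
      ≡⟨ ∑-cong (λ y → trans (cong (_* f y) (sym (count-≤1 (λ x → h x ≟ y) λ x x′ p p′ → inj x x′ (trans p (sym p′)))))
                             (sym (∑-*ʳ {X = X} (f y) _))) ⟩
    ∑[ y ] ∑[ x ] (𝟙 (h x ≟ y) * f y)
      ≡⟨ ∑-swap {X = Y} _ ⟩
    ∑[ x ] ∑[ y ] (𝟙 (h x ≟ y) * f y)
      ≡⟨ ∑-cong (λ x → ∑-at (h x) f) ⟩
    ∑[ x ] f (h x) ∎
    where open ≡-Reasoning

  count-image : (h : X → Y) → (∀ x x′ → h x ≡ h x′ → x ≡ x′) →
    count (λ y → any? λ x → h x ≟ y) ≡ ∣ X ∣
  count-image h inj = begin
    count (λ y → any? λ x → h x ≟ y)      ≡⟨ ∑-cong (λ y → sym (ℕ.*-identityʳ _)) ⟩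
    ∑[ y ] (𝟙 (any? λ x → h x ≟ y) * 1)   ≡⟨ ∑-image h inj (λ _ → 1) ⟩
    ∑ {X} (λ _ → 1)                       ≡⟨ ∑-const 1 ⟩
    ∣ X ∣ * 1                             ≡⟨ ℕ.*-identityʳ _ ⟩
    ∣ X ∣                                 ∎
    where open ≡-Reasoning

  injective⇒surjective : (h : X → Y) → (∀ x x′ → h x ≡ h x′ → x ≡ x′) → ∣ X ∣ ≡ ∣ Y ∣ → ∀ y → ∃ λ x → h x ≡ y
  injective⇒surjective h inj eq y =
    count-⊆-≡ (λ y → any? λ x → h x ≟ y) (λ y → y ≟ y) (λ _ _ → refl)
      (trans (count-image h inj) (trans eq (sym (count-all (λ y → y ≟ y) λ _ → refl)))) y refl

instance
  finite-Fin : ∀ {n} → Finite (Fin n)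
  finite-Fin = finite _ (mk↔ₛ′ id id (λ _ → refl) (λ _ → refl))

  finite-× : {X Y : Set} {{_ : Finite X}} {{_ : Finite Y}} → Finite (X × Y)
  finite-× {{finX}} {{finY}} = finite (X.size * Y.size) (mk↔ₛ′
    (λ (x , y) → Fin.combine (X.to x) (Y.to y))
    (λ i → X.from (Fin.quotient Y.size i) , Y.from (Fin.remainder {X.size} Y.size i))
    (λ i → trans (cong₂ Fin.combine (X.to-from _) (Y.to-from _)) (Fin.combine-remQuot {X.size} Y.size i))
    (λ (x , y) → let eq = Fin.remQuot-combine (X.to x) (Y.to y) in
      cong₂ _,_ (trans (cong (X.from ∘ proj₁) eq) (X.from-to x))
                (trans (cong (Y.from ∘ proj₂) eq) (Y.from-to y))))
    where
    module X = Finite finX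
    module Y = Finite finY

-- Inserting the indicator of z = (x , y) and exchanging the sums gives Fubini without unfolding how
-- pairs are numbered.
∑-× : {X Y : Set} {{_ : Finite X}} {{_ : Finite Y}} (f : X → Y → ℕ) →
  ∑[ z ] f (proj₁ z) (proj₂ z) ≡ ∑[ x ] ∑[ y ] f x y
∑-× {X} {Y} f = begin
  ∑[ z ] f (proj₁ z) (proj₂ z)
    ≡⟨ ∑-cong {X = X × Y} (λ z → sym (trans (∑-cong λ x → trans (∑-cong λ y → lemma z x y) (∑-*ˡ {X = Y} (𝟙 (proj₁ z ≟ x)) _))
                   (trans (∑-at (proj₁ z) _) (∑-at (proj₂ z) (f (proj₁ z)))))) ⟩
  ∑[ z ] ∑[ x ] ∑[ y ] (𝟙 (z ≟ (x , y)) * f x y)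
    ≡⟨ ∑-swap {X = X × Y} _ ⟩
  ∑[ x ] ∑[ z ] ∑[ y ] (𝟙 (z ≟ (x , y)) * f x y)
    ≡⟨ ∑-cong {X = X} (λ x → ∑-swap {X = X × Y} _) ⟩
  ∑[ x ] ∑[ y ] ∑[ z ] (𝟙 (z ≟ (x , y)) * f x y)
    ≡⟨ ∑-cong {X = X} (λ x → ∑-cong {X = Y} λ y → trans (∑-cong {X = X × Y} λ z → cong (_* f x y) (𝟙-cong (z ≟ (x , y)) ((x , y) ≟ z) sym sym)) (∑-at (x , y) (λ _ → f x y))) ⟩
  ∑[ x ] ∑[ y ] f x y ∎
  where
  open ≡-Reasoning
  lemma : ∀ z x y → 𝟙 (z ≟ (x , y)) * f x y ≡ 𝟙 (proj₁ z ≟ x) * (𝟙 (proj₂ z ≟ y) * f x y)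
  lemma z x y = trans (cong (_* f x y) (trans
      (𝟙-cong (z ≟ (x , y)) ((proj₁ z ≟ x) ×-dec (proj₂ z ≟ y)) (λ { refl → refl , refl }) (λ { (refl , refl) → refl }))
      (𝟙-× (proj₁ z ≟ x) (proj₂ z ≟ y))))
    (ℕ.*-assoc (𝟙 (proj₁ z ≟ x)) _ _)

-- Representatives of equivalence classes

record Transversal {X : Set} (P : X → Set) (_∼_ : X → X → Set) (k : ℕ) : Set where
  field
    rep      : Fin k → X
    rep∈P    : ∀ i → P (rep i)
    class    : ∀ x → P x → ∃ λ i → x ∼ rep i
    distinct : ∀ i j → rep i ∼ rep j → i ≡ j

module _ {X : Set} {{finX : Finite X}} {P : X → Set} (P? : ∀ x → Dec (P x))
  {_∼_ : X → X → Set} (_∼?_ : ∀ x y → Dec (x ∼ y))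
  (∼-refl : ∀ x → x ∼ x) (∼-sym : ∀ {x y} → x ∼ y → y ∼ x) (∼-trans : ∀ {x y z} → x ∼ y → y ∼ z → x ∼ z)
  where
  private module X = Finite finX

  private
    -- A new element of `P` joins the representatives found in the tail only if it is equivalent to
    -- none of them.
    greedy : ∀ {m} (g : Fin m → X) → ∃ λ k → Transversal (λ x → P x × ∃ λ i → g i ≡ x) _∼_ k
    greedy {zero} g = 0 , record { rep = λ () ; rep∈P = λ () ; class = λ { _ (_ , () , _) } ; distinct = λ () }
    greedy {suc m} g with greedy (g ∘ suc)
    ... | k , T with P? (g zero) | any? (λ i → g zero ∼? Transversal.rep T i)
    ...   | no ¬p | _ = k , record
      { rep = rep
      ; rep∈P = λ i → let (p , j , eq) = rep∈P i in p , suc j , eq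
      ; class = λ { x (p , zero , eq) → contradiction (subst P (sym eq) p) ¬p
                  ; x (p , suc j , eq) → class x (p , j , eq) }
      ; distinct = distinct }
      where open Transversal T
    ...   | yes p | yes (i₀ , r₀) = k , record
      { rep = rep
      ; rep∈P = λ i → let (p , j , eq) = rep∈P i in p , suc j , eq
      ; class = λ { x (p , zero , eq) → i₀ , subst (_∼ rep i₀) eq r₀
                  ; x (p , suc j , eq) → class x (p , j , eq) }
      ; distinct = distinct }
      where open Transversal T
    ...   | yes p₀ | no ¬r = suc k , record
      { rep = λ { zero → g zero ; (suc i) → rep i }
      ; rep∈P = λ { zero → p₀ , zero , refl ; (suc i) → let (p , j , eq) = rep∈P i in p , suc j , eq }
      ; class = λ { x (p , zero , eq) → zero , subst (_∼ g zero) eq (∼-refl (g zero))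
                  ; x (p , suc j , eq) → let (i , r) = class x (p , j , eq) in suc i , r }
      ; distinct = λ { zero zero _ → refl
                     ; zero (suc j) r → contradiction (j , r) ¬r
                     ; (suc i) zero r → contradiction (i , ∼-sym r) ¬r
                     ; (suc i) (suc j) r → cong suc (distinct i j r) } }
      where open Transversal T

    transversal : ∃ λ k → Transversal P _∼_ k
    transversal = proj₁ (greedy X.from) , record
      { rep = rep
      ; rep∈P = proj₁ ∘ rep∈P
      ; class = λ x p → class x (p , X.to x , X.from-to x)
      ; distinct = distinct }
      where open Transversal (proj₂ (greedy X.from))

  -- Summing the class sizes over the representatives gives `count P?` = k′ * g, and comparison with
  -- k * g fixes the number of representatives. This is how a count of bases becomes a count of
  -- lines.
  equal-classes⇒transversal : ∀ {g k} → g ≢ 0 →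
    (∀ a → P a → count (λ x → P? x ×-dec (x ∼? a)) ≡ g) → count P? ≡ k * g → Transversal P _∼_ k
  equal-classes⇒transversal {g} {k} g≢0 classSize total = subst (Transversal P _∼_) k′≡k T
    where
    k′ = proj₁ transversal
    T  = proj₂ transversal
    open Transversal T
    open ≡-Reasoning
    k′*g : count P? ≡ k′ * g
    k′*g = begin
      ∑[ x ] 𝟙 (P? x)
        ≡⟨ ∑-cong (λ x → trans (sym (ℕ.*-identityʳ _)) (trans (𝟙-*-cong (P? x) λ p → let (i , r) = class x p in
             sym (count-unique (λ i → x ∼? rep i) i r λ j r′ → distinct j i (∼-trans (∼-sym r′) r))) (sym (∑-*ˡ (𝟙 (P? x)) _)))) ⟩
      ∑[ x ] ∑[ i ] (𝟙 (P? x) * 𝟙 (x ∼? rep i))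
        ≡⟨ ∑-swap _ ⟩
      ∑[ i ] ∑[ x ] (𝟙 (P? x) * 𝟙 (x ∼? rep i))
        ≡⟨ ∑-cong (λ i → trans (∑-cong λ x → sym (𝟙-× (P? x) (x ∼? rep i))) (classSize (rep i) (rep∈P i))) ⟩
      ∑ {Fin k′} (λ _ → g)
        ≡⟨ ∑-const g ⟩
      k′ * g ∎
    k′≡k : k′ ≡ k
    k′≡k = ℕ.*-cancelʳ-≡ k′ k g {{≢-nonZero g≢0}} (trans (sym k′*g) total)

-- Finite fields

[1+k]*[1+n]C[1+k] : ∀ n k → suc k * (suc n choose suc k) ≡ suc n * (n choose k)
[1+k]*[1+n]C[1+k] zero    zero    = refl
[1+k]*[1+n]C[1+k] zero    (suc k) = trans (cong (suc (suc k) *_) (k>n⇒nCk≡0 {1} {suc (suc k)} (s≤s (s≤s z≤n)))) (ℕ.*-zeroʳ (suc (suc k)))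
[1+k]*[1+n]C[1+k] (suc n) zero    = begin
  1 * (suc (suc n) choose 1)         ≡⟨ cong (1 *_) (nCk+nC[k+1]≡[n+1]C[k+1] (suc n) 0) ⟨
  1 * (1 + (suc n choose 1))         ≡⟨ ℕ.*-distribˡ-+ 1 1 _ ⟩
  1 + 1 * (suc n choose 1)           ≡⟨ cong (1 +_) ([1+k]*[1+n]C[1+k] n 0) ⟩
  suc (suc n) * 1               ∎
  where open ≡-Reasoning
[1+k]*[1+n]C[1+k] (suc n) (suc k) = begin
  suc (suc k) * (suc (suc n) choose suc (suc k))
    ≡⟨ cong (suc (suc k) *_) (nCk+nC[k+1]≡[n+1]C[k+1] (suc n) (suc k)) ⟨
  suc (suc k) * (a + (suc n choose suc (suc k)))
    ≡⟨ ℕ.*-distribˡ-+ (suc (suc k)) a _ ⟩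
  (a + suc k * a) + suc (suc k) * (suc n choose suc (suc k))
    ≡⟨ cong₂ (λ u v → (a + u) + v) ([1+k]*[1+n]C[1+k] n k) ([1+k]*[1+n]C[1+k] n (suc k)) ⟩
  (a + suc n * (n choose k)) + suc n * (n choose suc k)
    ≡⟨ ℕ.+-assoc a _ _ ⟩
  a + (suc n * (n choose k) + suc n * (n choose suc k))
    ≡⟨ cong (a +_) (ℕ.*-distribˡ-+ (suc n) (n choose k) _) ⟨
  a + suc n * ((n choose k) + (n choose suc k))
    ≡⟨ cong (λ u → a + suc n * u) (nCk+nC[k+1]≡[n+1]C[k+1] n k) ⟩
  suc (suc n) * a ∎
  where
  open ≡-Reasoning
  a = suc n choose suc k

-- By the absorption identity p divides (k + 1) C(p , k + 1), and p does not divide the smaller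
-- number k + 1.
prime∣pCk : ∀ {p} → Prime p → ∀ k → suc k < p → p ∣ (p choose suc k)
prime∣pCk {suc n} pr k k<p with euclidsLemma (suc k) (suc n choose suc k) pr
  (subst (suc n ∣_) (sym ([1+k]*[1+n]C[1+k] n k)) (m∣m*n (n choose k)))
... | inj₁ p∣k = contradiction (∣⇒≤ p∣k) (ℕ.<⇒≱ k<p)
... | inj₂ p∣C = p∣C

IsPrimePower⇒2≤ : ∀ {q} → IsPrimePower q → 2 ≤ q
IsPrimePower⇒2≤ (p , h , prime-p , 1≤h , refl) =
  ℕ.≤-trans (nonTrivial⇒n>1 p {{prime⇒nonTrivial prime-p}})
    (subst (_≤ p ^ h) (ℕ.*-identityʳ p) (ℕ.^-monoʳ-≤ p {{prime⇒nonZero prime-p}} 1≤h))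

module FieldProperties (K : Field) where
  open Field K
  open CommutativeRing commutativeRing public
    using (+-assoc; +-comm; +-identityˡ; +-identityʳ; -‿inverseˡ; -‿inverseʳ; *-assoc; *-comm; *-identityˡ; *-identityʳ;
           distribˡ; distribʳ; zeroˡ; zeroʳ; ring; commutativeSemiring; semiring; +-commutativeMonoid; *-commutativeMonoid)
  open RingProperties ring public
    using (-‿distribˡ-*; -‿distribʳ-*; -‿involutive; -‿+-comm; -0#≈0#)
  open Exp semiring public using (^-assocʳ)
  open CommutativeExp commutativeSemiring public using (^-distrib-*)
  open Mult semiring public using (×1-homo-*; ×-assoc-*) renaming (_×_ to _·_; ×-assocˡ to ·-assocˡ)
  open ≡-Reasoning

  x+y≡0⇒y≡-x : ∀ {x y} → x +ᶠ y ≡ 0# → y ≡ -ᶠ x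
  x+y≡0⇒y≡-x {x} {y} p = begin
    y                  ≡⟨ +-identityˡ y ⟨
    0# +ᶠ y            ≡⟨ cong (_+ᶠ y) (-‿inverseˡ x) ⟨
    -ᶠ x +ᶠ x +ᶠ y     ≡⟨ +-assoc _ _ _ ⟩
    -ᶠ x +ᶠ (x +ᶠ y)   ≡⟨ cong (-ᶠ x +ᶠ_) p ⟩
    -ᶠ x +ᶠ 0#         ≡⟨ +-identityʳ _ ⟩
    -ᶠ x               ∎

  +-cancelˡ : ∀ x {y z} → x +ᶠ y ≡ x +ᶠ z → y ≡ z
  +-cancelˡ x {y} {z} p = trans (lemma y) (trans (cong (-ᶠ x +ᶠ_) p) (sym (lemma z)))
    where
    lemma : ∀ y → y ≡ -ᶠ x +ᶠ (x +ᶠ y)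
    lemma y = sym (trans (sym (+-assoc _ _ _)) (trans (cong (_+ᶠ y) (-‿inverseˡ x)) (+-identityˡ y)))

  x-y≡0⇒x≡y : ∀ {x y} → x +ᶠ -ᶠ y ≡ 0# → x ≡ y
  x-y≡0⇒x≡y {x} {y} p = +-cancelˡ (-ᶠ y) (trans (trans (+-comm _ _) p) (sym (-‿inverseˡ y)))

  inv : ∀ x → x ≢ 0# → Carrier
  inv x x≢0 = proj₁ (invertible x x≢0)

  inv-*ˡ : ∀ x x≢0 y → inv x x≢0 *ᶠ (x *ᶠ y) ≡ y
  inv-*ˡ x x≢0 y = trans (sym (*-assoc _ _ _)) (trans (cong (_*ᶠ y) (proj₁ (proj₂ (invertible x x≢0)))) (*-identityˡ y))

  *-invˡ : ∀ x x≢0 y → x *ᶠ (inv x x≢0 *ᶠ y) ≡ y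
  *-invˡ x x≢0 y = trans (sym (*-assoc _ _ _)) (trans (cong (_*ᶠ y) (proj₂ (proj₂ (invertible x x≢0)))) (*-identityˡ y))

  xy≡0⇒y≡0 : ∀ {x y} → x ≢ 0# → x *ᶠ y ≡ 0# → y ≡ 0#
  xy≡0⇒y≡0 {x} {y} x≢0 p = trans (sym (inv-*ˡ x x≢0 y)) (trans (cong (inv x x≢0 *ᶠ_) p) (zeroʳ _))

  *-≢0 : ∀ {x y} → x ≢ 0# → y ≢ 0# → x *ᶠ y ≢ 0#
  *-≢0 x≢0 y≢0 p = y≢0 (xy≡0⇒y≡0 x≢0 p)

  *-cancelˡ : ∀ {x y z} → x ≢ 0# → x *ᶠ y ≡ x *ᶠ z → y ≡ z
  *-cancelˡ {x} {y} {z} x≢0 p = trans (sym (inv-*ˡ x x≢0 y)) (trans (cong (inv x x≢0 *ᶠ_) p) (inv-*ˡ x x≢0 z))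

  -‿≢0 : ∀ {x} → x ≢ 0# → -ᶠ x ≢ 0#
  -‿≢0 {x} x≢0 p = x≢0 (trans (sym (-‿involutive x)) (trans (cong -ᶠ_ p) -0#≈0#))

  -- A vector of n coefficients, constant term first, stands for the monic
  -- polynomial of degree n with these lower coefficients.
  eval : ∀ {n} → Vec Carrier n → Carrier → Carrier
  eval []      x = 1#
  eval (c ∷ p) x = c +ᶠ x *ᶠ eval p x

  -- Horner's scheme for division by X - a: the coefficients are the values at a of the successive
  -- tails, and the leading coefficient 1 stays implicit.
  quot : ∀ {n} → Vec Carrier (suc n) → Carrier → Vec Carrier n
  quot (c ∷ [])    a = []
  quot (c ∷ d ∷ p) a = eval (d ∷ p) a ∷ quot (d ∷ p) a

  +-medial : ∀ a b c d → (a +ᶠ b) +ᶠ (c +ᶠ d) ≡ (a +ᶠ c) +ᶠ (b +ᶠ d)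
  +-medial a b c d = begin
    (a +ᶠ b) +ᶠ (c +ᶠ d)   ≡⟨ +-assoc _ _ _ ⟩
    a +ᶠ (b +ᶠ (c +ᶠ d))   ≡⟨ cong (a +ᶠ_) (trans (sym (+-assoc _ _ _)) (trans (cong (_+ᶠ d) (+-comm b c)) (+-assoc _ _ _))) ⟩
    a +ᶠ (c +ᶠ (b +ᶠ d))   ≡⟨ +-assoc _ _ _ ⟨
    (a +ᶠ c) +ᶠ (b +ᶠ d)   ∎

  [x-a]y+ay : ∀ x a y → (x +ᶠ -ᶠ a) *ᶠ y +ᶠ a *ᶠ y ≡ x *ᶠ y
  [x-a]y+ay x a y = trans (sym (distribʳ _ _ _)) (cong (_*ᶠ y)
    (trans (+-assoc _ _ _) (trans (cong (x +ᶠ_) (-‿inverseˡ a)) (+-identityʳ x))))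

  eval-quot : ∀ {n} (p : Vec Carrier (suc n)) a x → eval p x ≡ eval p a +ᶠ (x +ᶠ -ᶠ a) *ᶠ eval (quot p a) x
  eval-quot (c ∷ []) a x = begin
    c +ᶠ x *ᶠ 1#                                  ≡⟨ cong (c +ᶠ_) ([x-a]y+ay x a 1#) ⟨
    c +ᶠ ((x +ᶠ -ᶠ a) *ᶠ 1# +ᶠ a *ᶠ 1#)           ≡⟨ cong (c +ᶠ_) (+-comm _ _) ⟩
    c +ᶠ (a *ᶠ 1# +ᶠ (x +ᶠ -ᶠ a) *ᶠ 1#)           ≡⟨ +-assoc _ _ _ ⟨
    c +ᶠ a *ᶠ 1# +ᶠ (x +ᶠ -ᶠ a) *ᶠ 1#             ∎
  eval-quot (c ∷ p@(d ∷ _)) a x = begin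
    c +ᶠ x *ᶠ eval p x
      ≡⟨ cong (λ u → c +ᶠ x *ᶠ u) (eval-quot p a x) ⟩
    c +ᶠ x *ᶠ (eval p a +ᶠ (x +ᶠ -ᶠ a) *ᶠ g)
      ≡⟨ cong (c +ᶠ_) (distribˡ _ _ _) ⟩
    c +ᶠ (x *ᶠ eval p a +ᶠ x *ᶠ ((x +ᶠ -ᶠ a) *ᶠ g))
      ≡⟨ cong₂ (λ u v → c +ᶠ (u +ᶠ v)) (trans (sym ([x-a]y+ay x a _)) (+-comm _ _))
                (trans (sym (*-assoc _ _ _)) (trans (cong (_*ᶠ g) (*-comm _ _)) (*-assoc _ _ _))) ⟩
    c +ᶠ ((a *ᶠ eval p a +ᶠ (x +ᶠ -ᶠ a) *ᶠ eval p a) +ᶠ (x +ᶠ -ᶠ a) *ᶠ (x *ᶠ g))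
      ≡⟨ trans (cong (c +ᶠ_) (+-assoc _ _ _)) (sym (+-assoc _ _ _)) ⟩
    (c +ᶠ a *ᶠ eval p a) +ᶠ ((x +ᶠ -ᶠ a) *ᶠ eval p a +ᶠ (x +ᶠ -ᶠ a) *ᶠ (x *ᶠ g))
      ≡⟨ cong ((c +ᶠ a *ᶠ eval p a) +ᶠ_) (distribˡ _ _ _) ⟨
    (c +ᶠ a *ᶠ eval p a) +ᶠ (x +ᶠ -ᶠ a) *ᶠ (eval p a +ᶠ x *ᶠ g) ∎
    where g = eval (quot p a) x

  -- Splitting off X - `root zero` leaves the other roots to a monic quotient of smaller degree; in
  -- degree 0 the value is 1.
  roots-≤-degree : ∀ {n} (p : Vec Carrier n) (root : Fin (suc n) → Carrier) →
    (∀ i j → root i ≡ root j → i ≡ j) → ¬ (∀ i → eval p (root i) ≡ 0#)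
  roots-≤-degree []        root inj z = 1#≢0# (z zero)
  roots-≤-degree p@(_ ∷ _) root inj z =
    roots-≤-degree (quot p (root zero)) (root ∘ suc) (λ i j eq → Fin.suc-injective (inj _ _ eq)) λ i →
      xy≡0⇒y≡0 (λ eq → Fin.0≢1+n (inj zero (suc i) (sym (x-y≡0⇒x≡y eq)))) (begin
        (root (suc i) +ᶠ -ᶠ root zero) *ᶠ eval (quot p (root zero)) (root (suc i))
          ≡⟨ trans (cong₂ _+ᶠ_ (z zero) refl) (+-identityˡ _) ⟨
        eval p (root zero) +ᶠ (root (suc i) +ᶠ -ᶠ root zero) *ᶠ eval (quot p (root zero)) (root (suc i))
          ≡⟨ eval-quot p (root zero) (root (suc i)) ⟨
        eval p (root (suc i))
          ≡⟨ z (suc i) ⟩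
        0# ∎)

  module _ {{finK : Finite Carrier}} where
    private
      module Σ⁺ = SemiringSum semiring
      module Π = CommutativeMonoidSum *-commutativeMonoid
      module K = Finite finK

    -- Translation by 1 permutes the field, so the sum of all elements does not change when
    -- `∣ Carrier ∣ · 1#` is added to it.
    order·1≡0 : ∣ Carrier ∣ · 1# ≡ 0#
    order·1≡0 = +-cancelˡ total (begin
      total +ᶠ ∣ Carrier ∣ · 1#
        ≡⟨ cong (total +ᶠ_) (Σ⁺.sum-replicate ∣ Carrier ∣) ⟨
      total +ᶠ sumOver +-commutativeMonoid {X = Carrier} (λ _ → 1#)
        ≡⟨ Σ⁺.∑-distrib-+ K.from (λ _ → 1#) ⟨
      sumOver +-commutativeMonoid (_+ᶠ 1#)
        ≡⟨ sumOver-reindex +-commutativeMonoid (_+ᶠ 1#) (_+ᶠ -ᶠ 1#)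
             (λ y → trans (+-assoc _ _ _) (trans (cong (y +ᶠ_) (-‿inverseˡ 1#)) (+-identityʳ y)))
             (λ y → trans (+-assoc _ _ _) (trans (cong (y +ᶠ_) (-‿inverseʳ 1#)) (+-identityʳ y))) id ⟩
      total
        ≡⟨ +-identityʳ total ⟨
      total +ᶠ 0# ∎)
      where
      total : Carrier
      total = sumOver +-commutativeMonoid {X = Carrier} id

    private
      -- Lets a product over the nonzero elements run over the whole field, with a prescribed factor
      -- at 0.
      at0 : Carrier → Carrier → Carrier → Carrier
      at0 x u v with x ≟ 0#
      ... | yes _ = u
      ... | no _  = v

      at0-yes : ∀ {x u v} → x ≡ 0# → at0 x u v ≡ u
      at0-yes {x} p with x ≟ 0#
      ... | yes _ = refl
      ... | no ¬p = contradiction p ¬p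

      at0-no : ∀ {x u v} → x ≢ 0# → at0 x u v ≡ v
      at0-no {x} ¬p with x ≟ 0#
      ... | yes p = contradiction p ¬p
      ... | no _  = refl

      ∏ : (Carrier → Carrier) → Carrier
      ∏ = sumOver *-commutativeMonoid

      ∏≢0 : ∀ (h : Carrier → Carrier) → (∀ x → h x ≢ 0#) → ∏ h ≢ 0#
      ∏≢0 h h≢0 = go (h ∘ K.from) (h≢0 ∘ K.from)
        where
        go : ∀ {n} (g : Fin n → Carrier) → (∀ i → g i ≢ 0#) → Π.sum g ≢ 0#
        go {zero}  g z = 1#≢0#
        go {suc n} g z = *-≢0 (z zero) (go (g ∘ suc) (z ∘ suc))

    order-positive : ∃ λ k → ∣ Carrier ∣ ≡ suc k
    order-positive with ∣ Carrier ∣ | K.to 0#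
    ... | suc k | _ = k , refl

    -- Compare the product of all nonzero elements with its translate by x.
    x^order≡x : ∀ x → x ^ᶠ ∣ Carrier ∣ ≡ x
    x^order≡x x with x ≟ 0#
    ... | yes refl = let (k , eq) = order-positive in trans (cong (0# ^ᶠ_) eq) (zeroˡ (0# ^ᶠ k))
    ... | no x≢0 = begin
      x ^ᶠ ∣ Carrier ∣
        ≡⟨ Π.sum-replicate ∣ Carrier ∣ ⟨
      ∏ (λ _ → x)
        ≡⟨ Π.sum-cong-≗ (λ i → sym (split (K.from i))) ⟩
      ∏ (λ y → at0 y 1# x *ᶠ at0 y x 1#)
        ≡⟨ Π.∑-distrib-+ {∣ Carrier ∣} _ _ ⟩
      ∏ (λ y → at0 y 1# x) *ᶠ ∏ (λ y → at0 y x 1#)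
        ≡⟨ cong₂ _*ᶠ_ trivial (trans (sumOver-single *-commutativeMonoid 0# (λ y y≢0 → at0-no y≢0)) (at0-yes refl)) ⟩
      1# *ᶠ x
        ≡⟨ *-identityˡ x ⟩
      x ∎
      where
      h : Carrier → Carrier
      h y = at0 y 1# y

      h≢0 : ∀ y → h y ≢ 0#
      h≢0 y p with y ≟ 0#
      ... | yes _   = 1#≢0# p
      ... | no y≢0 = y≢0 p

      split : ∀ y → at0 y 1# x *ᶠ at0 y x 1# ≡ x
      split y with y ≟ 0#
      ... | yes _ = *-identityˡ x
      ... | no _  = *-identityʳ x

      h-* : ∀ y → at0 y 1# x *ᶠ h y ≡ h (x *ᶠ y)
      h-* y with y ≟ 0#
      ... | yes refl = trans (*-identityˡ 1#) (sym (at0-yes (zeroʳ x)))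
      ... | no y≢0   = sym (at0-no (*-≢0 x≢0 y≢0))

      trivial : ∏ (λ y → at0 y 1# x) ≡ 1#
      trivial = *-cancelˡ (∏≢0 h h≢0) (begin
        ∏ h *ᶠ ∏ (λ y → at0 y 1# x)          ≡⟨ *-comm _ _ ⟩
        ∏ (λ y → at0 y 1# x) *ᶠ ∏ h          ≡⟨ Π.∑-distrib-+ {∣ Carrier ∣} _ _ ⟨
        ∏ (λ y → at0 y 1# x *ᶠ h y)          ≡⟨ Π.sum-cong-≗ (λ i → h-* (K.from i)) ⟩
        ∏ (λ y → h (x *ᶠ y))                 ≡⟨ sumOver-reindex *-commutativeMonoid (x *ᶠ_) (inv x x≢0 *ᶠ_) (*-invˡ x x≢0) (inv-*ˡ x x≢0) h ⟩
        ∏ h                                  ≡⟨ *-identityʳ _ ⟨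
        ∏ h *ᶠ 1#                            ∎)

  1^n≡1 : ∀ n → 1# ^ᶠ n ≡ 1#
  1^n≡1 zero    = refl
  1^n≡1 (suc n) = trans (*-identityˡ _) (1^n≡1 n)

  [p^h]·1 : ∀ p h → (p ^ h) · 1# ≡ (p · 1#) ^ᶠ h
  [p^h]·1 p zero    = +-identityʳ 1#
  [p^h]·1 p (suc h) = trans (×1-homo-* p (p ^ h)) (cong (p · 1# *ᶠ_) ([p^h]·1 p h))

  -- p^h times 1 is (p · 1)^h, and the order of the field annihilates 1; a field has no nonzero
  -- nilpotents.
  characteristic : ∀ p h {{_ : Finite Carrier}} → ∣ Carrier ∣ ≡ p ^ h → p · 1# ≡ 0#
  characteristic p h ord with (p · 1#) ≟ 0#
  ... | yes eq = eq
  ... | no neq = contradiction (trans (sym ([p^h]·1 p h)) (trans (cong (_· 1#) (sym ord)) order·1≡0)) (^-≢0 h)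
    where
    ^-≢0 : ∀ h → (p · 1#) ^ᶠ h ≢ 0#
    ^-≢0 zero    = 1#≢0#
    ^-≢0 (suc h) = *-≢0 neq (^-≢0 h)

  module _ {p} (pr : Prime p) (p·1≡0 : p · 1# ≡ 0#) where
    private
      p·x≡0 : ∀ x → p · x ≡ 0#
      p·x≡0 x = begin
        p · x              ≡⟨ cong (p ·_) (*-identityˡ x) ⟨
        p · (1# *ᶠ x)      ≡⟨ ×-assoc-* p 1# x ⟨
        (p · 1#) *ᶠ x      ≡⟨ cong (_*ᶠ x) p·1≡0 ⟩
        0# *ᶠ x            ≡⟨ zeroˡ x ⟩
        0#                 ∎

      ∣⇒·≡0 : ∀ {m} → p ∣ m → ∀ x → m · x ≡ 0#
      ∣⇒·≡0 (divides k refl) x = begin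
        (k * p) · x   ≡⟨ cong (_· x) (ℕ.*-comm k p) ⟩
        (p * k) · x   ≡⟨ ·-assocˡ x p k ⟨
        p · (k · x)   ≡⟨ p·x≡0 _ ⟩
        0#            ∎

    -- All inner binomial coefficients are multiples of p, so only the two outer terms of the
    -- expansion survive.
    ^p-+ : ∀ x y → (x +ᶠ y) ^ᶠ p ≡ x ^ᶠ p +ᶠ y ^ᶠ p
    ^p-+ x y = trans (Binomial.theorem commutativeSemiring p x y) (expand p refl)
      where
      module Σ⁺ = SemiringSum semiring
      expand : ∀ m → m ≡ p → Binomial.binomialExpansion commutativeSemiring x y m ≡ x ^ᶠ m +ᶠ y ^ᶠ m
      expand zero    refl = contradiction refl (≢-nonZero⁻¹ 0 {{prime⇒nonZero pr}})
      expand (suc n) refl = begin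
        term zero +ᶠ Σ⁺.sum (term ∘ suc)
          ≡⟨ cong₂ _+ᶠ_ (trans (+-identityʳ _) (*-identityˡ _)) (Σ⁺.sum-init-last (term ∘ suc)) ⟩
        y ^ᶠ p +ᶠ (Σ⁺.sum (term ∘ suc ∘ inject₁) +ᶠ term (fromℕ p))
          ≡⟨ cong₂ (λ u v → y ^ᶠ p +ᶠ (u +ᶠ v))
               (trans (Σ⁺.sum-cong-≗ middle) (Σ⁺.sum-replicate-zero n)) last-term ⟩
        y ^ᶠ p +ᶠ (0# +ᶠ x ^ᶠ p)
          ≡⟨ trans (cong (y ^ᶠ p +ᶠ_) (+-identityˡ _)) (+-comm _ _) ⟩
        x ^ᶠ p +ᶠ y ^ᶠ p ∎
        where
        term = Binomial.binomialTerm commutativeSemiring x y p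
        middle : ∀ (i : Fin n) → term (suc (inject₁ i)) ≡ 0#
        middle i = ∣⇒·≡0 (prime∣pCk pr (toℕ (inject₁ i)) (s≤s (subst (_< n) (sym (Fin.toℕ-inject₁ i)) (Fin.toℕ<n i)))) _
        last-term : term (fromℕ p) ≡ x ^ᶠ p
        last-term = begin
          (p choose toℕ (fromℕ p)) · (x ^ᶠ toℕ (fromℕ p) *ᶠ y ^ᶠ (p ∸ toℕ (fromℕ p)))
            ≡⟨ cong (λ k → (p choose k) · (x ^ᶠ k *ᶠ y ^ᶠ (p ∸ k))) (Fin.toℕ-fromℕ p) ⟩
          (p choose p) · (x ^ᶠ p *ᶠ y ^ᶠ (p ∸ p))
            ≡⟨ cong₂ (λ c k → c · (x ^ᶠ p *ᶠ y ^ᶠ k)) (nCn≡1 p) (ℕ.n∸n≡0 p) ⟩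
          1 · (x ^ᶠ p *ᶠ 1#)
            ≡⟨ trans (+-identityʳ _) (*-identityʳ _) ⟩
          x ^ᶠ p ∎

    ^p^h-+ : ∀ h x y → (x +ᶠ y) ^ᶠ (p ^ h) ≡ x ^ᶠ (p ^ h) +ᶠ y ^ᶠ (p ^ h)
    ^p^h-+ zero    x y = trans (*-identityʳ _) (sym (cong₂ _+ᶠ_ (*-identityʳ x) (*-identityʳ y)))
    ^p^h-+ (suc h) x y = begin
      (x +ᶠ y) ^ᶠ (p * p ^ h)                       ≡⟨ ^-assocʳ (x +ᶠ y) p (p ^ h) ⟨
      ((x +ᶠ y) ^ᶠ p) ^ᶠ (p ^ h)                    ≡⟨ cong (_^ᶠ (p ^ h)) (^p-+ x y) ⟩
      (x ^ᶠ p +ᶠ y ^ᶠ p) ^ᶠ (p ^ h)                 ≡⟨ ^p^h-+ h _ _ ⟩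
      (x ^ᶠ p) ^ᶠ (p ^ h) +ᶠ (y ^ᶠ p) ^ᶠ (p ^ h)    ≡⟨ cong₂ _+ᶠ_ (^-assocʳ x p (p ^ h)) (^-assocʳ y p (p ^ h)) ⟩
      x ^ᶠ (p * p ^ h) +ᶠ y ^ᶠ (p * p ^ h)          ∎

  ^q-+ : {{_ : Finite Carrier}} → ∀ {q} m → IsPrimePower q → ∣ Carrier ∣ ≡ q ^ m →
    ∀ x y → (x +ᶠ y) ^ᶠ q ≡ x ^ᶠ q +ᶠ y ^ᶠ q
  ^q-+ m (p , h , prime-p , _ , refl) ord =
    ^p^h-+ prime-p (characteristic p (h * m) (trans ord (ℕ.^-*-assoc p h m))) h

  module _ {n : ℕ} where
    -- X^(n+2) − X
    fixedPolynomial : Vec Carrier (suc (suc n))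
    fixedPolynomial = 0# ∷ -ᶠ 1# ∷ replicate n 0#

    eval-replicate-0 : ∀ m x → eval (replicate m 0#) x ≡ x ^ᶠ m
    eval-replicate-0 zero    x = refl
    eval-replicate-0 (suc m) x = trans (+-identityˡ _) (cong (x *ᶠ_) (eval-replicate-0 m x))

    fixed⇒root : ∀ x → x ^ᶠ suc (suc n) ≡ x → eval fixedPolynomial x ≡ 0#
    fixed⇒root x fix = begin
      0# +ᶠ x *ᶠ (-ᶠ 1# +ᶠ x *ᶠ eval (replicate n 0#) x)   ≡⟨ +-identityˡ _ ⟩
      x *ᶠ (-ᶠ 1# +ᶠ x *ᶠ eval (replicate n 0#) x)         ≡⟨ cong (λ u → x *ᶠ (-ᶠ 1# +ᶠ x *ᶠ u)) (eval-replicate-0 n x) ⟩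
      x *ᶠ (-ᶠ 1# +ᶠ x ^ᶠ suc n)                           ≡⟨ distribˡ _ _ _ ⟩
      x *ᶠ -ᶠ 1# +ᶠ x ^ᶠ suc (suc n)                       ≡⟨ cong₂ _+ᶠ_ (trans (sym (-‿distribʳ-* x 1#)) (cong -ᶠ_ (*-identityʳ x))) fix ⟩
      -ᶠ x +ᶠ x                                            ≡⟨ -‿inverseˡ x ⟩
      0#                                                   ∎

module Hom {F E : Field} {ι : Field.Carrier F → Field.Carrier E} (ι-hom : IsFieldHomomorphism F E ι) where
  private
    module F = Field F
    module E = Field E
    module Fp = FieldProperties F
    module Ep = FieldProperties E
  open RingMorphisms.IsRingHomomorphism ι-hom public
    using () renaming (+-homo to ι-+; *-homo to ι-*; 0#-homo to ι-0; 1#-homo to ι-1; -‿homo to ι-neg)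

  ι-^ : ∀ x n → ι (x F.^ᶠ n) ≡ ι x E.^ᶠ n
  ι-^ x zero    = ι-1
  ι-^ x (suc n) = trans (ι-* x _) (cong (ι x E.*ᶠ_) (ι-^ x n))

  ι≡0⇒≡0 : {{_ : Finite F.Carrier}} → ∀ {x} → ι x ≡ E.0# → x ≡ F.0#
  ι≡0⇒≡0 {x} p with x ≟ F.0#
  ... | yes x≡0 = x≡0
  ... | no x≢0 = contradiction (begin
    E.1#                                  ≡⟨ ι-1 ⟨
    ι F.1#                                ≡⟨ cong ι (Fp.*-invˡ x x≢0 F.1#) ⟨
    ι (x F.*ᶠ (Fp.inv x x≢0 F.*ᶠ F.1#))   ≡⟨ ι-* _ _ ⟩
    ι x E.*ᶠ _                            ≡⟨ cong₂ E._*ᶠ_ p refl ⟩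
    E.0# E.*ᶠ _                           ≡⟨ Ep.zeroˡ _ ⟩
    E.0#                                  ∎) E.1#≢0#
    where open ≡-Reasoning

  ι-injective : {{_ : Finite F.Carrier}} → ∀ x y → ι x ≡ ι y → x ≡ y
  ι-injective x y p = Fp.x-y≡0⇒x≡y (ι≡0⇒≡0 (trans (ι-+ _ _)
    (trans (cong₂ E._+ᶠ_ p (ι-neg y)) (Ep.-‿inverseʳ (ι y)))))

-- The trace of a quadratic extension

module QuadraticExtension
  (q : ℕ) (primePower : IsPrimePower q) (F E : Field)
  (ordF : HasOrder F q) (ordE : HasOrder E (q ^ 2))
  (ι : Field.Carrier F → Field.Carrier E) (ι-hom : IsFieldHomomorphism F E ι)
  where

  private
    module F = Field F
    module E = Field E
    module Fp = FieldProperties F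
    module Ep = FieldProperties E
  open Hom {F} {E} {ι} ι-hom
  open E
  open ≡-Reasoning

  private
    instance
      finF : Finite F.Carrier
      finF = finite q ordF
      finE : Finite Carrier
      finE = finite (q ^ 2) ordE

  2≤q : 2 ≤ q
  2≤q = IsPrimePower⇒2≤ primePower

  σ : Carrier → Carrier
  σ x = x ^ᶠ q

  σ-+ : ∀ x y → σ (x +ᶠ y) ≡ σ x +ᶠ σ y
  σ-+ = Ep.^q-+ 2 primePower refl

  σ-* : ∀ x y → σ (x *ᶠ y) ≡ σ x *ᶠ σ y
  σ-* x y = Ep.^-distrib-* x y q

  σ-ι : ∀ c → σ (ι c) ≡ ι c
  σ-ι c = trans (sym (ι-^ c q)) (cong ι (Fp.x^order≡x c))

  σ-σ : ∀ x → σ (σ x) ≡ x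
  σ-σ x = trans (Ep.^-assocʳ x q q) (trans (cong (x ^ᶠ_) (cong (q *_) (sym (ℕ.*-identityʳ q)))) (Ep.x^order≡x x))

  -- A fixed point besides the q elements of ι F would be a root number q + 1 of X^q - X.
  ι-fixed : ∀ z → σ z ≡ z → ∃ λ c → ι c ≡ z
  ι-fixed z fix with any? (λ c → ι c ≟ z)
  ... | yes r = r
  ... | no ¬r = contradiction (λ { zero → root z fix ; (suc i) → root _ (σ-ι _) })
                  (roots-≤ (λ { zero → z ; (suc i) → ι (Finite.from finF i) }) distinct)
    where
    -- `fixedPolynomial {n}` is X^(n+2) - X, so n is q - 2; nothing is truncated because q ≥ 2.
    n : ℕ
    n = q ∸ 2
    q≡2+n : q ≡ suc (suc n)
    q≡2+n = sym (ℕ.m+[n∸m]≡n 2≤q)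
    root : ∀ x → σ x ≡ x → Ep.eval (Ep.fixedPolynomial {n}) x ≡ 0#
    root x fix = Ep.fixed⇒root {n} x (subst (λ m → x ^ᶠ m ≡ x) q≡2+n fix)
    roots-≤ : (root : Fin (suc q) → Carrier) → (∀ i j → root i ≡ root j → i ≡ j) →
      ¬ (∀ i → Ep.eval (Ep.fixedPolynomial {n}) (root i) ≡ 0#)
    roots-≤ = subst (λ m → (root : Fin (suc m) → Carrier) → (∀ i j → root i ≡ root j → i ≡ j) →
      ¬ (∀ i → Ep.eval (Ep.fixedPolynomial {n}) (root i) ≡ 0#)) (sym q≡2+n) (Ep.roots-≤-degree Ep.fixedPolynomial)
    distinct : ∀ i j → _ → i ≡ j
    distinct zero    zero    _  = refl
    distinct zero    (suc j) eq = contradiction (_ , sym eq) ¬r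
    distinct (suc i) zero    eq = contradiction (_ , eq) ¬r
    distinct (suc i) (suc j) eq = cong suc (trans (sym (Finite.to-from finF i))
      (trans (cong (Finite.to finF) (ι-injective _ _ eq)) (Finite.to-from finF j)))

  q<q² : q < q ^ 2
  q<q² = subst (q <_) (cong (q *_) (sym (ℕ.*-identityʳ q)))
    (ℕ.m<m*n q q {{≢-nonZero λ eq → ℕ.<⇒≱ (ℕ.≤-trans (s≤s z≤n) 2≤q) (ℕ.≤-reflexive eq)}} 2≤q)

  outside : ∃ λ z → ¬ ∃ λ c → ι c ≡ z
  outside with any? (λ z → ¬? (any? λ c → ι c ≟ z))
  ... | yes r = r
  ... | no ¬r = contradiction (trans (sym (count-image ι ι-injective)) (count-all _ λ z →
      decidable-stable (any? λ c → ι c ≟ z) λ ¬c → ¬r (z , ¬c)))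
    (ℕ.<⇒≢ q<q²)

  Tr : Carrier → Carrier
  Tr x = x +ᶠ σ x

  -- If the trace vanished, then σ z = - z for all z; z = 1 gives - 1 = 1, so σ would be the
  -- identity and `ι-fixed` would put all of E into F.
  Tr≢0 : ∃ λ x → Tr x ≢ 0#
  Tr≢0 with any? (λ x → ¬? (Tr x ≟ 0#))
  ... | yes r = r
  ... | no ¬r = contradiction (ι-fixed z (begin
      σ z          ≡⟨ Ep.x+y≡0⇒y≡-x (Tr≡0 z) ⟩
      -ᶠ z         ≡⟨ neg≡id z ⟩
      z            ∎)) (proj₂ outside)
    where
    z = proj₁ outside
    Tr≡0 : ∀ x → Tr x ≡ 0#
    Tr≡0 x = decidable-stable (Tr x ≟ 0#) λ neq → ¬r (x , neq)
    1≡-1 : -ᶠ 1# ≡ 1#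
    1≡-1 = trans (sym (Ep.x+y≡0⇒y≡-x (Tr≡0 1#))) (Ep.1^n≡1 q)
    neg≡id : ∀ x → -ᶠ x ≡ x
    neg≡id x = begin
      -ᶠ x             ≡⟨ cong -ᶠ_ (Ep.*-identityˡ x) ⟨
      -ᶠ (1# *ᶠ x)     ≡⟨ Ep.-‿distribˡ-* 1# x ⟩
      -ᶠ 1# *ᶠ x       ≡⟨ cong (_*ᶠ x) 1≡-1 ⟩
      1# *ᶠ x          ≡⟨ Ep.*-identityˡ x ⟩
      x                ∎

  Tr-fixed : ∀ x → σ (Tr x) ≡ Tr x
  Tr-fixed x = trans (σ-+ _ _) (trans (cong (σ x +ᶠ_) (σ-σ x)) (Ep.+-comm _ _))

  tr : Carrier → F.Carrier
  tr x = proj₁ (ι-fixed (Tr x) (Tr-fixed x))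

  ι-tr : ∀ x → ι (tr x) ≡ Tr x
  ι-tr x = proj₂ (ι-fixed (Tr x) (Tr-fixed x))

  tr-+ : ∀ x y → tr (x +ᶠ y) ≡ tr x F.+ᶠ tr y
  tr-+ x y = ι-injective _ _ (begin
    ι (tr (x +ᶠ y))                   ≡⟨ ι-tr _ ⟩
    (x +ᶠ y) +ᶠ σ (x +ᶠ y)            ≡⟨ cong ((x +ᶠ y) +ᶠ_) (σ-+ x y) ⟩
    (x +ᶠ y) +ᶠ (σ x +ᶠ σ y)          ≡⟨ Ep.+-medial x y _ _ ⟩
    Tr x +ᶠ Tr y                      ≡⟨ cong₂ _+ᶠ_ (ι-tr x) (ι-tr y) ⟨
    ι (tr x) +ᶠ ι (tr y)              ≡⟨ ι-+ _ _ ⟨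
    ι (tr x F.+ᶠ tr y)                ∎)

  tr-ι* : ∀ c x → tr (ι c *ᶠ x) ≡ c F.*ᶠ tr x
  tr-ι* c x = ι-injective _ _ (begin
    ι (tr (ι c *ᶠ x))                 ≡⟨ ι-tr _ ⟩
    ι c *ᶠ x +ᶠ σ (ι c *ᶠ x)          ≡⟨ cong (ι c *ᶠ x +ᶠ_) (trans (σ-* _ _) (cong (_*ᶠ σ x) (σ-ι c))) ⟩
    ι c *ᶠ x +ᶠ ι c *ᶠ σ x            ≡⟨ Ep.distribˡ _ _ _ ⟨
    ι c *ᶠ Tr x                       ≡⟨ cong (ι c *ᶠ_) (ι-tr x) ⟨
    ι c *ᶠ ι (tr x)                   ≡⟨ ι-* _ _ ⟨
    ι (c F.*ᶠ tr x)                   ∎)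

  -- For x ≠ 0 the products a x exhaust E, so they include an element of nonzero trace.
  tr-nondegenerate : ∀ x → (∀ a → tr (a *ᶠ x) ≡ F.0#) → x ≡ 0#
  tr-nondegenerate x z with x ≟ 0#
  ... | yes x≡0 = x≡0
  ... | no x≢0  = contradiction (begin
    Tr u                                  ≡⟨ ι-tr u ⟨
    ι (tr u)                              ≡⟨ cong (ι ∘ tr) (trans (Ep.*-comm _ x) (Ep.*-invˡ x x≢0 u)) ⟨
    ι (tr (Ep.inv x x≢0 *ᶠ u *ᶠ x))       ≡⟨ cong ι (z _) ⟩
    ι F.0#                                ≡⟨ ι-0 ⟩
    0#                                    ∎) (proj₂ Tr≢0)
    where u = proj₁ Tr≢0

-- Duality of finite spaces

instance
  finite-Vec : {X : Set} {n : ℕ} {{_ : Finite X}} → Finite (Vec X n)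
  finite-Vec {n = zero}  = finite 1 (mk↔ₛ′ (λ _ → Fin.zero) (λ _ → []) (λ { Fin.zero → refl ; (Fin.suc ()) }) (λ { [] → refl }))
  finite-Vec {X} {suc n} = finite P.size (mk↔ₛ′
    (λ { (x ∷ v) → P.to (x , v) })
    (λ i → proj₁ (P.from i) ∷ proj₂ (P.from i))
    P.to-from
    (λ { (x ∷ v) → cong (λ (x , v) → x ∷ v) (P.from-to (x , v)) }))
    where module P = Finite (finite-× {X} {Vec X n})

∣Vec∣ : (X : Set) {{_ : Finite X}} (n : ℕ) → ∣ Vec X n ∣ ≡ ∣ X ∣ ^ n
∣Vec∣ X zero    = refl
∣Vec∣ X (suc n) = cong (∣ X ∣ *_) (∣Vec∣ X n)

module VectorSpaceProperties (E : Field) (N : ℕ) where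
  open Field E
  open VectorSpace E N public
  private module Ep = FieldProperties E

  infix 8 -ᵥ_
  -ᵥ_ : V → V
  -ᵥ_ = map -ᶠ_

  open ≡-Reasoning

  +ᵥ-assoc : ∀ u v w → (u +ᵥ v) +ᵥ w ≡ u +ᵥ (v +ᵥ w)
  +ᵥ-assoc = zipWith-assoc Ep.+-assoc

  +ᵥ-comm : ∀ u v → u +ᵥ v ≡ v +ᵥ u
  +ᵥ-comm = zipWith-comm Ep.+-comm

  +ᵥ-identityˡ : ∀ v → 0ᵥ +ᵥ v ≡ v
  +ᵥ-identityˡ = zipWith-identityˡ Ep.+-identityˡ

  +ᵥ-identityʳ : ∀ v → v +ᵥ 0ᵥ ≡ v
  +ᵥ-identityʳ = zipWith-identityʳ Ep.+-identityʳ

  +ᵥ-inverseˡ : ∀ v → -ᵥ v +ᵥ v ≡ 0ᵥ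
  +ᵥ-inverseˡ = zipWith-inverseˡ Ep.-‿inverseˡ

  +ᵥ-inverseʳ : ∀ v → v +ᵥ -ᵥ v ≡ 0ᵥ
  +ᵥ-inverseʳ = zipWith-inverseʳ Ep.-‿inverseʳ

  •-distribˡ : ∀ a u v → a • (u +ᵥ v) ≡ a • u +ᵥ a • v
  •-distribˡ a u v = sym (zipWith-map-distrib u v)
    where
    zipWith-map-distrib : ∀ {m} (u v : Vec Carrier m) → zipWith _+ᶠ_ (map (a *ᶠ_) u) (map (a *ᶠ_) v) ≡ map (a *ᶠ_) (zipWith _+ᶠ_ u v)
    zipWith-map-distrib []      []      = refl
    zipWith-map-distrib (x ∷ u) (y ∷ v) = cong₂ _∷_ (sym (Ep.distribˡ a x y)) (zipWith-map-distrib u v)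

  •-distribʳ : ∀ a b v → (a +ᶠ b) • v ≡ a • v +ᵥ b • v
  •-distribʳ a b = go
    where
    go : ∀ {m} (v : Vec Carrier m) → map ((a +ᶠ b) *ᶠ_) v ≡ zipWith _+ᶠ_ (map (a *ᶠ_) v) (map (b *ᶠ_) v)
    go []      = refl
    go (x ∷ v) = cong₂ _∷_ (Ep.distribʳ x a b) (go v)

  •-assoc : ∀ a b v → (a *ᶠ b) • v ≡ a • (b • v)
  •-assoc a b v = trans (map-cong (λ x → Ep.*-assoc a b x) v) (map-∘ (a *ᶠ_) (b *ᶠ_) v)

  1• : ∀ v → 1# • v ≡ v
  1• v = trans (map-cong Ep.*-identityˡ v) (map-id v)

  0• : ∀ v → 0# • v ≡ 0ᵥ
  0• v = trans (map-cong Ep.zeroˡ v) (map-const v 0#)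

  •0 : ∀ a → a • 0ᵥ ≡ 0ᵥ
  •0 a = trans (map-replicate (a *ᶠ_) 0# N) (cong (replicate N) (Ep.zeroʳ a))

  u+v≡0⇒v≡-u : ∀ {u v} → u +ᵥ v ≡ 0ᵥ → v ≡ -ᵥ u
  u+v≡0⇒v≡-u {u} {v} p = begin
    v                  ≡⟨ +ᵥ-identityˡ v ⟨
    0ᵥ +ᵥ v            ≡⟨ cong (_+ᵥ v) (+ᵥ-inverseˡ u) ⟨
    (-ᵥ u +ᵥ u) +ᵥ v   ≡⟨ +ᵥ-assoc _ _ _ ⟩
    -ᵥ u +ᵥ (u +ᵥ v)   ≡⟨ cong (-ᵥ u +ᵥ_) p ⟩
    -ᵥ u +ᵥ 0ᵥ         ≡⟨ +ᵥ-identityʳ _ ⟩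
    -ᵥ u               ∎

  -•ˡ : ∀ a v → (-ᶠ a) • v ≡ -ᵥ (a • v)
  -•ˡ a v = u+v≡0⇒v≡-u (trans (sym (•-distribʳ a (-ᶠ a) v)) (trans (cong (_• v) (Ep.-‿inverseʳ a)) (0• v)))

  -ᵥ-involutive : ∀ v → -ᵥ -ᵥ v ≡ v
  -ᵥ-involutive v = sym (u+v≡0⇒v≡-u (+ᵥ-inverseˡ v))

  +ᵥ-medial : ∀ a b c d → (a +ᵥ b) +ᵥ (c +ᵥ d) ≡ (a +ᵥ c) +ᵥ (b +ᵥ d)
  +ᵥ-medial a b c d = begin
    (a +ᵥ b) +ᵥ (c +ᵥ d)   ≡⟨ +ᵥ-assoc _ _ _ ⟩
    a +ᵥ (b +ᵥ (c +ᵥ d))   ≡⟨ cong (a +ᵥ_) (trans (sym (+ᵥ-assoc _ _ _)) (trans (cong (_+ᵥ d) (+ᵥ-comm b c)) (+ᵥ-assoc _ _ _))) ⟩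
    a +ᵥ (c +ᵥ (b +ᵥ d))   ≡⟨ +ᵥ-assoc _ _ _ ⟨
    (a +ᵥ c) +ᵥ (b +ᵥ d)   ∎

  •-cancel : ∀ {a v} → a ≢ 0# → a • v ≡ 0ᵥ → v ≡ 0ᵥ
  •-cancel {a} {v} a≢0 p = begin
    v                              ≡⟨ 1• v ⟨
    1# • v                         ≡⟨ cong (_• v) (proj₁ (proj₂ (invertible a a≢0))) ⟨
    (Ep.inv a a≢0 *ᶠ a) • v        ≡⟨ •-assoc _ _ _ ⟩
    Ep.inv a a≢0 • a • v           ≡⟨ cong (Ep.inv a a≢0 •_) p ⟩
    Ep.inv a a≢0 • 0ᵥ              ≡⟨ •0 _ ⟩
    0ᵥ                             ∎

  inv-• : ∀ a a≢0 v → Ep.inv a a≢0 • a • v ≡ v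
  inv-• a a≢0 v = trans (sym (•-assoc _ _ _)) (trans (cong (_• v) (proj₁ (proj₂ (invertible a a≢0)))) (1• v))

  •-injectiveˡ : {{_ : Finite Carrier}} → ∀ {v} → v ≢ 0ᵥ → ∀ a b → a • v ≡ b • v → a ≡ b
  •-injectiveˡ {v} v≢0 a b p with (a +ᶠ -ᶠ b) ≟ 0#
  ... | yes eq = Ep.x-y≡0⇒x≡y eq
  ... | no neq = contradiction (•-cancel neq (begin
    (a +ᶠ -ᶠ b) • v       ≡⟨ •-distribʳ a (-ᶠ b) v ⟩
    a • v +ᵥ (-ᶠ b) • v   ≡⟨ cong₂ _+ᵥ_ p (-•ˡ b v) ⟩
    b • v +ᵥ -ᵥ (b • v)   ≡⟨ +ᵥ-inverseʳ (b • v) ⟩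
    0ᵥ                    ∎)) v≢0

-- The scalar multiplication needs no laws: it only serves to state the
-- homogeneity of linear forms.
record Space (F : Field) : Set₁ where
  infixl 6 _⊕_
  infixr 7 _⊙_
  field
    Carrier      : Set
    isFinite     : Finite Carrier
    _⊕_          : Carrier → Carrier → Carrier
    ⊖_           : Carrier → Carrier
    _⊙_          : Field.Carrier F → Carrier → Carrier
    ⊕-⊖-cancel   : ∀ a d → (a ⊕ d) ⊕ (⊖ d) ≡ a
    ⊖-⊕-cancel   : ∀ a d → (a ⊕ (⊖ d)) ⊕ d ≡ a

module _ {F : Field} where
  infixr 5 _×ˢ_
  _×ˢ_ : Space F → Space F → Space F
  A ×ˢ B = record
    { Carrier    = A.Carrier × B.Carrier
    ; isFinite   = finite-× {{A.isFinite}} {{B.isFinite}}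
    ; _⊕_        = λ (a , b) (a′ , b′) → (a A.⊕ a′) , (b B.⊕ b′)
    ; ⊖_         = λ (a , b) → (A.⊖ a) , (B.⊖ b)
    ; _⊙_        = λ c (a , b) → (c A.⊙ a) , (c B.⊙ b)
    ; ⊕-⊖-cancel = λ (a , b) (a′ , b′) → cong₂ _,_ (A.⊕-⊖-cancel a a′) (B.⊕-⊖-cancel b b′)
    ; ⊖-⊕-cancel = λ (a , b) (a′ , b′) → cong₂ _,_ (A.⊖-⊕-cancel a a′) (B.⊖-⊕-cancel b b′)
    }
    where
    module A = Space A
    module B = Space B

  record IsForm (A : Space F) (φ : Space.Carrier A → Field.Carrier F) : Set where
    open Space A
    field
      +-homo : ∀ a b → φ (a ⊕ b) ≡ Field._+ᶠ_ F (φ a) (φ b)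
      ⊙-homo : ∀ c a → φ (c ⊙ a) ≡ Field._*ᶠ_ F c (φ a)

module Duality (F : Field) {k : ℕ} (ordF : HasOrder F (suc k)) where
  private
    module F = Field F
    module Fp = FieldProperties F
    q = suc k
    instance
      finF : Finite F.Carrier
      finF = finite q ordF
  open ≡-Reasoning

  module _ {A : Space F} {φ} (form : IsForm A φ) where
    open Space A
    open IsForm form
    private instance
      finA : Finite Carrier
      finA = isFinite

    -- Adding the multiple `d c` of a, on which φ takes the value c, maps the kernel onto the fibre
    -- over c; so all q fibres have the same size.
    count-kernel : ∀ a → φ a ≢ F.0# → q * count (λ a → φ a ≟ F.0#) ≡ ∣ Carrier ∣
    count-kernel a φa≢0 = begin
      q * count (λ x → φ x ≟ F.0#)
        ≡⟨ ∑-const {X = F.Carrier} _ ⟨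
      ∑[ c ] count (λ x → φ x ≟ F.0#)
        ≡⟨ ∑-cong (λ c → trans (sym (trans (∑-cong λ x → 𝟙-cong (φ (τ c x) ≟ c) (φ x ≟ F.0#) (to c x) (from c x)) refl))
             (∑-reindex (τ c) (_⊕ ⊖ d c) (λ y → ⊖-⊕-cancel y (d c)) (λ y → ⊕-⊖-cancel y (d c)) (λ x → 𝟙 (φ x ≟ c)))) ⟩
      ∑[ c ] count (λ x → φ x ≟ c)
        ≡⟨ ∑-swap _ ⟩
      ∑[ x ] count (λ c → φ x ≟ c)
        ≡⟨ ∑-cong (λ x → count-unique (λ c → φ x ≟ c) (φ x) refl (λ _ → sym)) ⟩
      ∑ {Carrier} (λ _ → 1)
        ≡⟨ trans (∑-const 1) (ℕ.*-identityʳ _) ⟩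
      ∣ Carrier ∣ ∎
      where
      d : F.Carrier → Carrier
      d c = (c F.*ᶠ Fp.inv (φ a) φa≢0) ⊙ a
      τ : F.Carrier → Carrier → Carrier
      τ c x = x ⊕ d c
      φ-τ : ∀ c x → φ (τ c x) ≡ φ x F.+ᶠ c
      φ-τ c x = trans (+-homo x (d c)) (cong (φ x F.+ᶠ_) (trans (⊙-homo _ a) (trans (Fp.*-comm _ _)
        (trans (cong (φ a F.*ᶠ_) (Fp.*-comm _ _)) (Fp.*-invˡ (φ a) φa≢0 c)))))
      to : ∀ c x → φ (τ c x) ≡ c → φ x ≡ F.0#
      to c x p = Fp.+-cancelˡ c (trans (Fp.+-comm _ _) (trans (sym (φ-τ c x)) (trans p (sym (Fp.+-identityʳ c)))))
      from : ∀ c x → φ x ≡ F.0# → φ (τ c x) ≡ c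
      from c x p = trans (φ-τ c x) (trans (cong (F._+ᶠ c) p) (Fp.+-identityˡ c))

    -- One formula for both cases, so that it can be summed over all the forms of a pairing: the
    -- zero form has a kernel of size ∣A∣, and q ∣A∣ = ∣A∣ + k ∣A∣.
    count-kernel′ : (zero? : Dec (∀ a → φ a ≡ F.0#)) →
      q * count (λ a → φ a ≟ F.0#) ≡ ∣ Carrier ∣ + k * (𝟙 zero? * ∣ Carrier ∣)
    count-kernel′ (yes φ≡0) = cong₂ (λ u v → u + k * v) (count-all _ φ≡0)
      (trans (count-all _ φ≡0) (trans (sym (ℕ.*-identityˡ _)) (cong (_* ∣ Carrier ∣) (sym (𝟙-yes (yes φ≡0) φ≡0)))))
    count-kernel′ (no φ≢0) with any? (λ a → ¬? (φ a ≟ F.0#))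
    ... | no ¬r = contradiction (λ a → decidable-stable (φ a ≟ F.0#) λ neq → ¬r (a , neq)) φ≢0
    ... | yes (a , φa≢0) = trans (count-kernel a φa≢0) (sym (trans
      (cong (λ u → ∣ Carrier ∣ + k * (u * ∣ Carrier ∣)) (𝟙-no (no φ≢0) φ≢0))
      (trans (cong (∣ Carrier ∣ +_) (ℕ.*-zeroʳ k)) (ℕ.+-identityʳ _))))

  -- Count the pairs (a , b) with β a b ≡ 0 in both orders.
  module _ {A B : Space F} (β : Space.Carrier A → Space.Carrier B → F.Carrier)
    (formˡ : ∀ b → IsForm A (λ a → β a b)) (formʳ : ∀ a → IsForm B (β a))
    where
    private
      module A = Space A
      module B = Space B
    private instance
      finA : Finite A.Carrier
      finA = A.isFinite
      finB : Finite B.Carrier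
      finB = B.isFinite

    count-radicals : 1 ≤ k →
      {L : A.Carrier → Set} (L? : ∀ a → Dec (L a)) → (∀ a → L a → ∀ b → β a b ≡ F.0#) → (∀ a → (∀ b → β a b ≡ F.0#) → L a) →
      {R : B.Carrier → Set} (R? : ∀ b → Dec (R b)) → (∀ b → R b → ∀ a → β a b ≡ F.0#) → (∀ b → (∀ a → β a b ≡ F.0#) → R b) →
      count R? * ∣ A.Carrier ∣ ≡ ∣ B.Carrier ∣ * count L?
    count-radicals 1≤k L? L⇒ ⇒L R? R⇒ ⇒R = begin
      count R? * ∣A∣   ≡⟨ ℕ.*-cancelˡ-≡ _ _ k {{≢-nonZero (ℕ.m<n⇒n≢0 1≤k)}} (ℕ.+-cancelˡ-≡ (∣A∣ * ∣B∣) _ _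
                           (trans (sym total′) total)) ⟩
      count L? * ∣B∣   ≡⟨ ℕ.*-comm _ ∣B∣ ⟩
      ∣B∣ * count L?   ∎
      where
      ∣A∣ = ∣ A.Carrier ∣
      ∣B∣ = ∣ B.Carrier ∣
      total : q * (∑[ a ] ∑[ b ] 𝟙 (β a b ≟ F.0#)) ≡ ∣A∣ * ∣B∣ + k * (count L? * ∣B∣)
      total = begin
        q * (∑[ a ] ∑[ b ] 𝟙 (β a b ≟ F.0#))
          ≡⟨ ∑-*ˡ q _ ⟨
        ∑[ a ] (q * (∑[ b ] 𝟙 (β a b ≟ F.0#)))
          ≡⟨ ∑-cong (λ a → trans (count-kernel′ (formʳ a) (all? λ b → β a b ≟ F.0#))
               (cong (λ u → ∣B∣ + k * (u * ∣B∣)) (𝟙-cong (all? λ b → β a b ≟ F.0#) (L? a) (⇒L a) (L⇒ a)))) ⟩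
        ∑[ a ] (∣B∣ + k * (𝟙 (L? a) * ∣B∣))
          ≡⟨ ∑-+ _ _ ⟩
        ∑ {A.Carrier} (λ _ → ∣B∣) + (∑[ a ] (k * (𝟙 (L? a) * ∣B∣)))
          ≡⟨ cong₂ _+_ (∑-const ∣B∣) (trans (∑-*ˡ k _) (cong (k *_) (∑-*ʳ ∣B∣ _))) ⟩
        ∣A∣ * ∣B∣ + k * (count L? * ∣B∣) ∎
      total′ : q * (∑[ a ] ∑[ b ] 𝟙 (β a b ≟ F.0#)) ≡ ∣A∣ * ∣B∣ + k * (count R? * ∣A∣)
      total′ = begin
        q * (∑[ a ] ∑[ b ] 𝟙 (β a b ≟ F.0#))
          ≡⟨ cong (q *_) (∑-swap _) ⟩
        q * (∑[ b ] ∑[ a ] 𝟙 (β a b ≟ F.0#))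
          ≡⟨ ∑-*ˡ q _ ⟨
        ∑[ b ] (q * (∑[ a ] 𝟙 (β a b ≟ F.0#)))
          ≡⟨ ∑-cong (λ b → trans (count-kernel′ (formˡ b) (all? λ a → β a b ≟ F.0#))
               (cong (λ u → ∣A∣ + k * (u * ∣A∣)) (𝟙-cong (all? λ a → β a b ≟ F.0#) (R? b) (⇒R b) (R⇒ b)))) ⟩
        ∑[ b ] (∣A∣ + k * (𝟙 (R? b) * ∣A∣))
          ≡⟨ ∑-+ _ _ ⟩
        ∑ {B.Carrier} (λ _ → ∣A∣) + (∑[ b ] (k * (𝟙 (R? b) * ∣A∣)))
          ≡⟨ cong₂ _+_ (trans (∑-const ∣A∣) (ℕ.*-comm ∣B∣ ∣A∣)) (trans (∑-*ˡ k _) (cong (k *_) (∑-*ʳ ∣A∣ _))) ⟩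
        ∣A∣ * ∣B∣ + k * (count R? * ∣A∣) ∎

-- Counting pairs of vectors

private
  -- These identities close the eight cases of the final counts. In them `suc k` is q,
  -- `k + k * suc k` is q² - 1, `1 + (k + k * suc k) * C` will be q^(4n-4), and (q² - 1)(1 + q² C)
  -- is the number of nonzero vectors of `W`. Those for 𝓞₁ and 𝓞₂ have the shape minuend = result +
  -- subtrahend.
  identity-𝓞₁-in : ∀ k C → (suc k * (1 + (k + k * suc k) * C)) * (((k + k * suc k) * (1 + suc k * suc k * C)) + (k + k * suc k) * k) ≡ ((suc k * (1 + (k + k * suc k) * C)) * C + (1 + (k + k * suc k) * C)) * ((k + k * suc k) * (suc k * k)) + (1 + (k + k * suc k) * C) * (((k + k * suc k) * (1 + suc k * suc k * C)) + (k + k * suc k) * k)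
  identity-𝓞₁-in = ℕSolver.solve-∀

  identity-𝓞₁-out : ∀ k C → (suc k * (1 + (k + k * suc k) * C)) * (((k + k * suc k) * (1 + suc k * suc k * C)) + (k + k * suc k) * 0) ≡ (suc k * (1 + (k + k * suc k) * C)) * C * ((k + k * suc k) * (suc k * k)) + (1 + (k + k * suc k) * C) * (((k + k * suc k) * (1 + suc k * suc k * C)) + (k + k * suc k) * k)
  identity-𝓞₁-out = ℕSolver.solve-∀

  identity-𝓞₁-out′ : ∀ k C → (suc k * (1 + (k + k * suc k) * C)) * (((k + k * suc k) * (1 + suc k * suc k * C)) + (k + k * suc k) * k) ≡ (suc k * (1 + (k + k * suc k) * C)) * C * ((k + k * suc k) * (suc k * k)) + (1 + (k + k * suc k) * C) * (((k + k * suc k) * (1 + suc k * suc k * C)) + (k + k * suc k) * (k + k * suc k))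
  identity-𝓞₁-out′ = ℕSolver.solve-∀

  identity-𝓞₂-out : ∀ k C → (1 + (k + k * suc k) * C) * (((k + k * suc k) * (1 + suc k * suc k * C)) + (k + k * suc k) * k) ≡ (suc k * suc (suc k) * C) * C * ((k + k * suc k) * (suc k * k)) + (((k + k * suc k) * (1 + suc k * suc k * C)) + (k + k * suc k) * (k + (k + k * suc k) * C * suc k))
  identity-𝓞₂-out = ℕSolver.solve-∀

  identity-𝓞₂-out′ : ∀ k C → (1 + (k + k * suc k) * C) * (((k + k * suc k) * (1 + suc k * suc k * C)) + (k + k * suc k) * (k + k * suc k)) ≡ (suc k * suc (suc k) * C) * C * ((k + k * suc k) * (suc k * k)) + (((k + k * suc k) * (1 + suc k * suc k * C)) + (k + k * suc k) * ((k + k * suc k) + (k + k * suc k) * C * (suc k * suc k)))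
  identity-𝓞₂-out′ = ℕSolver.solve-∀

  identity-𝓞₂-in : ∀ k C → (1 + (k + k * suc k) * C) * (((k + k * suc k) * (1 + suc k * suc k * C)) + (k + k * suc k) * (k + k * suc k)) ≡ ((suc k * suc (suc k) * C) * C + (1 + (k + k * suc k) * C)) * ((k + k * suc k) * (suc k * k)) + (((k + k * suc k) * (1 + suc k * suc k * C)) + (k + k * suc k) * (k + (k + k * suc k) * C * suc k))
  identity-𝓞₂-in = ℕSolver.solve-∀

  identity-𝓕-out : ∀ k C → (k + k * suc k) * C * (suc k * k) ≡ 1 * C * ((k + k * suc k) * (suc k * k))
  identity-𝓕-out = ℕSolver.solve-∀

  identity-𝓕-in : ∀ k C → ((k + k * suc k) + suc k * suc k * ((k + k * suc k) * C)) * (suc k * k) ≡ (1 * C + (1 + (k + k * suc k) * C)) * ((k + k * suc k) * (suc k * k))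
  identity-𝓕-in = ℕSolver.solve-∀

-- `tr` stands for any F-linear map from E to F with a nondegenerate pairing tr (a x). The factor λ₀
-- is absorbed into it, so the counts see neither λ₀ nor the Frobenius map.
module Core
  (k : ℕ) (1≤k : 1 ≤ k) (F E : Field) (ordF : HasOrder F (suc k)) (ordE : HasOrder E (suc k ^ 2))
  (ι : Field.Carrier F → Field.Carrier E) (ι-hom : IsFieldHomomorphism F E ι)
  (tr : Field.Carrier E → Field.Carrier F)
  (tr-+ : ∀ x y → tr (Field._+ᶠ_ E x y) ≡ Field._+ᶠ_ F (tr x) (tr y))
  (tr-ι* : ∀ c x → tr (Field._*ᶠ_ E (ι c) x) ≡ Field._*ᶠ_ F c (tr x))
  (tr-nondegenerate : ∀ x → (∀ a → tr (Field._*ᶠ_ E a x) ≡ Field.0# F) → x ≡ Field.0# E)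
  (N : ℕ) (f : VectorSpace.V E N → VectorSpace.V E N → Field.Carrier E)
  (f-alt : VectorSpace.IsNondegenerateAlternating E N f)
  where

  q : ℕ
  q = suc k

  module F = Field F
  module E = Field E
  module Fp = FieldProperties F
  module Ep = FieldProperties E
  open VectorSpaceProperties E N public
  open IsNondegenerateAlternating f-alt public
  open Hom {F} {E} {ι} ι-hom public
  open E using (_+ᶠ_; _*ᶠ_; -ᶠ_; 0#; 1#)
  open Duality F ordF
  open ≡-Reasoning

  instance
    finF : Finite F.Carrier
    finF = finite q ordF
    finE : Finite E.Carrier
    finE = finite (q ^ 2) ordE

  f-0ˡ : ∀ v → f 0ᵥ v ≡ 0#
  f-0ˡ v = trans (cong (λ u → f u v) (sym (0• 0ᵥ))) (trans (•-homoˡ _ _ _) (Ep.zeroˡ _))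

  f-0ʳ : ∀ v → f v 0ᵥ ≡ 0#
  f-0ʳ v = trans (cong (f v) (sym (0• 0ᵥ))) (trans (•-homoʳ _ _ _) (Ep.zeroˡ _))

  f-skew : ∀ u v → f v u ≡ -ᶠ f u v
  f-skew u v = Ep.x+y≡0⇒y≡-x (begin
    f u v +ᶠ f v u                                  ≡⟨ cong₂ _+ᶠ_ (trans (sym (Ep.+-identityˡ _)) (cong (_+ᶠ f u v) (sym (alternating u)))) (trans (sym (Ep.+-identityʳ _)) (cong (f v u +ᶠ_) (sym (alternating v)))) ⟩
    (f u u +ᶠ f u v) +ᶠ (f v u +ᶠ f v v)            ≡⟨ cong₂ _+ᶠ_ (+-homoʳ u u v) (+-homoʳ v u v) ⟨
    f u (u +ᵥ v) +ᶠ f v (u +ᵥ v)                    ≡⟨ +-homoˡ u v (u +ᵥ v) ⟨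
    f (u +ᵥ v) (u +ᵥ v)                             ≡⟨ alternating (u +ᵥ v) ⟩
    0#                                              ∎)

  f-sym0 : ∀ {u v} → f u v ≡ 0# → f v u ≡ 0#
  f-sym0 {u} {v} p = trans (f-skew u v) (trans (cong -ᶠ_ p) Ep.-0#≈0#)

  nondegenerateʳ : ∀ w → (∀ v → f v w ≡ 0#) → w ≡ 0ᵥ
  nondegenerateʳ w z = nondegenerate w (λ v → f-sym0 (z v))

  tr-0 : tr 0# ≡ F.0#
  tr-0 = trans (cong tr (sym (Ep.zeroʳ (ι F.0#)))) (trans (tr-ι* F.0# 0#) (Fp.zeroˡ _))

  tr-neg : ∀ x → tr (-ᶠ x) ≡ F.-ᶠ tr x
  tr-neg x = Fp.x+y≡0⇒y≡-x (trans (sym (tr-+ _ _)) (trans (cong tr (Ep.-‿inverseʳ x)) tr-0))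

  -- For `tr` = `tr₀` this is the form `b` of the statement, with its values taken in F instead of
  -- E, where duality needs them.
  g : V → V → F.Carrier
  g u v = tr (f u v)

  g-sym0 : ∀ {u v} → g u v ≡ F.0# → g v u ≡ F.0#
  g-sym0 {u} {v} p = trans (cong tr (f-skew u v)) (trans (tr-neg _) (trans (cong F.-ᶠ_ p) Fp.-0#≈0#))

  g-+ˡ : ∀ u v w → g (u +ᵥ v) w ≡ g u w F.+ᶠ g v w
  g-+ˡ u v w = trans (cong tr (+-homoˡ u v w)) (tr-+ _ _)

  g-+ʳ : ∀ u v w → g u (v +ᵥ w) ≡ g u v F.+ᶠ g u w
  g-+ʳ u v w = trans (cong tr (+-homoʳ u v w)) (tr-+ _ _)

  g-ι•ˡ : ∀ c u v → g (ι c • u) v ≡ c F.*ᶠ g u v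
  g-ι•ˡ c u v = trans (cong tr (•-homoˡ (ι c) u v)) (tr-ι* c _)

  g-ι•ʳ : ∀ c u v → g u (ι c • v) ≡ c F.*ᶠ g u v
  g-ι•ʳ c u v = trans (cong tr (•-homoʳ (ι c) u v)) (tr-ι* c _)

  g-nondegenerateʳ : ∀ w → (∀ v → g v w ≡ F.0#) → w ≡ 0ᵥ
  g-nondegenerateʳ w z = nondegenerateʳ w λ v → tr-nondegenerate _ λ a → trans (cong tr (sym (•-homoˡ a v w))) (z (a • v))

  scalarSpace : (S : Field) {{_ : Finite (Field.Carrier S)}} → (F.Carrier → Field.Carrier S) → Space F
  scalarSpace S {{finS}} i = record
    { Carrier    = S.Carrier
    ; isFinite   = finS
    ; _⊕_        = S._+ᶠ_
    ; ⊖_         = S.-ᶠ_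
    ; _⊙_        = λ c s → i c S.*ᶠ s
    ; ⊕-⊖-cancel = λ a d → trans (Sp.+-assoc _ _ _) (trans (cong (a S.+ᶠ_) (Sp.-‿inverseʳ d)) (Sp.+-identityʳ a))
    ; ⊖-⊕-cancel = λ a d → trans (Sp.+-assoc _ _ _) (trans (cong (a S.+ᶠ_) (Sp.-‿inverseˡ d)) (Sp.+-identityʳ a))
    }
    where
    module S = Field S
    module Sp = FieldProperties S

  Fˢ Eˢ Vˢ : Space F
  Fˢ = scalarSpace F id
  Eˢ = scalarSpace E ι
  Vˢ = record
    { Carrier    = V
    ; isFinite   = finite-Vec
    ; _⊕_        = _+ᵥ_
    ; ⊖_         = -ᵥ_
    ; _⊙_        = λ c v → ι c • v
    ; ⊕-⊖-cancel = λ a d → trans (+ᵥ-assoc _ _ _) (trans (cong (a +ᵥ_) (+ᵥ-inverseʳ d)) (+ᵥ-identityʳ a))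
    ; ⊖-⊕-cancel = λ a d → trans (+ᵥ-assoc _ _ _) (trans (cong (a +ᵥ_) (+ᵥ-inverseˡ d)) (+ᵥ-identityʳ a))
    }

  record IsLinear (A : Space F) (h : Space.Carrier A → V) : Set where
    open Space A
    field
      +-homo : ∀ a b → h (a ⊕ b) ≡ h a +ᵥ h b
      ⊙-homo : ∀ c a → h (c ⊙ a) ≡ ι c • h a

  -- Since g is nondegenerate, the left radical of `g v (h a)` is the kernel of h, and the right
  -- radical is the orthogonal of the image of h. The sizes of orthogonal subspaces of V below all
  -- come from a choice of h.
  count-orthogonal : {A : Space F} (let instance finA = Space.isFinite A) {h : Space.Carrier A → V} → IsLinear A h →
    {R : V → Set} (R? : ∀ v → Dec (R v)) → (∀ v → R v → ∀ a → g v (h a) ≡ F.0#) → (∀ v → (∀ a → g v (h a) ≡ F.0#) → R v) →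
    count R? * ∣ Space.Carrier A ∣ ≡ ∣ V ∣ * count (λ a → h a ≟ 0ᵥ)
  count-orthogonal {A} {h} lin R? R⇒ ⇒R = count-radicals {A} {Vˢ} (λ a v → g v (h a))
    (λ v → record { +-homo = λ a b → trans (cong (g v) (+-homo a b)) (g-+ʳ v _ _)
                  ; ⊙-homo = λ c a → trans (cong (g v) (⊙-homo c a)) (g-ι•ʳ c v _) })
    (λ a → record { +-homo = λ u v → g-+ˡ u v (h a) ; ⊙-homo = λ c u → g-ι•ˡ c u (h a) })
    1≤k (λ a → h a ≟ 0ᵥ)
    (λ a p v → trans (cong (g v) p) (trans (cong tr (f-0ʳ v)) tr-0)) (λ a → g-nondegenerateʳ (h a))
    R? R⇒ ⇒R
    where
    open IsLinear lin
    instance finA = Space.isFinite A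

  -- Only S = F and S = E occur; this lets each count be done for both at once.
  record Scalars : Set₁ where
    field
      S     : Field
      finS  : Finite (Field.Carrier S)
      i     : F.Carrier → Field.Carrier S
      j     : Field.Carrier S → E.Carrier
      j-hom : IsFieldHomomorphism S E j
      j∘i   : ∀ c → j (i c) ≡ ι c

  scalarsF scalarsE : Scalars
  scalarsF = record { S = F ; finS = finF ; i = id ; j = ι ; j-hom = ι-hom ; j∘i = λ _ → refl }
  scalarsE = record { S = E ; finS = finE ; i = ι ; j = id ; j-hom = Identity.isRingHomomorphism _ refl ; j∘i = λ _ → refl }

  lin : V → V → F.Carrier × F.Carrier → V
  lin x y (c , d) = ι c • x +ᵥ ι d • y

  0² : F.Carrier × F.Carrier
  0² = F.0# , F.0#

  lin-linear : ∀ x y → IsLinear (Fˢ ×ˢ Fˢ) (lin x y)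
  lin-linear x y = record
    { +-homo = λ (c , d) (c′ , d′) → trans (cong₂ _+ᵥ_ (homo c c′ x) (homo d d′ y)) (+ᵥ-medial _ _ _ _)
    ; ⊙-homo = λ a (c , d) → trans (cong₂ _+ᵥ_ (trans (cong (_• x) (ι-* a c)) (•-assoc _ _ x)) (trans (cong (_• y) (ι-* a d)) (•-assoc _ _ y)))
                                   (sym (•-distribˡ (ι a) _ _))
    }
    where
    homo : ∀ c c′ v → ι (c F.+ᶠ c′) • v ≡ ι c • v +ᵥ ι c′ • v
    homo c c′ v = trans (cong (_• v) (ι-+ c c′)) (•-distribʳ _ _ v)

  lin-0 : ∀ x y → lin x y 0² ≡ 0ᵥ
  lin-0 x y = trans (cong₂ _+ᵥ_ (trans (cong (_• x) ι-0) (0• x)) (trans (cong (_• y) ι-0) (0• y))) (+ᵥ-identityˡ 0ᵥ)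

  lin-1,0 : ∀ x y → lin x y (F.1# , F.0#) ≡ x
  lin-1,0 x y = trans (cong₂ _+ᵥ_ (trans (cong (_• x) ι-1) (1• x)) (trans (cong (_• y) ι-0) (0• y))) (+ᵥ-identityʳ x)

  lin-0,1 : ∀ x y → lin x y (F.0# , F.1#) ≡ y
  lin-0,1 x y = trans (cong₂ _+ᵥ_ (trans (cong (_• x) ι-0) (0• x)) (trans (cong (_• y) ι-1) (1• y))) (+ᵥ-identityˡ y)

  Independent : V → V → Set
  Independent x y = ∀ a → lin x y a ≡ 0ᵥ → a ≡ 0²

  f-lin : ∀ x y c d c′ d′ → f (lin x y (c , d)) (lin x y (c′ , d′)) ≡ ι (c F.*ᶠ d′ F.+ᶠ F.-ᶠ (d F.*ᶠ c′)) *ᶠ f x y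
  f-lin x y c d c′ d′ = begin
    f (ι c • x +ᵥ ι d • y) (ι c′ • x +ᵥ ι d′ • y)
      ≡⟨ +-homoˡ _ _ _ ⟩
    f (ι c • x) _ +ᶠ f (ι d • y) _
      ≡⟨ cong₂ _+ᶠ_ (trans (•-homoˡ _ _ _) (cong (ι c *ᶠ_) (row x))) (trans (•-homoˡ _ _ _) (cong (ι d *ᶠ_) (row y))) ⟩
    ι c *ᶠ (ι c′ *ᶠ f x x +ᶠ ι d′ *ᶠ f x y) +ᶠ ι d *ᶠ (ι c′ *ᶠ f y x +ᶠ ι d′ *ᶠ f y y)
      ≡⟨ cong₂ (λ u v → ι c *ᶠ u +ᶠ ι d *ᶠ v)
           (trans (cong (_+ᶠ ι d′ *ᶠ f x y) (trans (cong (ι c′ *ᶠ_) (alternating x)) (Ep.zeroʳ _))) (Ep.+-identityˡ _))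
           (trans (cong (ι c′ *ᶠ f y x +ᶠ_) (trans (cong (ι d′ *ᶠ_) (alternating y)) (Ep.zeroʳ _))) (Ep.+-identityʳ _)) ⟩
    ι c *ᶠ (ι d′ *ᶠ f x y) +ᶠ ι d *ᶠ (ι c′ *ᶠ f y x)
      ≡⟨ cong₂ _+ᶠ_ (move c d′ (f x y)) (trans (move d c′ (f y x)) (trans (cong (ι (d F.*ᶠ c′) *ᶠ_) (f-skew x y))
           (trans (sym (Ep.-‿distribʳ-* _ _)) (trans (Ep.-‿distribˡ-* _ _) (cong (_*ᶠ f x y) (sym (ι-neg _))))))) ⟩
    ι (c F.*ᶠ d′) *ᶠ f x y +ᶠ ι (F.-ᶠ (d F.*ᶠ c′)) *ᶠ f x y
      ≡⟨ Ep.distribʳ _ _ _ ⟨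
    (ι (c F.*ᶠ d′) +ᶠ ι (F.-ᶠ (d F.*ᶠ c′))) *ᶠ f x y
      ≡⟨ cong (_*ᶠ f x y) (ι-+ _ _) ⟨
    ι (c F.*ᶠ d′ F.+ᶠ F.-ᶠ (d F.*ᶠ c′)) *ᶠ f x y ∎
    where
    row : ∀ u → f u (ι c′ • x +ᵥ ι d′ • y) ≡ ι c′ *ᶠ f u x +ᶠ ι d′ *ᶠ f u y
    row u = trans (+-homoʳ _ _ _) (cong₂ _+ᶠ_ (•-homoʳ _ _ _) (•-homoʳ _ _ _))
    move : ∀ a b z → ι a *ᶠ (ι b *ᶠ z) ≡ ι (a F.*ᶠ b) *ᶠ z
    move a b z = trans (sym (Ep.*-assoc _ _ _)) (cong (_*ᶠ z) (sym (ι-* a b)))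

  infix 4 _∈⟨_⟩
  _∈⟨_⟩ : V → V → Set
  v ∈⟨ u ⟩ = ∃ λ a → a • u ≡ v

  _∈⟨_⟩? : ∀ v u → Dec (v ∈⟨ u ⟩)
  v ∈⟨ u ⟩? = any? λ a → a • u ≟ v

  module Perp (x y : V) (indep : Independent x y) where

    W : V → Set
    W v = g v x ≡ F.0# × g v y ≡ F.0#

    W? : ∀ v → Dec (W v)
    W? v = (g v x ≟ F.0#) ×-dec (g v y ≟ F.0#)

    W*? : ∀ v → Dec (0ᵥ ≢ v × W v)
    W*? v = ¬? (0ᵥ ≟ v) ×-dec W? v

    W⇒lin : ∀ {v} → W v → ∀ a → g v (lin x y a) ≡ F.0#
    W⇒lin {v} (p , p′) (c , d) = begin
      g v (ι c • x +ᵥ ι d • y)             ≡⟨ g-+ʳ _ _ _ ⟩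
      g v (ι c • x) F.+ᶠ g v (ι d • y)     ≡⟨ cong₂ F._+ᶠ_ (g-ι•ʳ c v x) (g-ι•ʳ d v y) ⟩
      c F.*ᶠ g v x F.+ᶠ d F.*ᶠ g v y       ≡⟨ cong₂ (λ u w → c F.*ᶠ u F.+ᶠ d F.*ᶠ w) p p′ ⟩
      c F.*ᶠ F.0# F.+ᶠ d F.*ᶠ F.0#         ≡⟨ cong₂ F._+ᶠ_ (Fp.zeroʳ c) (Fp.zeroʳ d) ⟩
      F.0# F.+ᶠ F.0#                       ≡⟨ Fp.+-identityˡ _ ⟩
      F.0#                                 ∎

    lin⇒W : ∀ {v} → (∀ a → g v (lin x y a) ≡ F.0#) → W v
    lin⇒W {v} z = trans (cong (g v) (sym (lin-1,0 x y))) (z _) , trans (cong (g v) (sym (lin-0,1 x y))) (z _)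

    W-0 : W 0ᵥ
    W-0 = trans (cong tr (f-0ˡ x)) tr-0 , trans (cong tr (f-0ˡ y)) tr-0

    lin≢0 : ∀ {a} → 0² ≢ a → lin x y a ≢ 0ᵥ
    lin≢0 a≢0 p = a≢0 (sym (indep _ p))

    lin-injective : ∀ a b → lin x y a ≡ lin x y b → a ≡ b
    lin-injective (c , d) (c′ , d′) p = cong₂ _,_ (Fp.x-y≡0⇒x≡y (cong proj₁ diff)) (Fp.x-y≡0⇒x≡y (cong proj₂ diff))
      where
      diff : (c F.+ᶠ F.-ᶠ c′ , d F.+ᶠ F.-ᶠ d′) ≡ 0²
      diff = indep _ (begin
        lin x y (c F.+ᶠ F.-ᶠ c′ , d F.+ᶠ F.-ᶠ d′)
          ≡⟨ IsLinear.+-homo (lin-linear x y) (c , d) (F.-ᶠ c′ , F.-ᶠ d′) ⟩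
        lin x y (c , d) +ᵥ lin x y (F.-ᶠ c′ , F.-ᶠ d′)
          ≡⟨ cong (_+ᵥ lin x y (F.-ᶠ c′ , F.-ᶠ d′)) p ⟩
        lin x y (c′ , d′) +ᵥ lin x y (F.-ᶠ c′ , F.-ᶠ d′)
          ≡⟨ IsLinear.+-homo (lin-linear x y) (c′ , d′) (F.-ᶠ c′ , F.-ᶠ d′) ⟨
        lin x y (c′ F.+ᶠ F.-ᶠ c′ , d′ F.+ᶠ F.-ᶠ d′)
          ≡⟨ cong₂ (λ u v → lin x y (u , v)) (Fp.-‿inverseʳ c′) (Fp.-‿inverseʳ d′) ⟩
        lin x y 0²
          ≡⟨ lin-0 x y ⟩
        0ᵥ ∎)

    count-W : count W? * (q * q) ≡ ∣ V ∣
    count-W = trans (count-orthogonal (lin-linear x y) W? (λ _ → W⇒lin) (λ _ → lin⇒W))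
      (trans (cong (∣ V ∣ *_) (count-unique _ 0² (lin-0 x y) indep)) (ℕ.*-identityʳ _))

  -- Relations of a vector with a line, over F and over E

  module ScalarCounts (𝕊 : Scalars) where
    open Scalars 𝕊
    private
      module S = Field S
      module Sp = FieldProperties S
    open Hom {S} {E} {j} j-hom using () renaming (ι-+ to j-+; ι-* to j-*; ι-0 to j-0; ι-1 to j-1; ι-neg to j-neg; ι≡0⇒≡0 to j≡0⇒≡0; ι-injective to j-injective)
    private
      instance
        finS′ : Finite S.Carrier
        finS′ = finS
      Sˢ = scalarSpace S i

    -- For S = F this is tr z = 0, for S = E it is z = 0; at z = f v u the two cases are
    -- orthogonality of v to u for `g` and for f.
    Orth : E.Carrier → Set
    Orth z = ∀ s → tr (j s *ᶠ z) ≡ F.0#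

    j•-linear : ∀ u → IsLinear Sˢ (λ s → j s • u)
    j•-linear u = record
      { +-homo = λ s t → trans (cong (_• u) (j-+ s t)) (•-distribʳ _ _ u)
      ; ⊙-homo = λ c s → trans (cong (_• u) (trans (j-* _ _) (cong (_*ᶠ j s) (j∘i c)))) (•-assoc _ _ u)
      }

    g-j• : ∀ v s u → g v (j s • u) ≡ tr (j s *ᶠ f v u)
    g-j• v s u = cong tr (•-homoʳ (j s) v u)

    j•≡0⇒≡0 : ∀ {s u} → u ≢ 0ᵥ → j s • u ≡ 0ᵥ → s ≡ S.0#
    j•≡0⇒≡0 {s} {u} u≢0 p = j≡0⇒≡0 (•-injectiveˡ u≢0 (j s) 0# (trans p (sym (0• u))))

    count-Orth : ∀ u → u ≢ 0ᵥ → {R : V → Set} (R? : ∀ v → Dec (R v)) → (∀ v → R v → Orth (f v u)) → (∀ v → Orth (f v u) → R v) →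
      count R? * ∣ S.Carrier ∣ ≡ ∣ V ∣
    count-Orth u u≢0 R? R⇒ ⇒R = trans
      (count-orthogonal (j•-linear u) R? (λ v r s → trans (g-j• v s u) (R⇒ v r s)) (λ v z → ⇒R v λ s → trans (sym (g-j• v s u)) (z s)))
      (trans (cong (∣ V ∣ *_) (count-unique _ S.0# (trans (cong (_• u) j-0) (0• u)) (λ s → j•≡0⇒≡0 u≢0))) (ℕ.*-identityʳ _))

    module OnLine (x y : V) (indep : Independent x y) where

      open Perp x y indep

      d : V → ℕ
      d u = ∑[ a ] count (λ s → lin x y a +ᵥ j s • u ≟ 0ᵥ)

      count-W∩Orth : ∀ u {R : V → Set} (R? : ∀ v → Dec (R v)) → (∀ v → R v → Orth (f v u)) → (∀ v → Orth (f v u) → R v) →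
        count (λ v → W? v ×-dec R? v) * (q * q * ∣ S.Carrier ∣) ≡ ∣ V ∣ * d u
      count-W∩Orth u R? R⇒ ⇒R = trans
        (count-orthogonal {A = (Fˢ ×ˢ Fˢ) ×ˢ Sˢ} {h = h} h-linear (λ v → W? v ×-dec R? v) to from)
        (cong (∣ V ∣ *_) (∑-× {X = F.Carrier × F.Carrier} {Y = S.Carrier} (λ a s → 𝟙 (h (a , s) ≟ 0ᵥ))))
        where
        h : (F.Carrier × F.Carrier) × S.Carrier → V
        h (a , s) = lin x y a +ᵥ j s • u
        module L = IsLinear (lin-linear x y)
        module J = IsLinear (j•-linear u)
        h-linear : IsLinear ((Fˢ ×ˢ Fˢ) ×ˢ Sˢ) h
        h-linear = record
          { +-homo = λ (a , s) (a′ , s′) → trans (cong₂ _+ᵥ_ (L.+-homo a a′) (J.+-homo s s′)) (+ᵥ-medial _ _ _ _)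
          ; ⊙-homo = λ c (a , s) → trans (cong₂ _+ᵥ_ (L.⊙-homo c a) (J.⊙-homo c s)) (sym (•-distribˡ (ι c) _ _))
          }
        to : ∀ v → W v × _ → ∀ a → g v (h a) ≡ F.0#
        to v (w , r) (a , s) = trans (g-+ʳ v _ _)
          (trans (cong₂ F._+ᶠ_ (W⇒lin w a) (trans (g-j• v s u) (R⇒ v r s))) (Fp.+-identityˡ _))
        from : ∀ v → (∀ a → g v (h a) ≡ F.0#) → W v × _
        from v z = lin⇒W (λ a → trans (cong (g v) (sym (trans (cong (lin x y a +ᵥ_) (trans (cong (_• u) j-0) (0• u))) (+ᵥ-identityʳ _)))) (z (a , S.0#)))
                 , ⇒R v (λ s → trans (sym (g-j• v s u)) (trans (cong (g v) (sym (trans (cong (_+ᵥ j s • u) (lin-0 x y)) (+ᵥ-identityˡ _)))) (z (0² , s))))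

      -- For u ≠ 0 a relation with a = 0 has s = 0, which gives the summand `count W*?`. A relation
      -- with a ≠ 0 makes u an S-multiple of the vector `lin x y a` of ℓ. Summing over u first
      -- leaves only the S-multiples of vectors of ℓ that fall into `W`.
      ∑-W*-d : ∑[ u ] (𝟙 (W*? u) * d u) ≡ count W*? + ∑[ a ] (𝟙 (¬? (0² ≟ a)) * count (λ s → W*? (j s • lin x y a)))
      ∑-W*-d = begin
        ∑[ u ] (𝟙 (W*? u) * d u)
          ≡⟨ ∑-cong (λ u → trans (𝟙-*-cong (W*? u) λ (0≢u , _) → d-expand u (0≢u ∘ sym)) (ℕ.*-distribˡ-+ (𝟙 (W*? u)) 1 _)) ⟩
        ∑[ u ] (𝟙 (W*? u) * 1 + 𝟙 (W*? u) * (∑[ a ] (𝟙 (¬? (0² ≟ a)) * count (λ s → j s • lin x y a ≟ u))))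
          ≡⟨ ∑-+ _ _ ⟩
        (∑[ u ] (𝟙 (W*? u) * 1)) + (∑[ u ] (𝟙 (W*? u) * (∑[ a ] (𝟙 (¬? (0² ≟ a)) * count (λ s → j s • lin x y a ≟ u)))))
          ≡⟨ cong₂ _+_ (∑-cong λ u → ℕ.*-identityʳ _) exchange ⟩
        count W*? + (∑[ a ] (𝟙 (¬? (0² ≟ a)) * count (λ s → W*? (j s • lin x y a)))) ∎
        where
        d-expand : ∀ u → u ≢ 0ᵥ → d u ≡ 1 + (∑[ a ] (𝟙 (¬? (0² ≟ a)) * count (λ s → j s • lin x y a ≟ u)))
        d-expand u u≢0 = trans (∑-remove 0² _) (cong₂ _+_
          (count-unique _ S.0# (trans (cong₂ _+ᵥ_ (lin-0 x y) (trans (cong (_• u) j-0) (0• u))) (+ᵥ-identityˡ 0ᵥ))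
            (λ s p → j•≡0⇒≡0 u≢0 (trans (sym (+ᵥ-identityˡ _)) (trans (cong (_+ᵥ j s • u) (sym (lin-0 x y))) p))))
          (∑-cong λ a → 𝟙-*-cong (¬? (0² ≟ a)) λ 0≢a → proportional (lin x y a) u (lin≢0 0≢a) u≢0))
          where
          -- Both counts are at most 1 because w and u are nonzero, and s ↦ - 1/s exchanges the
          -- solutions.
          proportional : ∀ w u → w ≢ 0ᵥ → u ≢ 0ᵥ → count (λ s → w +ᵥ j s • u ≟ 0ᵥ) ≡ count (λ s → j s • w ≟ u)
          proportional w u w≢0 u≢0 = begin
            count (λ s → w +ᵥ j s • u ≟ 0ᵥ)
              ≡⟨ count-≤1 _ (λ s t p p′ → j-injective s t (•-injectiveˡ u≢0 _ _ (trans (u+v≡0⇒v≡-u p) (sym (u+v≡0⇒v≡-u p′))))) ⟩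
            𝟙 (any? λ s → w +ᵥ j s • u ≟ 0ᵥ)
              ≡⟨ 𝟙-cong (any? λ s → w +ᵥ j s • u ≟ 0ᵥ) (any? λ s → j s • w ≟ u) to from ⟩
            𝟙 (any? λ s → j s • w ≟ u)
              ≡⟨ count-≤1 _ (λ s t p p′ → j-injective s t (•-injectiveˡ w≢0 _ _ (trans p (sym p′)))) ⟨
            count (λ s → j s • w ≟ u) ∎
            where
            to : (∃ λ s → w +ᵥ j s • u ≡ 0ᵥ) → ∃ λ s → j s • w ≡ u
            to (s , p) = S.-ᶠ Sp.inv s s≢0 , (begin
              j (S.-ᶠ Sp.inv s s≢0) • w                   ≡⟨ trans (cong (_• w) (j-neg _)) (-•ˡ _ w) ⟩
              -ᵥ (j (Sp.inv s s≢0) • w)                   ≡⟨ cong (λ v → -ᵥ (j (Sp.inv s s≢0) • v)) w≡ ⟩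
              -ᵥ (j (Sp.inv s s≢0) • (-ᶠ j s) • u)        ≡⟨ cong -ᵥ_ (trans (sym (•-assoc _ _ u)) (cong (_• u) (trans (sym (Ep.-‿distribʳ-* _ _)) (cong -ᶠ_ (trans (sym (j-* _ _)) (trans (cong j (proj₁ (proj₂ (S.invertible s s≢0)))) j-1)))))) ⟩
              -ᵥ ((-ᶠ 1#) • u)                            ≡⟨ cong -ᵥ_ (trans (-•ˡ 1# u) (cong -ᵥ_ (1• u))) ⟩
              -ᵥ -ᵥ u                                     ≡⟨ -ᵥ-involutive u ⟩
              u                                           ∎)
              where
              s≢0 : s ≢ S.0#
              s≢0 refl = w≢0 (trans (sym (+ᵥ-identityʳ w)) (trans (cong (w +ᵥ_) (sym (trans (cong (_• u) j-0) (0• u)))) p))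
              w≡ : w ≡ (-ᶠ j s) • u
              w≡ = trans (u+v≡0⇒v≡-u (trans (+ᵥ-comm _ _) p)) (sym (-•ˡ (j s) u))
            from : (∃ λ s → j s • w ≡ u) → ∃ λ s → w +ᵥ j s • u ≡ 0ᵥ
            from (s , refl) = S.-ᶠ Sp.inv s s≢0 , (begin
              w +ᵥ j (S.-ᶠ Sp.inv s s≢0) • j s • w        ≡⟨ cong (w +ᵥ_) (trans (sym (•-assoc _ _ w)) (cong (_• w) (trans (sym (j-* _ _)) (trans (cong j (trans (sym (Sp.-‿distribˡ-* _ _)) (cong S.-ᶠ_ (proj₁ (proj₂ (S.invertible s s≢0)))))) (trans (j-neg _) (cong -ᶠ_ j-1)))))) ⟩
              w +ᵥ (-ᶠ 1#) • w                            ≡⟨ cong (w +ᵥ_) (trans (-•ˡ 1# w) (cong -ᵥ_ (1• w))) ⟩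
              w +ᵥ -ᵥ w                                   ≡⟨ +ᵥ-inverseʳ w ⟩
              0ᵥ                                          ∎)
              where
              s≢0 : s ≢ S.0#
              s≢0 refl = u≢0 (trans (cong (_• w) j-0) (0• w))
        exchange : ∑[ u ] (𝟙 (W*? u) * (∑[ a ] (𝟙 (¬? (0² ≟ a)) * count (λ s → j s • lin x y a ≟ u))))
          ≡ ∑[ a ] (𝟙 (¬? (0² ≟ a)) * count (λ s → W*? (j s • lin x y a)))
        exchange = begin
          ∑[ u ] (𝟙 (W*? u) * (∑[ a ] (𝟙 (¬? (0² ≟ a)) * count (λ s → j s • lin x y a ≟ u))))
            ≡⟨ ∑-cong (λ u → sym (∑-*ˡ (𝟙 (W*? u)) _)) ⟩
          ∑[ u ] ∑[ a ] (𝟙 (W*? u) * (𝟙 (¬? (0² ≟ a)) * count (λ s → j s • lin x y a ≟ u)))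
            ≡⟨ ∑-swap _ ⟩
          ∑[ a ] ∑[ u ] (𝟙 (W*? u) * (𝟙 (¬? (0² ≟ a)) * count (λ s → j s • lin x y a ≟ u)))
            ≡⟨ ∑-cong (λ a → trans (∑-cong λ u → swap-factors (𝟙 (W*? u)) (𝟙 (¬? (0² ≟ a))) _) (∑-*ˡ (𝟙 (¬? (0² ≟ a))) _)) ⟩
          ∑[ a ] (𝟙 (¬? (0² ≟ a)) * (∑[ u ] (𝟙 (W*? u) * count (λ s → j s • lin x y a ≟ u))))
            ≡⟨ ∑-cong (λ a → cong (𝟙 (¬? (0² ≟ a)) *_) (begin
                 ∑[ u ] (𝟙 (W*? u) * count (λ s → j s • lin x y a ≟ u))         ≡⟨ ∑-cong (λ u → sym (∑-*ˡ (𝟙 (W*? u)) _)) ⟩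
                 ∑[ u ] ∑[ s ] (𝟙 (W*? u) * 𝟙 (j s • lin x y a ≟ u))            ≡⟨ ∑-swap _ ⟩
                 ∑[ s ] ∑[ u ] (𝟙 (W*? u) * 𝟙 (j s • lin x y a ≟ u))            ≡⟨ ∑-cong (λ s → trans (∑-cong λ u → ℕ.*-comm (𝟙 (W*? u)) _) (∑-at (j s • lin x y a) _)) ⟩
                 ∑[ s ] 𝟙 (W*? (j s • lin x y a))                               ∎)) ⟩
          ∑[ a ] (𝟙 (¬? (0² ≟ a)) * count (λ s → W*? (j s • lin x y a))) ∎
          where
          swap-factors : ∀ a b c → a * (b * c) ≡ b * (a * c)
          swap-factors = ℕSolver.solve-∀

      count-W*-on : ∀ w → w ≢ 0ᵥ → count (λ s → W? (j s • w)) ≡ 1 + count (λ s → W*? (j s • w))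
      count-W*-on w w≢0 = trans (∑-remove S.0# _) (cong₂ _+_
        (𝟙-yes _ (subst W (sym (trans (cong (_• w) j-0) (0• w))) W-0))
        (∑-cong λ s → trans (sym (𝟙-× (¬? (S.0# ≟ s)) (W? (j s • w))))
          (𝟙-cong (¬? (S.0# ≟ s) ×-dec W? (j s • w)) (W*? (j s • w))
            (λ (s≢0 , p) → (λ eq → s≢0 (sym (j•≡0⇒≡0 w≢0 (sym eq)))) , p)
            (λ (js≢0 , p) → (λ { refl → js≢0 (sym (trans (cong (_• w) j-0) (0• w))) }) , p))))

  -- 1 and e are independent over F, and F × F has as many elements as E; so injectivity of (c , d)
  -- ↦ c + d e already gives surjectivity.
  decompose : ∀ e → ¬ (∃ λ c → ι c ≡ e) → ∀ z → ∃ λ (c , d) → ι c +ᶠ ι d *ᶠ e ≡ z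
  decompose e e∉F = injective⇒surjective h h-injective (cong (q *_) (sym (ℕ.*-identityʳ q)))
    where
    h : F.Carrier × F.Carrier → E.Carrier
    h (c , d) = ι c +ᶠ ι d *ᶠ e
    h-homo : ∀ c d c′ d′ → h (c F.+ᶠ c′ , d F.+ᶠ d′) ≡ h (c , d) +ᶠ h (c′ , d′)
    h-homo c d c′ d′ = trans (cong₂ _+ᶠ_ (ι-+ c c′) (trans (cong (_*ᶠ e) (ι-+ d d′)) (Ep.distribʳ e _ _))) (Ep.+-medial _ _ _ _)
    h≡0 : ∀ c d → h (c , d) ≡ 0# → c ≡ F.0# × d ≡ F.0#
    h≡0 c d p with d ≟ F.0#
    ... | yes refl = ι≡0⇒≡0 (trans (sym (trans (cong (ι c +ᶠ_) (trans (cong (_*ᶠ e) ι-0) (Ep.zeroˡ e))) (Ep.+-identityʳ _))) p) , refl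
    ... | no d≢0 = contradiction (Fp.inv d d≢0 F.*ᶠ (F.-ᶠ c) , (begin
      ι (Fp.inv d d≢0 F.*ᶠ (F.-ᶠ c))            ≡⟨ trans (ι-* _ _) (cong (ι (Fp.inv d d≢0) *ᶠ_) (ι-neg c)) ⟩
      ι (Fp.inv d d≢0) *ᶠ (-ᶠ ι c)              ≡⟨ cong (ι (Fp.inv d d≢0) *ᶠ_) (Ep.x+y≡0⇒y≡-x p) ⟨
      ι (Fp.inv d d≢0) *ᶠ (ι d *ᶠ e)            ≡⟨ Ep.*-assoc _ _ _ ⟨
      ι (Fp.inv d d≢0) *ᶠ ι d *ᶠ e              ≡⟨ cong (_*ᶠ e) (trans (sym (ι-* _ _)) (trans (cong ι (proj₁ (proj₂ (F.invertible d d≢0)))) ι-1)) ⟩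
      1# *ᶠ e                                   ≡⟨ Ep.*-identityˡ e ⟩
      e                                         ∎)) e∉F
    h-injective : ∀ a b → h a ≡ h b → a ≡ b
    h-injective (c , d) (c′ , d′) p = cong₂ _,_ (Fp.x-y≡0⇒x≡y (proj₁ diff)) (Fp.x-y≡0⇒x≡y (proj₂ diff))
      where
      diff = h≡0 (c F.+ᶠ F.-ᶠ c′) (d F.+ᶠ F.-ᶠ d′) (begin
        h (c F.+ᶠ F.-ᶠ c′ , d F.+ᶠ F.-ᶠ d′)              ≡⟨ h-homo c d (F.-ᶠ c′) (F.-ᶠ d′) ⟩
        h (c , d) +ᶠ h (F.-ᶠ c′ , F.-ᶠ d′)               ≡⟨ cong (_+ᶠ h (F.-ᶠ c′ , F.-ᶠ d′)) p ⟩
        h (c′ , d′) +ᶠ h (F.-ᶠ c′ , F.-ᶠ d′)             ≡⟨ h-homo c′ d′ (F.-ᶠ c′) (F.-ᶠ d′) ⟨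
        h (c′ F.+ᶠ F.-ᶠ c′ , d′ F.+ᶠ F.-ᶠ d′)            ≡⟨ cong₂ (λ u v → h (u , v)) (Fp.-‿inverseʳ c′) (Fp.-‿inverseʳ d′) ⟩
        h 0²                                             ≡⟨ cong₂ _+ᶠ_ ι-0 (trans (cong (_*ᶠ e) ι-0) (Ep.zeroˡ e)) ⟩
        0# +ᶠ 0#                                         ≡⟨ Ep.+-identityˡ 0# ⟩
        0#                                               ∎)

  infix 4 _∈F⟨_⟩
  _∈F⟨_⟩ : V → V → Set
  v ∈F⟨ u ⟩ = ∃ λ c → ι c • u ≡ v

  _∈F⟨_⟩? : ∀ v u → Dec (v ∈F⟨ u ⟩)
  v ∈F⟨ u ⟩? = any? λ c → ι c • u ≟ v

  count-∈⟨⟩∖∈F⟨⟩ : ∀ u → u ≢ 0ᵥ → count (λ v → (v ∈⟨ u ⟩?) ×-dec ¬? (v ∈F⟨ u ⟩?)) ≡ q * k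
  count-∈⟨⟩∖∈F⟨⟩ u u≢0 = ℕ.+-cancelʳ-≡ q _ _ (begin
    count (λ v → (v ∈⟨ u ⟩?) ×-dec ¬? (v ∈F⟨ u ⟩?)) + q
      ≡⟨ cong₂ _+_ refl (count-image (λ c → ι c • u) λ c d p → ι-injective c d (•-injectiveˡ u≢0 _ _ p)) ⟨
    count (λ v → (v ∈⟨ u ⟩?) ×-dec ¬? (v ∈F⟨ u ⟩?)) + count (λ v → v ∈F⟨ u ⟩?)
      ≡⟨ count-∖ (λ v → v ∈F⟨ u ⟩?) (λ v → v ∈⟨ u ⟩?) (λ v (c , p) → ι c , p) ⟩
    count (λ v → v ∈⟨ u ⟩?)
      ≡⟨ count-image (_• u) (•-injectiveˡ u≢0) ⟩
    q ^ 2
      ≡⟨ lemma k ⟩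
    q * k + q ∎)
    where
    lemma : ∀ k → suc k * (suc k * 1) ≡ suc k * k + suc k
    lemma = ℕSolver.solve-∀

  -- The counts for a fixed line

  module Evaluate (x y : V) (indep : Independent x y) where
    open Perp x y indep public
    private
      module SF = ScalarCounts scalarsF
      module SE = ScalarCounts scalarsE
      module LF = SF.OnLine x y indep
      module LE = SE.OnLine x y indep

    M : ℕ
    M = count (λ a → ¬? (0² ≟ a))

    1+M≡q² : 1 + M ≡ q * q
    1+M≡q² = sym (trans (sym (trans (∑-const 1) (ℕ.*-identityʳ (q * q)))) (trans (∑-remove 0² (λ _ → 1))
      (cong (1 +_) (∑-cong λ a → ℕ.*-identityʳ _))))

    ∑-nonzero : {h : F.Carrier × F.Carrier → ℕ} {c : ℕ} → (∀ a → 0² ≢ a → h a ≡ c) →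
      ∑[ a ] (𝟙 (¬? (0² ≟ a)) * h a) ≡ M * c
    ∑-nonzero {c = c} p = trans (∑-cong λ a → 𝟙-*-cong (¬? (0² ≟ a)) (p a)) (∑-*ʳ c _)

    count-W* : count W? ≡ 1 + count W*?
    count-W* = trans (∑-remove 0ᵥ _) (cong₂ _+_ (𝟙-yes (W? 0ᵥ) W-0) (∑-cong λ v → sym (𝟙-× (¬? (0ᵥ ≟ v)) (W? v))))

    -- The radical of the pairing (c , d) ↦ tr (a * f w (c x + d y)).
    count-multiples : ∀ w → count (λ a → W? (a • w)) ≡ count (λ a → f w (lin x y a) ≟ 0#)
    count-multiples w = ℕ.*-cancelʳ-≡ _ _ (q * q) (begin
      count (λ a → W? (a • w)) * (q * q)
        ≡⟨ count-radicals {Fˢ ×ˢ Fˢ} {Eˢ} (λ a e → g (e • w) (lin x y a))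
             (λ e → record { +-homo = λ a b → trans (cong (g (e • w)) (L.+-homo a b)) (g-+ʳ _ _ _)
                           ; ⊙-homo = λ c a → trans (cong (g (e • w)) (L.⊙-homo c a)) (g-ι•ʳ c _ _) })
             (λ a → record { +-homo = λ e e′ → trans (cong (λ v → g v (lin x y a)) (•-distribʳ e e′ w)) (g-+ˡ _ _ _)
                           ; ⊙-homo = λ c e → trans (cong (λ v → g v (lin x y a)) (•-assoc (ι c) e w)) (g-ι•ˡ c _ _) })
             1≤k (λ a → f w (lin x y a) ≟ 0#)
             (λ a p e → trans (cong tr (trans (•-homoˡ e w _) (trans (cong (e *ᶠ_) p) (Ep.zeroʳ e)))) tr-0)
             (λ a z → tr-nondegenerate _ λ e → trans (cong tr (sym (•-homoˡ e w _))) (z e))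
             (λ a → W? (a • w)) (λ a → W⇒lin) (λ a → lin⇒W) ⟩
      q ^ 2 * count (λ a → f w (lin x y a) ≟ 0#)
        ≡⟨ trans (cong (_* count (λ a → f w (lin x y a) ≟ 0#)) (cong (q *_) (ℕ.*-identityʳ q))) (ℕ.*-comm (q * q) _) ⟩
      count (λ a → f w (lin x y a) ≟ 0#) * (q * q) ∎)
      where module L = IsLinear (lin-linear x y)

    A-F A-E : V → ℕ
    A-F u = count (λ v → W? v ×-dec (g v u ≟ F.0#))
    A-E u = count (λ v → W? v ×-dec (f v u ≟ 0#))

    A-F≡ : ∀ u → A-F u * (q * q * q) ≡ ∣ V ∣ * LF.d u
    A-F≡ u = LF.count-W∩Orth u (λ v → g v u ≟ F.0#)
      (λ v p s → trans (tr-ι* s _) (trans (cong (s F.*ᶠ_) p) (Fp.zeroʳ s)))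
      (λ v z → trans (cong tr (sym (trans (cong (_*ᶠ f v u) ι-1) (Ep.*-identityˡ _)))) (z F.1#))

    A-E≡ : ∀ u → A-E u * (q * q * q ^ 2) ≡ ∣ V ∣ * LE.d u
    A-E≡ u = LE.count-W∩Orth u (λ v → f v u ≟ 0#)
      (λ v p s → trans (cong tr (trans (cong (s *ᶠ_) p) (Ep.zeroʳ s))) tr-0)
      (λ v z → tr-nondegenerate _ z)

    -- The pairs of `T-∥` are among those of `T-E`, and these among those of `T-F`. The excess of
    -- `T-F` over `T-E` counts ordered bases of lines of 𝓞₁ in `W`, that of `T-E` over `T-∥` ordered
    -- bases of lines of 𝓞₂.
    T-F T-E T-∥ : ℕ
    T-F = ∑[ u ] (𝟙 (W*? u) * A-F u)
    T-E = ∑[ u ] (𝟙 (W*? u) * A-E u)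
    T-∥ = ∑[ u ] (𝟙 (W*? u) * count (λ v → W? v ×-dec (v ∈⟨ u ⟩?)))

    private
      weighted : ∀ {A d : V → ℕ} {s} → (∀ u → A u * s ≡ ∣ V ∣ * d u) →
        ∑[ u ] (𝟙 (W*? u) * A u) * s ≡ ∣ V ∣ * (∑[ u ] (𝟙 (W*? u) * d u))
      weighted {A} {d} {s} eq = begin
        ∑[ u ] (𝟙 (W*? u) * A u) * s             ≡⟨ ∑-*ʳ s _ ⟨
        ∑[ u ] (𝟙 (W*? u) * A u * s)             ≡⟨ ∑-cong (λ u → trans (ℕ.*-assoc (𝟙 (W*? u)) _ s) (trans (cong (𝟙 (W*? u) *_) (eq u)) (shuffle (𝟙 (W*? u)) ∣ V ∣ (d u)))) ⟩
        ∑[ u ] (∣ V ∣ * (𝟙 (W*? u) * d u))       ≡⟨ ∑-*ˡ ∣ V ∣ _ ⟩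
        ∣ V ∣ * (∑[ u ] (𝟙 (W*? u) * d u))       ∎
        where
        shuffle : ∀ a b c → a * (b * c) ≡ b * (a * c)
        shuffle = ℕSolver.solve-∀

    T-F≡ : ∀ {c} → (∀ a → 0² ≢ a → count (λ s → W*? (ι s • lin x y a)) ≡ c) →
      T-F * (q * q * q) ≡ ∣ V ∣ * (count W*? + M * c)
    T-F≡ p = trans (weighted A-F≡) (cong (∣ V ∣ *_) (trans LF.∑-W*-d (cong (count W*? +_) (∑-nonzero p))))

    T-E≡ : ∀ {c} → (∀ a → 0² ≢ a → count (λ e → W*? (e • lin x y a)) ≡ c) →
      T-E * (q * q * q ^ 2) ≡ ∣ V ∣ * (count W*? + M * c)
    T-E≡ p = trans (weighted A-E≡) (cong (∣ V ∣ *_) (trans LE.∑-W*-d (cong (count W*? +_) (∑-nonzero p))))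

    -- Pairs with v = e u become scalars e with e u in `W`, and `count-multiples` trades these for
    -- the a with f u (lin x y a) = 0. Exchanging the sums leaves `A-E` at the vectors of ℓ. The 1
    -- in `1 + c` is u = 0, which `A-E` counts and `W*?` excludes.
    T-∥≡ : ∀ {c} → (∀ a → 0² ≢ a → A-E (lin x y a) ≡ 1 + c) → T-∥ ≡ count W*? + M * c
    T-∥≡ {c} p = begin
      ∑[ u ] (𝟙 (W*? u) * count (λ v → W? v ×-dec (v ∈⟨ u ⟩?)))
        ≡⟨ ∑-cong (λ u → 𝟙-*-cong (W*? u) λ (0≢u , _) → begin
             ∑[ v ] 𝟙 (W? v ×-dec (v ∈⟨ u ⟩?))        ≡⟨ ∑-cong (λ v → trans (𝟙-× (W? v) (v ∈⟨ u ⟩?)) (ℕ.*-comm (𝟙 (W? v)) _)) ⟩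
             ∑[ v ] (𝟙 (v ∈⟨ u ⟩?) * 𝟙 (W? v))        ≡⟨ ∑-image (_• u) (•-injectiveˡ (0≢u ∘ sym)) _ ⟩
             ∑[ a ] 𝟙 (W? (a • u))                    ≡⟨ count-multiples u ⟩
             count (λ a → f u (lin x y a) ≟ 0#)       ∎) ⟩
      ∑[ u ] (𝟙 (W*? u) * count (λ a → f u (lin x y a) ≟ 0#))
        ≡⟨ ∑-cong (λ u → sym (∑-*ˡ (𝟙 (W*? u)) _)) ⟩
      ∑[ u ] ∑[ a ] (𝟙 (W*? u) * 𝟙 (f u (lin x y a) ≟ 0#))
        ≡⟨ ∑-swap _ ⟩
      ∑[ a ] ∑[ u ] (𝟙 (W*? u) * 𝟙 (f u (lin x y a) ≟ 0#))
        ≡⟨ ∑-remove 0² _ ⟩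
      ∑[ u ] (𝟙 (W*? u) * 𝟙 (f u (lin x y 0²) ≟ 0#)) + (∑[ a ] (𝟙 (¬? (0² ≟ a)) * (∑[ u ] (𝟙 (W*? u) * 𝟙 (f u (lin x y a) ≟ 0#)))))
        ≡⟨ cong₂ _+_ (∑-cong λ u → trans (cong (𝟙 (W*? u) *_) (𝟙-yes _ (trans (cong (f u) (lin-0 x y)) (f-0ʳ u)))) (ℕ.*-identityʳ _))
             (∑-nonzero λ a 0≢a → ℕ.suc-injective (trans (sym (A-E-remove (lin x y a))) (p a 0≢a))) ⟩
      count W*? + M * c ∎
      where
      A-E-remove : ∀ w → A-E w ≡ 1 + (∑[ u ] (𝟙 (W*? u) * 𝟙 (f u w ≟ 0#)))
      A-E-remove w = trans (∑-remove 0ᵥ _) (cong₂ _+_ (𝟙-yes (W? 0ᵥ ×-dec (f 0ᵥ w ≟ 0#)) (W-0 , f-0ˡ w))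
        (∑-cong λ u → begin
          𝟙 (¬? (0ᵥ ≟ u)) * 𝟙 (W? u ×-dec (f u w ≟ 0#))         ≡⟨ cong (𝟙 (¬? (0ᵥ ≟ u)) *_) (𝟙-× (W? u) _) ⟩
          𝟙 (¬? (0ᵥ ≟ u)) * (𝟙 (W? u) * 𝟙 (f u w ≟ 0#))         ≡⟨ ℕ.*-assoc (𝟙 (¬? (0ᵥ ≟ u))) _ _ ⟨
          𝟙 (¬? (0ᵥ ≟ u)) * 𝟙 (W? u) * 𝟙 (f u w ≟ 0#)           ≡⟨ cong (_* 𝟙 (f u w ≟ 0#)) (𝟙-× (¬? (0ᵥ ≟ u)) (W? u)) ⟨
          𝟙 (W*? u) * 𝟙 (f u w ≟ 0#)                            ∎))

    -- Here u lies on ℓ itself. As x and y are independent, e determines a′, so the relations are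
    -- counted by the e that keep `lin x y a` on ℓ.
    A-E-lin : ∀ {a c} → 0² ≢ a → count (λ e → any? λ a′ → lin x y a′ +ᵥ e • lin x y a ≟ 0ᵥ) ≡ c →
      A-E (lin x y a) * (q * q * q ^ 2) ≡ ∣ V ∣ * c
    A-E-lin {a} {c} 0≢a p = trans (A-E≡ (lin x y a)) (cong (∣ V ∣ *_) (trans (∑-swap _) (trans
      (∑-cong λ e → count-≤1 (λ a′ → lin x y a′ +ᵥ e • lin x y a ≟ 0ᵥ) λ a₁ a₂ p₁ p₂ → lin-injective a₁ a₂
        (trans (u+v≡0⇒v≡-u (trans (+ᵥ-comm _ _) p₁)) (sym (u+v≡0⇒v≡-u (trans (+ᵥ-comm _ _) p₂))))) p)))

    f-lin0 : f x y ≡ 0# → ∀ a b → f (lin x y a) (lin x y b) ≡ 0#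
    f-lin0 p (c , d) (c′ , d′) = trans (f-lin x y c d c′ d′) (trans (cong₂ _*ᶠ_ refl p) (Ep.zeroʳ _))

    count-W-E-isotropic : f x y ≡ 0# → ∀ a → count (λ e → W? (e • lin x y a)) ≡ q * q
    count-W-E-isotropic p a = trans (count-multiples (lin x y a)) (count-all _ (f-lin0 p a))

    -- On ℓ, f is the determinant of the coefficient pairs times f x y. For (c , d) ≠ 0 the
    -- determinant `φ` is a nonzero linear form on F², with values c and - d at the unit vectors, so
    -- its kernel has q elements.
    count-W-E-anisotropic : f x y ≢ 0# → ∀ a → 0² ≢ a → count (λ e → W? (e • lin x y a)) ≡ q
    count-W-E-anisotropic f≢0 (c , d) 0≢a = trans (count-multiples (lin x y (c , d))) (ℕ.*-cancelˡ-≡ _ _ q (trans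
      (cong (q *_) (count-cong (λ b → f (lin x y (c , d)) (lin x y b) ≟ 0#) (λ b → φ b ≟ F.0#) to from))
      (uncurry-kernel)))
      where
      φ : F.Carrier × F.Carrier → F.Carrier
      φ (c′ , d′) = c F.*ᶠ d′ F.+ᶠ F.-ᶠ (d F.*ᶠ c′)
      to : ∀ b → f (lin x y (c , d)) (lin x y b) ≡ 0# → φ b ≡ F.0#
      to (c′ , d′) p = ι≡0⇒≡0 (Ep.xy≡0⇒y≡0 f≢0 (trans (Ep.*-comm _ _) (trans (sym (f-lin x y c d c′ d′)) p)))
      from : ∀ b → φ b ≡ F.0# → f (lin x y (c , d)) (lin x y b) ≡ 0#
      from (c′ , d′) p = trans (f-lin x y c d c′ d′) (trans (cong (λ u → ι u *ᶠ f x y) p) (trans (cong (_*ᶠ f x y) ι-0) (Ep.zeroˡ _)))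
      form : IsForm (Fˢ ×ˢ Fˢ) φ
      form = record
        { +-homo = λ (c₁ , d₁) (c₂ , d₂) → trans (cong₂ F._+ᶠ_ (Fp.distribˡ c d₁ d₂) (trans (cong F.-ᶠ_ (Fp.distribˡ d c₁ c₂)) (sym (Fp.-‿+-comm _ _))))
                                                  (Fp.+-medial _ _ _ _)
        ; ⊙-homo = λ s (c₁ , d₁) → trans (cong₂ F._+ᶠ_ (shuffle c s d₁) (trans (cong F.-ᶠ_ (shuffle d s c₁)) (Fp.-‿distribʳ-* s _))) (sym (Fp.distribˡ s _ _))
        }
        where
        shuffle : ∀ c s d → c F.*ᶠ (s F.*ᶠ d) ≡ s F.*ᶠ (c F.*ᶠ d)
        shuffle c s d = trans (sym (Fp.*-assoc _ _ _)) (trans (cong (F._*ᶠ d) (Fp.*-comm c s)) (Fp.*-assoc _ _ _))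
      φ-0,1 : φ (F.0# , F.1#) ≡ c
      φ-0,1 = trans (cong₂ F._+ᶠ_ (Fp.*-identityʳ c) (trans (cong F.-ᶠ_ (Fp.zeroʳ d)) Fp.-0#≈0#)) (Fp.+-identityʳ c)
      φ-1,0 : φ (F.1# , F.0#) ≡ F.-ᶠ d
      φ-1,0 = trans (cong₂ F._+ᶠ_ (Fp.zeroʳ c) (cong F.-ᶠ_ (Fp.*-identityʳ d))) (Fp.+-identityˡ _)
      uncurry-kernel : q * count (λ b → φ b ≟ F.0#) ≡ q * q
      uncurry-kernel with c ≟ F.0# | d ≟ F.0#
      ... | no c≢0  | _         = count-kernel {A = Fˢ ×ˢ Fˢ} form (F.0# , F.1#) (c≢0 ∘ trans (sym φ-0,1))
      ... | yes _   | no d≢0    = count-kernel {A = Fˢ ×ˢ Fˢ} form (F.1# , F.0#) (λ p → Fp.-‿≢0 d≢0 (trans (sym φ-1,0) p))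
      ... | yes c≡0 | yes d≡0   = contradiction (sym (cong₂ _,_ c≡0 d≡0)) 0≢a

    y∈⟨x⟩⇒∉F : ∀ {e} → e • x ≡ y → ¬ ∃ λ c → ι c ≡ e
    y∈⟨x⟩⇒∉F {e} p (c , refl) = Fp.-‿≢0 F.1#≢0# (cong proj₂ (indep (c , F.-ᶠ F.1#) (begin
      ι c • x +ᵥ ι (F.-ᶠ F.1#) • y    ≡⟨ cong₂ _+ᵥ_ p (trans (cong (_• y) (trans (ι-neg _) (cong -ᶠ_ ι-1))) (trans (-•ˡ 1# y) (cong -ᵥ_ (1• y)))) ⟩
      y +ᵥ -ᵥ y                       ≡⟨ +ᵥ-inverseʳ y ⟩
      0ᵥ                              ∎)))

    x≢0 : x ≢ 0ᵥ
    x≢0 p = F.1#≢0# (cong proj₁ (indep _ (trans (lin-1,0 x y) p)))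

    E-independent : ¬ (y ∈⟨ x ⟩) → ∀ a b → a • x +ᵥ b • y ≡ 0ᵥ → a ≡ 0# × b ≡ 0#
    E-independent y∉ a b p with b ≟ 0#
    ... | no b≢0 = contradiction (Ep.inv b b≢0 *ᶠ (-ᶠ a) , (begin
      (Ep.inv b b≢0 *ᶠ (-ᶠ a)) • x       ≡⟨ •-assoc _ _ x ⟩
      Ep.inv b b≢0 • (-ᶠ a) • x          ≡⟨ cong (Ep.inv b b≢0 •_) (trans (-•ˡ a x) (sym (u+v≡0⇒v≡-u p))) ⟩
      Ep.inv b b≢0 • b • y               ≡⟨ inv-• b b≢0 y ⟩
      y                                  ∎)) y∉
    ... | yes refl with a ≟ 0#
    ...   | yes a≡0 = a≡0 , refl
    ...   | no a≢0 = contradiction (•-cancel a≢0 (trans (sym (trans (cong (a • x +ᵥ_) (0• y)) (+ᵥ-identityʳ _))) p)) x≢0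

    private
      e•lin : ∀ e c d → e • lin x y (c , d) ≡ (e *ᶠ ι c) • x +ᵥ (e *ᶠ ι d) • y
      e•lin e c d = trans (•-distribˡ e _ _) (cong₂ _+ᵥ_ (sym (•-assoc _ _ x)) (sym (•-assoc _ _ y)))

    -- By `decompose` with e₀ outside F, ℓ is all of E x, hence closed under every scalar of E.
    count-E∩ℓ-∥ : y ∈⟨ x ⟩ → ∀ a → count (λ e → any? λ a′ → lin x y a′ +ᵥ e • lin x y a ≟ 0ᵥ) ≡ q * q
    count-E∩ℓ-∥ (e₀ , p) (c , d) = trans (count-all _ all) (cong (q *_) (ℕ.*-identityʳ q))
      where
      lin≡ : ∀ c d → lin x y (c , d) ≡ (ι c +ᶠ ι d *ᶠ e₀) • x
      lin≡ c d = trans (cong (ι c • x +ᵥ_) (trans (cong (ι d •_) (sym p)) (sym (•-assoc _ _ x)))) (sym (•-distribʳ _ _ x))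
      all : ∀ e → ∃ λ a′ → lin x y a′ +ᵥ e • lin x y (c , d) ≡ 0ᵥ
      all e = let z = e *ᶠ (ι c +ᶠ ι d *ᶠ e₀) ; ((c′ , d′) , eq) = decompose e₀ (y∈⟨x⟩⇒∉F p) (-ᶠ z) in
        (c′ , d′) , (begin
          lin x y (c′ , d′) +ᵥ e • lin x y (c , d)                      ≡⟨ cong₂ (λ u v → u +ᵥ e • v) (trans (lin≡ c′ d′) (cong (_• x) eq)) (lin≡ c d) ⟩
          (-ᶠ z) • x +ᵥ e • (ι c +ᶠ ι d *ᶠ e₀) • x                      ≡⟨ cong₂ _+ᵥ_ (-•ˡ z x) (sym (•-assoc _ _ x)) ⟩
          -ᵥ (z • x) +ᵥ z • x                                           ≡⟨ +ᵥ-inverseˡ _ ⟩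
          0ᵥ                                                            ∎)

    -- x and y are independent over E. Comparing coefficients gives c′ + e c = 0 and d′ + e d = 0,
    -- and since c or d is nonzero, e lies in F.
    count-E∩ℓ-∦ : ¬ (y ∈⟨ x ⟩) → ∀ a → 0² ≢ a → count (λ e → any? λ a′ → lin x y a′ +ᵥ e • lin x y a ≟ 0ᵥ) ≡ q
    count-E∩ℓ-∦ y∉ (c , d) 0≢a = trans (count-cong (λ e → any? λ a′ → lin x y a′ +ᵥ e • lin x y (c , d) ≟ 0ᵥ) (λ e → any? λ s → ι s ≟ e) to from)
      (count-image ι ι-injective)
      where
      scalar : ∀ {e c c′} → c ≢ F.0# → ι c′ +ᶠ e *ᶠ ι c ≡ 0# → ∃ λ s → ι s ≡ e
      scalar {e} {c} {c′} c≢0 p = Fp.inv c c≢0 F.*ᶠ (F.-ᶠ c′) , (begin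
        ι (Fp.inv c c≢0 F.*ᶠ (F.-ᶠ c′))      ≡⟨ trans (ι-* _ _) (cong (ι (Fp.inv c c≢0) *ᶠ_) (ι-neg c′)) ⟩
        ι (Fp.inv c c≢0) *ᶠ (-ᶠ ι c′)        ≡⟨ cong (ι (Fp.inv c c≢0) *ᶠ_) (trans (sym (Ep.x+y≡0⇒y≡-x p)) (Ep.*-comm e (ι c))) ⟩
        ι (Fp.inv c c≢0) *ᶠ (ι c *ᶠ e)       ≡⟨ Ep.*-assoc _ _ _ ⟨
        ι (Fp.inv c c≢0) *ᶠ ι c *ᶠ e         ≡⟨ cong (_*ᶠ e) (trans (sym (ι-* _ _)) (trans (cong ι (proj₁ (proj₂ (F.invertible c c≢0)))) ι-1)) ⟩
        1# *ᶠ e                              ≡⟨ Ep.*-identityˡ e ⟩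
        e                                    ∎)
      to : ∀ e → (∃ λ a′ → lin x y a′ +ᵥ e • lin x y (c , d) ≡ 0ᵥ) → ∃ λ s → ι s ≡ e
      to e ((c′ , d′) , p) with E-independent y∉ (ι c′ +ᶠ e *ᶠ ι c) (ι d′ +ᶠ e *ᶠ ι d) (trans (begin
          (ι c′ +ᶠ e *ᶠ ι c) • x +ᵥ (ι d′ +ᶠ e *ᶠ ι d) • y                              ≡⟨ cong₂ _+ᵥ_ (•-distribʳ _ _ x) (•-distribʳ _ _ y) ⟩
          (ι c′ • x +ᵥ (e *ᶠ ι c) • x) +ᵥ (ι d′ • y +ᵥ (e *ᶠ ι d) • y)                  ≡⟨ +ᵥ-medial _ _ _ _ ⟩
          lin x y (c′ , d′) +ᵥ ((e *ᶠ ι c) • x +ᵥ (e *ᶠ ι d) • y)                       ≡⟨ cong (lin x y (c′ , d′) +ᵥ_) (e•lin e c d) ⟨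
          lin x y (c′ , d′) +ᵥ e • lin x y (c , d)                                      ∎) p)
      ... | pc , pd with c ≟ F.0# | d ≟ F.0#
      ...   | no c≢0  | _       = scalar c≢0 pc
      ...   | yes _   | no d≢0  = scalar d≢0 pd
      ...   | yes c≡0 | yes d≡0 = contradiction (sym (cong₂ _,_ c≡0 d≡0)) 0≢a
      from : ∀ e → (∃ λ s → ι s ≡ e) → ∃ λ a′ → lin x y a′ +ᵥ e • lin x y (c , d) ≡ 0ᵥ
      from _ (s , refl) = (F.-ᶠ s F.*ᶠ c , F.-ᶠ s F.*ᶠ d) , (begin
        lin x y (F.-ᶠ s F.*ᶠ c , F.-ᶠ s F.*ᶠ d) +ᵥ ι s • lin x y (c , d)
          ≡⟨ cong (_+ᵥ ι s • lin x y (c , d)) (trans (IsLinear.⊙-homo (lin-linear x y) (F.-ᶠ s) (c , d)) (trans (cong (_• lin x y (c , d)) (ι-neg s)) (-•ˡ _ _))) ⟩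
        -ᵥ (ι s • lin x y (c , d)) +ᵥ ι s • lin x y (c , d)
          ≡⟨ +ᵥ-inverseˡ _ ⟩
        0ᵥ ∎)

    -- If g vanishes on ℓ, then ℓ lies in `W`, and s = 0 is the only scalar excluded.
    count-W-F-isotropic : g x y ≡ F.0# → ∀ a → 0² ≢ a → count (λ s → W*? (ι s • lin x y a)) ≡ k
    count-W-F-isotropic p a 0≢a = ℕ.suc-injective (trans (sym (LF.count-W*-on (lin x y a) (lin≢0 0≢a))) (count-all _ λ s →
      lin⇒W λ b → trans (g-ι•ˡ s _ _) (trans (cong (s F.*ᶠ_) (g-lin0 a b)) (Fp.zeroʳ s))))
      where
      g-lin0 : ∀ a b → g (lin x y a) (lin x y b) ≡ F.0#
      g-lin0 (c , d) (c′ , d′) = trans (cong tr (f-lin x y c d c′ d′)) (trans (tr-ι* _ _) (trans (cong₂ F._*ᶠ_ refl p) (Fp.zeroʳ _)))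

    -- Pairing c x + d y with y and with x gives c g x y and - d g x y, so both coefficients vanish.
    W∩ℓ-anisotropic : g x y ≢ F.0# → ∀ a → W (lin x y a) → a ≡ 0²
    W∩ℓ-anisotropic g≢0 (c , d) (p , p′) = cong₂ _,_
      (trans (sym coeff-c) (Fp.xy≡0⇒y≡0 g≢0 (trans (Fp.*-comm _ _) (trans (sym (g-lin c d F.0# F.1#)) (trans (cong (g _) (lin-0,1 x y)) p′)))))
      (decidable-stable (d ≟ F.0#) λ d≢0 → Fp.-‿≢0 d≢0 (trans (sym coeff-d) (Fp.xy≡0⇒y≡0 g≢0 (trans (Fp.*-comm _ _) (trans (sym (g-lin c d F.1# F.0#)) (trans (cong (g _) (lin-1,0 x y)) p))))))
      where
      g-lin : ∀ c d c′ d′ → g (lin x y (c , d)) (lin x y (c′ , d′)) ≡ (c F.*ᶠ d′ F.+ᶠ F.-ᶠ (d F.*ᶠ c′)) F.*ᶠ g x y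
      g-lin c d c′ d′ = trans (cong tr (f-lin x y c d c′ d′)) (tr-ι* _ _)
      coeff-c : c F.*ᶠ F.1# F.+ᶠ F.-ᶠ (d F.*ᶠ F.0#) ≡ c
      coeff-c = trans (cong₂ F._+ᶠ_ (Fp.*-identityʳ c) (trans (cong F.-ᶠ_ (Fp.zeroʳ d)) Fp.-0#≈0#)) (Fp.+-identityʳ c)
      coeff-d : c F.*ᶠ F.0# F.+ᶠ F.-ᶠ (d F.*ᶠ F.1#) ≡ F.-ᶠ d
      coeff-d = trans (cong₂ F._+ᶠ_ (Fp.zeroʳ c) (cong F.-ᶠ_ (Fp.*-identityʳ d))) (Fp.+-identityˡ _)

    count-W-F-anisotropic : g x y ≢ F.0# → ∀ a → 0² ≢ a → count (λ s → W*? (ι s • lin x y a)) ≡ 0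
    count-W-F-anisotropic g≢0 (c , d) _ = ∑-zero λ s → 𝟙-no (W*? (ι s • lin x y (c , d))) λ (0≢ , w) → 0≢ (sym (begin
      ι s • lin x y (c , d)               ≡⟨ IsLinear.⊙-homo (lin-linear x y) s (c , d) ⟨
      lin x y (s F.*ᶠ c , s F.*ᶠ d)       ≡⟨ cong (lin x y) (W∩ℓ-anisotropic g≢0 _ (subst W (sym (IsLinear.⊙-homo (lin-linear x y) s (c , d))) w)) ⟩
      lin x y 0²                          ≡⟨ lin-0 x y ⟩
      0ᵥ                                  ∎))

    count-W-E : ∀ {c} a → 0² ≢ a → count (λ e → W? (e • lin x y a)) ≡ 1 + c → count (λ e → W*? (e • lin x y a)) ≡ c
    count-W-E a 0≢a p = ℕ.suc-injective (trans (sym (LE.count-W*-on (lin x y a) (lin≢0 0≢a))) p)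

    f-perp : V → Set
    f-perp v = f v x ≡ 0# × f v y ≡ 0#

    f-perp? : ∀ v → Dec (f-perp v)
    f-perp? v = (f v x ≟ 0#) ×-dec (f v y ≟ 0#)

    combine : E.Carrier × E.Carrier → V
    combine (a , b) = a • x +ᵥ b • y

    -- Duality for the map `combine` on E²; the sum on the right is the size of its kernel.
    count-f-perp : count f-perp? * (q ^ 2 * q ^ 2) ≡ ∣ V ∣ * (∑[ a ] count (λ b → combine (a , b) ≟ 0ᵥ))
    count-f-perp = trans (count-orthogonal {A = Eˢ ×ˢ Eˢ} {h = combine} linear f-perp? to from)
      (cong (∣ V ∣ *_) (∑-× {X = E.Carrier} {Y = E.Carrier} (λ a b → 𝟙 (combine (a , b) ≟ 0ᵥ))))
      where
      linear : IsLinear (Eˢ ×ˢ Eˢ) combine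
      linear = record
        { +-homo = λ (a , b) (a′ , b′) → trans (cong₂ _+ᵥ_ (•-distribʳ a a′ x) (•-distribʳ b b′ y)) (+ᵥ-medial _ _ _ _)
        ; ⊙-homo = λ c (a , b) → trans (cong₂ _+ᵥ_ (•-assoc (ι c) a x) (•-assoc (ι c) b y)) (sym (•-distribˡ (ι c) _ _))
        }
      to : ∀ v → f-perp v → ∀ a → g v (combine a) ≡ F.0#
      to v (p , p′) (a , b) = trans (cong tr (begin
        f v (a • x +ᵥ b • y)                 ≡⟨ trans (+-homoʳ _ _ _) (cong₂ _+ᶠ_ (•-homoʳ a v x) (•-homoʳ b v y)) ⟩
        a *ᶠ f v x +ᶠ b *ᶠ f v y             ≡⟨ cong₂ (λ u w → a *ᶠ u +ᶠ b *ᶠ w) p p′ ⟩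
        a *ᶠ 0# +ᶠ b *ᶠ 0#                   ≡⟨ cong₂ _+ᶠ_ (Ep.zeroʳ a) (Ep.zeroʳ b) ⟩
        0# +ᶠ 0#                             ≡⟨ Ep.+-identityˡ _ ⟩
        0#                                   ∎)) tr-0
      from : ∀ v → (∀ a → g v (combine a) ≡ F.0#) → f-perp v
      from v z = tr-nondegenerate _ (λ a → trans (cong tr (trans (sym (•-homoʳ a v x)) (cong (f v) (sym (trans (cong (a • x +ᵥ_) (0• y)) (+ᵥ-identityʳ _)))))) (z (a , 0#)))
               , tr-nondegenerate _ (λ b → trans (cong tr (trans (sym (•-homoʳ b v y)) (cong (f v) (sym (trans (cong (_+ᵥ b • y) (0• x)) (+ᵥ-identityˡ _)))))) (z (0# , b)))

    count-combine-∥ : y ∈⟨ x ⟩ → ∑[ a ] count (λ b → combine (a , b) ≟ 0ᵥ) ≡ q * q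
    count-combine-∥ (e₀ , p) = trans (∑-swap _) (trans (∑-cong λ b → count-unique (λ a → combine (a , b) ≟ 0ᵥ) (-ᶠ (b *ᶠ e₀)) (solution b)
        λ a p′ → •-injectiveˡ x≢0 _ _ (begin
          a • x                     ≡⟨ u+v≡0⇒v≡-u (trans (+ᵥ-comm _ _) p′) ⟩
          -ᵥ (b • y)                ≡⟨ u+v≡0⇒v≡-u (trans (+ᵥ-comm _ _) (solution b)) ⟨
          (-ᶠ (b *ᶠ e₀)) • x        ∎))
      (trans (∑-const 1) (ones k)))
      where
      ones : ∀ k → suc k ^ 2 * 1 ≡ suc k * suc k
      ones k = trans (ℕ.*-identityʳ (suc k ^ 2)) (cong (suc k *_) (ℕ.*-identityʳ (suc k)))
      solution : ∀ b → combine (-ᶠ (b *ᶠ e₀) , b) ≡ 0ᵥ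
      solution b = trans (cong₂ _+ᵥ_ (-•ˡ _ x) (trans (cong (b •_) (sym p)) (sym (•-assoc b e₀ x)))) (+ᵥ-inverseˡ _)

    count-combine-∦ : ¬ (y ∈⟨ x ⟩) → ∑[ a ] count (λ b → combine (a , b) ≟ 0ᵥ) ≡ 1
    count-combine-∦ y∉ = trans (∑-single 0# (λ a a≢0 → ∑-zero λ b → 𝟙-no (combine (a , b) ≟ 0ᵥ) λ p → a≢0 (proj₁ (E-independent y∉ a b p))))
      (count-unique (λ b → combine (0# , b) ≟ 0ᵥ) 0# (trans (cong₂ _+ᵥ_ (0• x) (0• y)) (+ᵥ-identityˡ _)) (λ b p → proj₂ (E-independent y∉ 0# b p)))

    -- The conditions on (u , v) are literally the relations `R` of the three families defined
    -- later, so the values found here are what `isDual` asks for.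
    T-𝓞₁ T-𝓞₂ T-𝓕 : ℕ
    T-𝓞₁ = ∑[ u ] (𝟙 (W*? u) * count (λ v → W? v ×-dec ((g v u ≟ F.0#) ×-dec ¬? (f v u ≟ 0#))))
    T-𝓞₂ = ∑[ u ] (𝟙 (W*? u) * count (λ v → W? v ×-dec ((f v u ≟ 0#) ×-dec ¬? (v ∈⟨ u ⟩?))))
    T-𝓕 = ∑[ u ] (𝟙 (W*? u) * count (λ v → W? v ×-dec ((v ∈⟨ u ⟩?) ×-dec ¬? (v ∈F⟨ u ⟩?))))

    private
      difference : {P Q : V → V → Set} (P? : ∀ v u → Dec (P v u)) (Q? : ∀ v u → Dec (Q v u)) → (∀ v u → P v u → Q v u) →
        ∑[ u ] (𝟙 (W*? u) * count (λ v → W? v ×-dec (Q? v u ×-dec ¬? (P? v u)))) + ∑[ u ] (𝟙 (W*? u) * count (λ v → W? v ×-dec P? v u))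
          ≡ ∑[ u ] (𝟙 (W*? u) * count (λ v → W? v ×-dec Q? v u))
      difference P? Q? P⇒Q = trans (sym (∑-+ _ _)) (∑-cong λ u → trans (sym (ℕ.*-distribˡ-+ (𝟙 (W*? u)) _ _))
        (cong (𝟙 (W*? u) *_) (trans (cong₂ _+_ (count-cong _ (λ v → (W? v ×-dec Q? v u) ×-dec ¬? (W? v ×-dec P? v u))
            (λ v (w , qv , ¬p) → (w , qv) , λ (_ , p) → ¬p p) (λ v ((w , qv) , ¬wp) → w , qv , λ p → ¬wp (w , p))) refl)
          (count-∖ (λ v → W? v ×-dec P? v u) (λ v → W? v ×-dec Q? v u) (λ v (w , p) → w , P⇒Q v u p)))))

    T-𝓞₁+T-E : T-𝓞₁ + T-E ≡ T-F
    T-𝓞₁+T-E = difference (λ v u → f v u ≟ 0#) (λ v u → g v u ≟ F.0#) (λ v u p → trans (cong tr p) tr-0)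

    T-𝓞₂+T-∥ : T-𝓞₂ + T-∥ ≡ T-E
    T-𝓞₂+T-∥ = difference (λ v u → v ∈⟨ u ⟩?) (λ v u → f v u ≟ 0#) λ { _ u (a , refl) → trans (•-homoˡ a u u) (trans (cong (a *ᶠ_) (alternating u)) (Ep.zeroʳ a)) }

    -- With e outside F, both u and e u lie in `W` exactly if u is orthogonal to x and y for f: as 1
    -- and e span E over F, the two conditions tr z = 0 and tr (e z) = 0 force tr (a z) = 0 for
    -- every a. What remains is a product, with q² - q choices of v for each u.
    T-𝓕≡ : ∀ {c} → count f-perp? ≡ 1 + c → T-𝓕 ≡ c * (q * k)
    T-𝓕≡ {c} p = begin
      ∑[ u ] (𝟙 (W*? u) * count (λ v → W? v ×-dec ((v ∈⟨ u ⟩?) ×-dec ¬? (v ∈F⟨ u ⟩?))))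
        ≡⟨ ∑-cong (λ u → trans (sym (∑-*ˡ (𝟙 (W*? u)) _)) (trans (∑-cong λ v → exchange u v) (∑-*ˡ (𝟙 (¬? (0ᵥ ≟ u)) * 𝟙 (f-perp? u)) _))) ⟩
      ∑[ u ] (𝟙 (¬? (0ᵥ ≟ u)) * 𝟙 (f-perp? u) * count (λ v → (v ∈⟨ u ⟩?) ×-dec ¬? (v ∈F⟨ u ⟩?)))
        ≡⟨ ∑-cong (λ u → trans (cong (_* n u) (sym (𝟙-× (¬? (0ᵥ ≟ u)) (f-perp? u))))
             (trans (𝟙-*-cong (¬? (0ᵥ ≟ u) ×-dec f-perp? u) λ (0≢u , _) → count-∈⟨⟩∖∈F⟨⟩ u (0≢u ∘ sym)) (cong (_* (q * k)) (𝟙-× (¬? (0ᵥ ≟ u)) (f-perp? u))))) ⟩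
      ∑[ u ] (𝟙 (¬? (0ᵥ ≟ u)) * 𝟙 (f-perp? u) * (q * k))
        ≡⟨ ∑-*ʳ (q * k) _ ⟩
      ∑[ u ] (𝟙 (¬? (0ᵥ ≟ u)) * 𝟙 (f-perp? u)) * (q * k)
        ≡⟨ cong (_* (q * k)) (ℕ.suc-injective (trans (sym (trans (∑-remove 0ᵥ _) (cong₂ _+_ (𝟙-yes (f-perp? 0ᵥ) (f-0ˡ x , f-0ˡ y)) refl))) p)) ⟩
      c * (q * k) ∎
      where
      n : V → ℕ
      n u = count (λ v → (v ∈⟨ u ⟩?) ×-dec ¬? (v ∈F⟨ u ⟩?))
      f≡0 : ∀ {e} → ¬ (∃ λ c → ι c ≡ e) → ∀ z → tr z ≡ F.0# → tr (e *ᶠ z) ≡ F.0# → z ≡ 0#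
      f≡0 {e} e∉F z p p′ = tr-nondegenerate z λ a → let ((c , d) , eq) = decompose e e∉F a in begin
        tr (a *ᶠ z)                               ≡⟨ cong (λ a → tr (a *ᶠ z)) eq ⟨
        tr ((ι c +ᶠ ι d *ᶠ e) *ᶠ z)               ≡⟨ cong tr (trans (Ep.distribʳ z _ _) (cong (ι c *ᶠ z +ᶠ_) (Ep.*-assoc _ _ _))) ⟩
        tr (ι c *ᶠ z +ᶠ ι d *ᶠ (e *ᶠ z))          ≡⟨ trans (tr-+ _ _) (cong₂ F._+ᶠ_ (tr-ι* c z) (tr-ι* d _)) ⟩
        c F.*ᶠ tr z F.+ᶠ d F.*ᶠ tr (e *ᶠ z)       ≡⟨ cong₂ (λ u v → c F.*ᶠ u F.+ᶠ d F.*ᶠ v) p p′ ⟩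
        c F.*ᶠ F.0# F.+ᶠ d F.*ᶠ F.0#              ≡⟨ trans (cong₂ F._+ᶠ_ (Fp.zeroʳ c) (Fp.zeroʳ d)) (Fp.+-identityˡ _) ⟩
        F.0#                                      ∎
      exchange : ∀ u v → 𝟙 (W*? u) * 𝟙 (W? v ×-dec ((v ∈⟨ u ⟩?) ×-dec ¬? (v ∈F⟨ u ⟩?)))
        ≡ 𝟙 (¬? (0ᵥ ≟ u)) * 𝟙 (f-perp? u) * 𝟙 ((v ∈⟨ u ⟩?) ×-dec ¬? (v ∈F⟨ u ⟩?))
      exchange u v = begin
        𝟙 (W*? u) * 𝟙 (W? v ×-dec S?)                  ≡⟨ 𝟙-× (W*? u) (W? v ×-dec S?) ⟨
        𝟙 (W*? u ×-dec (W? v ×-dec S?))                ≡⟨ 𝟙-cong (W*? u ×-dec (W? v ×-dec S?)) ((¬? (0ᵥ ≟ u) ×-dec f-perp? u) ×-dec S?) to from ⟩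
        𝟙 ((¬? (0ᵥ ≟ u) ×-dec f-perp? u) ×-dec S?)     ≡⟨ trans (𝟙-× (¬? (0ᵥ ≟ u) ×-dec f-perp? u) S?) (cong (_* 𝟙 S?) (𝟙-× (¬? (0ᵥ ≟ u)) (f-perp? u))) ⟩
        𝟙 (¬? (0ᵥ ≟ u)) * 𝟙 (f-perp? u) * 𝟙 S?         ∎
        where
        S? = (v ∈⟨ u ⟩?) ×-dec ¬? (v ∈F⟨ u ⟩?)
        to : (0ᵥ ≢ u × W u) × W v × (v ∈⟨ u ⟩) × ¬ (v ∈F⟨ u ⟩) → (0ᵥ ≢ u × f-perp u) × (v ∈⟨ u ⟩) × ¬ (v ∈F⟨ u ⟩)
        to ((0≢u , w₁ , w₂) , (w₁′ , w₂′) , (e , refl) , v∉F) =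
          (0≢u , f≡0 e∉F _ w₁ (trans (cong tr (sym (•-homoˡ e u x))) w₁′) , f≡0 e∉F _ w₂ (trans (cong tr (sym (•-homoˡ e u y))) w₂′)) , (e , refl) , v∉F
          where
          e∉F : ¬ ∃ λ c → ι c ≡ e
          e∉F (c , refl) = v∉F (c , refl)
        from : (0ᵥ ≢ u × f-perp u) × (v ∈⟨ u ⟩) × ¬ (v ∈F⟨ u ⟩) → (0ᵥ ≢ u × W u) × W v × (v ∈⟨ u ⟩) × ¬ (v ∈F⟨ u ⟩)
        from ((0≢u , p , p′) , (e , refl) , v∉F) =
          (0≢u , tr≡0 p , tr≡0 p′) , (tr≡0 (e*≡0 p) , tr≡0 (e*≡0 p′)) , (e , refl) , v∉F
          where
          tr≡0 : ∀ {z} → z ≡ 0# → tr z ≡ F.0#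
          tr≡0 p = trans (cong tr p) tr-0
          e*≡0 : ∀ {w} → f u w ≡ 0# → f (e • u) w ≡ 0#
          e*≡0 {w} p = trans (•-homoˡ e u w) (trans (cong (e *ᶠ_) p) (Ep.zeroʳ e))

    -- `C` will be 1 + q² + ... + q^(4n-6), so that `X` = q^(4n-4) and ∣V∣ = q⁴ X. With `C`
    -- abstract, all closed forms are polynomials in k and C, free of exponents in n.
    module Sizes (C : ℕ) (∣V∣≡ : ∣ V ∣ ≡ q * q * (q * q) * (1 + (k + k * q) * C)) where
      private
        X G : ℕ
        X = 1 + (k + k * q) * C
        G = (k + k * q) * (q * k)

        M≡ : M ≡ k + k * q
        M≡ = ℕ.suc-injective 1+M≡q²

        divide : ∀ s t {A B} → ∣ V ∣ ≡ t * s → .{{_ : NonZero s}} → A * s ≡ ∣ V ∣ * B → A ≡ t * B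
        divide s t {A} {B} eq p = ℕ.*-cancelʳ-≡ A (t * B) s (trans p (trans (cong (_* B) eq) (shuffle t s B)))
          where
          shuffle : ∀ a b c → a * b * c ≡ a * c * b
          shuffle = ℕSolver.solve-∀

        -- Each use of duality divides ∣V∣ by the size of its coefficient space: F², F² × F, F² × E
        -- and E², in this order.
        by-q² : ∣ V ∣ ≡ q * q * X * (q * q)
        by-q² = trans ∣V∣≡ (lemma q X)
          where
          lemma : ∀ q X → q * q * (q * q) * X ≡ q * q * X * (q * q)
          lemma = ℕSolver.solve-∀
        by-q³ : ∣ V ∣ ≡ q * X * (q * q * q)
        by-q³ = trans ∣V∣≡ (lemma q X)
          where
          lemma : ∀ q X → q * q * (q * q) * X ≡ q * X * (q * q * q)
          lemma = ℕSolver.solve-∀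
        by-q⁴ : ∣ V ∣ ≡ X * (q * q * q ^ 2)
        by-q⁴ = trans ∣V∣≡ (lemma q X)
          where
          lemma : ∀ q X → q * q * (q * q) * X ≡ X * (q * q * (q * (q * 1)))
          lemma = ℕSolver.solve-∀
        by-q⁴′ : ∣ V ∣ ≡ X * (q ^ 2 * q ^ 2)
        by-q⁴′ = trans ∣V∣≡ (lemma q X)
          where
          lemma : ∀ q X → q * q * (q * q) * X ≡ X * (q * (q * 1) * (q * (q * 1)))
          lemma = ℕSolver.solve-∀

        w : ℕ
        w = (k + k * q) * (1 + q * q * C)

        count-W*≡ : count W*? ≡ w
        count-W*≡ = ℕ.suc-injective (trans (sym count-W*) (trans (divide (q * q) (q * q * X) by-q² (trans count-W (sym (ℕ.*-identityʳ _)))) (lemma k C)))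
          where
          lemma : ∀ k C → suc k * suc k * (1 + (k + k * suc k) * C) * 1 ≡ suc ((k + k * suc k) * (1 + suc k * suc k * C))
          lemma = ℕSolver.solve-∀

        w+M* : ∀ c → count W*? + M * c ≡ w + (k + k * q) * c
        w+M* c = cong₂ (λ u v → u + v * c) count-W*≡ M≡

        T-F-closed : ∀ {c} → (∀ a → 0² ≢ a → count (λ s → W*? (ι s • lin x y a)) ≡ c) → T-F ≡ q * X * (w + (k + k * q) * c)
        T-F-closed {c} p = trans (divide (q * q * q) (q * X) by-q³ (T-F≡ p)) (cong (q * X *_) (w+M* c))

        T-E-closed : ∀ {c} → (∀ a → 0² ≢ a → count (λ e → W? (e • lin x y a)) ≡ 1 + c) → T-E ≡ X * (w + (k + k * q) * c)
        T-E-closed {c} p = trans (divide (q * q * q ^ 2) X by-q⁴ (T-E≡ λ a 0≢a → count-W-E a 0≢a (p a 0≢a))) (cong (X *_) (w+M* c))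

        -- By duality `A-E` at a nonzero vector of ℓ is X d, and c is this number without the zero
        -- vector.
        T-∥-closed : ∀ {d c} → (∀ a → 0² ≢ a → count (λ e → any? λ a′ → lin x y a′ +ᵥ e • lin x y a ≟ 0ᵥ) ≡ d) →
          X * d ≡ 1 + c → T-∥ ≡ w + (k + k * q) * c
        T-∥-closed {c = c} p eq = trans (T-∥≡ λ a 0≢a → trans (divide (q * q * q ^ 2) X by-q⁴ (A-E-lin 0≢a (p a 0≢a))) eq) (w+M* c)

        T-E-isotropic : f x y ≡ 0# → T-E ≡ X * (w + (k + k * q) * (k + k * q))
        T-E-isotropic p = T-E-closed λ a _ → count-W-E-isotropic p a

        T-E-anisotropic : f x y ≢ 0# → T-E ≡ X * (w + (k + k * q) * k)
        T-E-anisotropic p = T-E-closed λ a 0≢a → count-W-E-anisotropic p a 0≢a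

        T-∥-∥ : y ∈⟨ x ⟩ → T-∥ ≡ w + (k + k * q) * (k + k * q + (k + k * q) * C * (q * q))
        T-∥-∥ p = T-∥-closed (λ a _ → count-E∩ℓ-∥ p a) (lemma k C)
          where
          lemma : ∀ k C → (1 + (k + k * suc k) * C) * (suc k * suc k) ≡ 1 + (k + k * suc k + (k + k * suc k) * C * (suc k * suc k))
          lemma = ℕSolver.solve-∀

        T-∥-∦ : ¬ (y ∈⟨ x ⟩) → T-∥ ≡ w + (k + k * q) * (k + (k + k * q) * C * q)
        T-∥-∦ p = T-∥-closed (count-E∩ℓ-∦ p) (lemma k C)
          where
          lemma : ∀ k C → (1 + (k + k * suc k) * C) * suc k ≡ 1 + (k + (k + k * suc k) * C * suc k)
          lemma = ℕSolver.solve-∀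

        subtract : ∀ {T B S R} → T + B ≡ S → ∀ {B′ S′} → B ≡ B′ → S ≡ S′ → S′ ≡ R + B′ → T ≡ R
        subtract {B = B} eq refl refl eq′ = ℕ.+-cancelʳ-≡ B _ _ (trans eq eq′)

      f≢0⇒∦ : f x y ≢ 0# → ¬ (y ∈⟨ x ⟩)
      f≢0⇒∦ p (a , refl) = p (trans (•-homoʳ a x x) (trans (cong (a *ᶠ_) (alternating x)) (Ep.zeroʳ a)))

      T-𝓞₁-in : g x y ≡ F.0# → f x y ≢ 0# → T-𝓞₁ ≡ (q * X * C + X) * G
      T-𝓞₁-in p p′ = subtract T-𝓞₁+T-E (T-E-anisotropic p′) (T-F-closed (count-W-F-isotropic p)) (identity-𝓞₁-in k C)

      -- There are two ways to miss 𝓞₁. If g x y ≠ 0, neither `T-F` nor `T-E` has its extra X * G;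
      -- if f x y = 0, both have it and it cancels in the difference.
      T-𝓞₁-out : ¬ (g x y ≡ F.0# × f x y ≢ 0#) → T-𝓞₁ ≡ q * X * C * G
      T-𝓞₁-out ¬p with f x y ≟ 0#
      ... | yes p = subtract T-𝓞₁+T-E (T-E-isotropic p) (T-F-closed (count-W-F-isotropic (trans (cong tr p) tr-0))) (identity-𝓞₁-out′ k C)
      ... | no p  = subtract T-𝓞₁+T-E (T-E-anisotropic p) (T-F-closed (count-W-F-anisotropic λ p′ → ¬p (p′ , p))) (identity-𝓞₁-out k C)

      T-𝓞₂-in : f x y ≡ 0# → ¬ (y ∈⟨ x ⟩) → T-𝓞₂ ≡ (q * suc q * C * C + X) * G
      T-𝓞₂-in p p′ = subtract T-𝓞₂+T-∥ (T-∥-∦ p′) (T-E-isotropic p) (identity-𝓞₂-in k C)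

      -- Again two ways: for f x y ≠ 0 neither `T-E` nor `T-∥` has the extra X * G, and for y in
      -- ⟨x⟩_E both have it.
      T-𝓞₂-out : ¬ (f x y ≡ 0# × ¬ (y ∈⟨ x ⟩)) → T-𝓞₂ ≡ q * suc q * C * C * G
      T-𝓞₂-out ¬p with f x y ≟ 0#
      ... | no p  = subtract T-𝓞₂+T-∥ (T-∥-∦ (f≢0⇒∦ p)) (T-E-anisotropic p) (identity-𝓞₂-out k C)
      ... | yes p = subtract T-𝓞₂+T-∥ (T-∥-∥ (decidable-stable (y ∈⟨ x ⟩?) λ p′ → ¬p (p , p′))) (T-E-isotropic p) (identity-𝓞₂-out′ k C)

      T-𝓕-in : y ∈⟨ x ⟩ → T-𝓕 ≡ (1 * C + X) * G
      T-𝓕-in p = trans (T-𝓕≡ (trans (divide (q ^ 2 * q ^ 2) X by-q⁴′ (trans count-f-perp (cong (∣ V ∣ *_) (count-combine-∥ p)))) (lemma k C))) (identity-𝓕-in k C)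
        where
        lemma : ∀ k C → (1 + (k + k * suc k) * C) * (suc k * suc k) ≡ 1 + (k + k * suc k + suc k * suc k * ((k + k * suc k) * C))
        lemma = ℕSolver.solve-∀

      T-𝓕-out : ¬ (y ∈⟨ x ⟩) → T-𝓕 ≡ 1 * C * G
      T-𝓕-out p = trans (T-𝓕≡ (trans (divide (q ^ 2 * q ^ 2) X by-q⁴′ (trans count-f-perp (cong (∣ V ∣ *_) (count-combine-∦ p)))) (ℕ.*-identityʳ X))) (identity-𝓕-out k C)

-- Lines

module Main
  (n k : ℕ) (primePower : IsPrimePower (suc k)) (F E : Field)
  (ordF : HasOrder F (suc k)) (ordE : HasOrder E (suc k ^ 2))
  (ι : Field.Carrier F → Field.Carrier E) (ι-hom : IsFieldHomomorphism F E ι)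
  (f : VectorSpace.V E (2 * n) → VectorSpace.V E (2 * n) → Field.Carrier E)
  (f-alt : VectorSpace.IsNondegenerateAlternating E (2 * n) f)
  (λ₀ : Field.Carrier E) (λ₀≢0 : λ₀ ≢ Field.0# E)
  where

  private
    module QE = QuadraticExtension (suc k) primePower F E ordF ordE ι ι-hom
    module EP = FieldProperties E

  1≤k : 1 ≤ k
  1≤k = ℕ.≤-pred QE.2≤q

  tr₀ : Field.Carrier E → Field.Carrier F
  tr₀ x = QE.tr (Field._*ᶠ_ E λ₀ x)

  tr₀-+ : ∀ x y → tr₀ (Field._+ᶠ_ E x y) ≡ Field._+ᶠ_ F (tr₀ x) (tr₀ y)
  tr₀-+ x y = trans (cong QE.tr (EP.distribˡ λ₀ x y)) (QE.tr-+ _ _)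

  private
    λ₀-shuffle : ∀ a x → Field._*ᶠ_ E λ₀ (Field._*ᶠ_ E a x) ≡ Field._*ᶠ_ E a (Field._*ᶠ_ E λ₀ x)
    λ₀-shuffle a x = trans (sym (EP.*-assoc _ _ _)) (trans (cong (λ z → Field._*ᶠ_ E z x) (EP.*-comm λ₀ a)) (EP.*-assoc _ _ _))

  tr₀-ι* : ∀ c x → tr₀ (Field._*ᶠ_ E (ι c) x) ≡ Field._*ᶠ_ F c (tr₀ x)
  tr₀-ι* c x = trans (cong QE.tr (λ₀-shuffle (ι c) x)) (QE.tr-ι* c _)

  tr₀-nondegenerate : ∀ x → (∀ a → tr₀ (Field._*ᶠ_ E a x) ≡ Field.0# F) → x ≡ Field.0# E
  tr₀-nondegenerate x z = EP.xy≡0⇒y≡0 λ₀≢0 (QE.tr-nondegenerate _ λ a → trans (cong QE.tr (sym (λ₀-shuffle a x))) (z a))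

  open Core k 1≤k F E ordF ordE ι ι-hom tr₀ tr₀-+ tr₀-ι* tr₀-nondegenerate (2 * n) f f-alt
  open E using (_+ᶠ_; _*ᶠ_; -ᶠ_; 0#; 1#)
  module Γ = Geometry n q F E ι f λ₀
  open Γ using (b; Point; Line; perp; IsotropicLine; Conjugate; MeetsNontrivially; 𝓕; 𝓞₁; 𝓞₂; NumberOfLines; IsCover; IsDualOfSymplecticType; r)
  open ≡-Reasoning

  b≡0⇒g≡0 : ∀ {u v} → b u v ≡ 0# → g u v ≡ F.0#
  b≡0⇒g≡0 p = ι≡0⇒≡0 (trans (QE.ι-tr _) p)

  g≡0⇒b≡0 : ∀ {u v} → g u v ≡ F.0# → b u v ≡ 0#
  g≡0⇒b≡0 p = trans (sym (QE.ι-tr _)) (trans (cong ι p) ι-0)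

  Span : V → V → Pred V 0ℓ
  Span x y v = ∃ λ a → lin x y a ≡ v

  Span? : ∀ x y v → Dec (Span x y v)
  Span? x y v = any? λ a → lin x y a ≟ v

  lin-combine : ∀ x y c d c₁ d₁ c₂ d₂ → lin (lin x y (c₁ , d₁)) (lin x y (c₂ , d₂)) (c , d)
    ≡ lin x y (c F.*ᶠ c₁ F.+ᶠ d F.*ᶠ c₂ , c F.*ᶠ d₁ F.+ᶠ d F.*ᶠ d₂)
  lin-combine x y c d c₁ d₁ c₂ d₂ = sym (trans (L.+-homo (c F.*ᶠ c₁ , c F.*ᶠ d₁) (d F.*ᶠ c₂ , d F.*ᶠ d₂)) (cong₂ _+ᵥ_ (L.⊙-homo c _) (L.⊙-homo d _)))
    where module L = IsLinear (lin-linear x y)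

  Span-⊆ : ∀ {x y u v} → u ∈ Span x y → v ∈ Span x y → Span u v ⊆ Span x y
  Span-⊆ {x} {y} ((c₁ , d₁) , refl) ((c₂ , d₂) , refl) ((c , d) , refl) = _ , sym (lin-combine x y c d c₁ d₁ c₂ d₂)

  count-Span : ∀ {x y} → Independent x y → count (Span? x y) ≡ q * q
  count-Span {x} {y} indep = count-image (lin x y) (Perp.lin-injective x y indep)

  -- Both spans have q² elements, so one inclusion is enough.
  Span-≐ : ∀ {x y u v} → Independent x y → Independent u v → u ∈ Span x y → v ∈ Span x y → Span u v ≐ Span x y
  Span-≐ {x} {y} {u} {v} ind ind′ u∈ v∈ = Span-⊆ u∈ v∈ ,
    λ {w} → count-⊆-≡ (Span? u v) (Span? x y) (λ _ → Span-⊆ u∈ v∈) (trans (count-Span ind′) (sym (count-Span ind))) w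

  ∉F⇒independent : ∀ {u v} → 0ᵥ ≢ u → ¬ (v ∈F⟨ u ⟩) → Independent u v
  ∉F⇒independent {u} {v} 0≢u v∉ (c , d) p with d ≟ F.0#
  ... | no d≢0 = contradiction (F.-ᶠ (Fp.inv d d≢0 F.*ᶠ c) , (begin
    ι (F.-ᶠ (Fp.inv d d≢0 F.*ᶠ c)) • u             ≡⟨ trans (cong (_• u) (ι-neg _)) (-•ˡ _ u) ⟩
    -ᵥ (ι (Fp.inv d d≢0 F.*ᶠ c) • u)               ≡⟨ u+v≡0⇒v≡-u eq ⟨
    v                                              ∎)) v∉
    where
    eq : ι (Fp.inv d d≢0 F.*ᶠ c) • u +ᵥ v ≡ 0ᵥ
    eq = begin
      ι (Fp.inv d d≢0 F.*ᶠ c) • u +ᵥ v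
        ≡⟨ cong (ι (Fp.inv d d≢0 F.*ᶠ c) • u +ᵥ_) (trans (cong (_• v) (trans (cong ι (proj₁ (proj₂ (F.invertible d d≢0)))) ι-1)) (1• v)) ⟨
      lin u v (Fp.inv d d≢0 F.*ᶠ c , Fp.inv d d≢0 F.*ᶠ d)
        ≡⟨ IsLinear.⊙-homo (lin-linear u v) (Fp.inv d d≢0) (c , d) ⟩
      ι (Fp.inv d d≢0) • lin u v (c , d)
        ≡⟨ trans (cong (ι (Fp.inv d d≢0) •_) p) (•0 _) ⟩
      0ᵥ ∎
  ... | yes refl with c ≟ F.0#
  ...   | yes refl = refl
  ...   | no c≢0 = contradiction (sym (•-cancel (λ p′ → c≢0 (ι≡0⇒≡0 p′))
          (trans (sym (trans (cong (ι c • u +ᵥ_) (trans (cong (_• v) ι-0) (0• v))) (+ᵥ-identityʳ _))) p))) 0≢u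

  independent⇒0≢ : ∀ {u v} → Independent u v → 0ᵥ ≢ u
  independent⇒0≢ {u} {v} ind p = F.1#≢0# (cong proj₁ (ind _ (trans (lin-1,0 u v) (sym p))))

  independent⇒∉F : ∀ {u v} → Independent u v → ¬ (v ∈F⟨ u ⟩)
  independent⇒∉F {u} {v} ind (c , p) = Evaluate.y∈⟨x⟩⇒∉F u v ind p (c , refl)

  ∈Span-left : ∀ x y → x ∈ Span x y
  ∈Span-left x y = _ , lin-1,0 x y

  ∈Span-right : ∀ x y → y ∈ Span x y
  ∈Span-right x y = _ , lin-0,1 x y

  lin-combination : ∀ (ℓ : Line) c d (bs : Vec V 2) →
    VectorSpace.Subspace.combination ℓ (c ∷ d ∷ []) bs ≡ lin (head bs) (head (tail bs)) (c , d)
  lin-combination ℓ c d (x ∷ y ∷ []) = cong (ι c • x +ᵥ_) (+ᵥ-identityʳ _)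

  span : ∀ x y → Independent x y → Line
  span x y ind = record
    { Member      = Span x y
    ; basis       = x ∷ y ∷ []
    ; independent = λ { (c ∷ d ∷ []) p → cong (λ a → proj₁ a ∷ proj₂ a ∷ []) (ind (c , d) (trans (cong (ι c • x +ᵥ_) (sym (+ᵥ-identityʳ _))) p)) }
    ; spans       = λ v → mk⇔
        (λ ((c , d) , p) → c ∷ d ∷ [] , trans (cong (ι c • x +ᵥ_) (+ᵥ-identityʳ _)) p)
        (λ { (c ∷ d ∷ [] , p) → (c , d) , trans (cong (ι c • x +ᵥ_) (sym (+ᵥ-identityʳ _))) p })
    }

  module _ (ℓ : Line) where
    private module ℓ = VectorSpace.Subspace ℓ

    fst snd : V
    fst = head ℓ.basis
    snd = head (tail ℓ.basis)

    basis-independent : Independent fst snd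
    basis-independent (c , d) p = cong (λ cs → head cs , head (tail cs))
      (ℓ.independent (c ∷ d ∷ []) (trans (lin-combination ℓ c d ℓ.basis) p))

    Member-≐ : ℓ.Member ≐ Span fst snd
    Member-≐ = to , from
      where
      to : ℓ.Member ⊆ Span fst snd
      to {v} m with Equivalence.to (ℓ.spans v) m
      ... | c ∷ d ∷ [] , p = (c , d) , trans (sym (lin-combination ℓ c d ℓ.basis)) p
      from : Span fst snd ⊆ ℓ.Member
      from {v} ((c , d) , p) = Equivalence.from (ℓ.spans v) (c ∷ d ∷ [] , trans (lin-combination ℓ c d ℓ.basis) p)

    fst∈ : ℓ.Member fst
    fst∈ = proj₂ Member-≐ (∈Span-left _ _)

    snd∈ : ℓ.Member snd
    snd∈ = proj₂ Member-≐ (∈Span-right _ _)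

  open VectorSpace.Subspace using (Member)

  ≐-sym : {P Q : Pred V 0ℓ} → P ≐ Q → Q ≐ P
  ≐-sym (p , p′) = p′ , p

  ≐-trans : {P Q R : Pred V 0ℓ} → P ≐ Q → Q ≐ R → P ≐ R
  ≐-trans (p , p′) (s , s′) = (λ m → s (p m)) , (λ m → p′ (s′ m))

  module _ {X : Set} {{_ : Finite X}} (pair : X → V × V) {Q : X → Set} (Q? : ∀ x → Dec (Q x))
    (Q⇒independent : ∀ {x} → Q x → Independent (proj₁ (pair x)) (proj₂ (pair x)))
    where

    spanOf : X → Pred V 0ℓ
    spanOf x = Span (proj₁ (pair x)) (proj₂ (pair x))

    infix 4 _∼_
    _∼_ : X → X → Set
    x ∼ y = spanOf x ≐ spanOf y

    _∼?_ : ∀ x y → Dec (x ∼ y)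
    x ∼? y = ⊆? x y ×-dec ⊆? y x
      where
      ⊆? : ∀ x y → Dec (spanOf x ⊆ spanOf y)
      ⊆? x y = map′ (λ p {v} → p v) (λ p v → p) (all? λ v → Span? _ _ v →-dec Span? _ _ v)

    -- Lines are counted through parameters: `X` is V × V for the lines in a subspace, and V, with a
    -- fixed first vector, for the lines through a point. Parameters with the same span form one
    -- class, and g is the common class size.
    numberOfLines : ∀ {a} {P : Pred Line a} {m g} →
      (∀ {x} (qx : Q x) → P (span _ _ (Q⇒independent qx))) →
      (∀ ℓ → P ℓ → ∃ λ x → Q x × Member ℓ ≐ spanOf x) →
      g ≢ 0 → (∀ x → Q x → count (λ y → Q? y ×-dec (y ∼? x)) ≡ g) → count Q? ≡ m * g →
      NumberOfLines P m
    numberOfLines {P = P} {m} Q⇒P P⇒Q g≢0 classSize total = record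
      { to        = label
      ; from      = from
      ; to-cong   = λ {ℓ} {s} ℓ≐s → distinct _ _ (≐-trans (≐-sym (label-spec ℓ)) (≐-trans ℓ≐s (label-spec s)))
      ; from-cong = λ { refl → id , id }
      ; inverse   = (λ {i} {ℓ} ℓ≐i → distinct _ _ (≐-trans (≐-sym (label-spec ℓ)) ℓ≐i))
                  , (λ { {ℓ} refl → ≐-sym (label-spec ℓ) })
      }
      where
      open Transversal (equal-classes⇒transversal Q? _∼?_ (λ x → id , id) ≐-sym ≐-trans {k = m} g≢0 classSize total)
      from : Fin m → Σ Line P
      from i = span _ _ (Q⇒independent (rep∈P i)) , Q⇒P (rep∈P i)
      label : Σ Line P → Fin m
      label (ℓ , p) = let (x , qx , _) = P⇒Q ℓ p in proj₁ (class x qx)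
      label-spec : ∀ ℓ → Member (proj₁ ℓ) ≐ spanOf (rep (label ℓ))
      label-spec (ℓ , p) = let (x , qx , ℓ≐x) = P⇒Q ℓ p in ≐-trans ℓ≐x (proj₂ (class x qx))

  -- Ordered bases and families of lines

  G : ℕ
  G = (k + k * q) * (q * k)

  q*k≢0 : q * k ≢ 0
  q*k≢0 p with ℕ.m*n≡0⇒m≡0∨n≡0 q p
  ... | inj₂ k≡0 = ℕ.m<n⇒n≢0 1≤k k≡0

  G≢0 : G ≢ 0
  G≢0 p with ℕ.m*n≡0⇒m≡0∨n≡0 (k + k * q) p
  ... | inj₁ eq = ℕ.m<n⇒n≢0 1≤k (ℕ.m+n≡0⇒m≡0 k eq)
  ... | inj₂ eq = q*k≢0 eq

  module _ {x y : V} (ind : Independent x y) where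

    count-Span∖F⟨⟩ : ∀ {u} → 0ᵥ ≢ u → u ∈ Span x y → count (λ v → Span? x y v ×-dec ¬? (v ∈F⟨ u ⟩?)) ≡ q * k
    count-Span∖F⟨⟩ {u} 0≢u u∈ = ℕ.+-cancelʳ-≡ q _ _ (begin
      count (λ v → Span? x y v ×-dec ¬? (v ∈F⟨ u ⟩?)) + q
        ≡⟨ cong₂ _+_ refl (count-image (λ c → ι c • u) λ c d p → ι-injective c d (•-injectiveˡ (0≢u ∘ sym) _ _ p)) ⟨
      count (λ v → Span? x y v ×-dec ¬? (v ∈F⟨ u ⟩?)) + count (λ v → v ∈F⟨ u ⟩?)
        ≡⟨ count-∖ (λ v → v ∈F⟨ u ⟩?) (Span? x y) F⟨⟩⊆ ⟩
      count (Span? x y)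
        ≡⟨ count-Span ind ⟩
      q * q
        ≡⟨ trans (ℕ.*-suc q k) (ℕ.+-comm q (q * k)) ⟩
      q * k + q ∎)
      where
      F⟨⟩⊆ : ∀ v → v ∈F⟨ u ⟩ → v ∈ Span x y
      F⟨⟩⊆ v (c , p) = let (a , eq) = u∈ in _ , trans (IsLinear.⊙-homo (lin-linear x y) c a) (trans (cong (ι c •_) eq) p)

    count-Span∖0 : count (λ u → ¬? (0ᵥ ≟ u) ×-dec Span? x y u) ≡ k + k * q
    count-Span∖0 = ℕ.suc-injective (begin
      1 + count (λ u → ¬? (0ᵥ ≟ u) ×-dec Span? x y u)
        ≡⟨ cong₂ _+_ (𝟙-yes (Span? x y 0ᵥ) (_ , lin-0 x y)) (∑-cong λ u → sym (𝟙-× (¬? (0ᵥ ≟ u)) (Span? x y u))) ⟨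
      𝟙 (Span? x y 0ᵥ) + (∑[ u ] (𝟙 (¬? (0ᵥ ≟ u)) * 𝟙 (Span? x y u)))
        ≡⟨ ∑-remove 0ᵥ (λ u → 𝟙 (Span? x y u)) ⟨
      count (Span? x y)
        ≡⟨ count-Span ind ⟩
      q * q ∎)

    count-bases : count {X = V × V} (λ (u , v) → (¬? (0ᵥ ≟ u) ×-dec Span? x y u) ×-dec (Span? x y v ×-dec ¬? (v ∈F⟨ u ⟩?))) ≡ G
    count-bases = begin
      count {X = V × V} (λ (u , v) → (¬? (0ᵥ ≟ u) ×-dec Span? x y u) ×-dec (Span? x y v ×-dec ¬? (v ∈F⟨ u ⟩?)))
        ≡⟨ ∑-× (λ u v → 𝟙 ((¬? (0ᵥ ≟ u) ×-dec Span? x y u) ×-dec (Span? x y v ×-dec ¬? (v ∈F⟨ u ⟩?)))) ⟩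
      ∑[ u ] ∑[ v ] 𝟙 ((¬? (0ᵥ ≟ u) ×-dec Span? x y u) ×-dec (Span? x y v ×-dec ¬? (v ∈F⟨ u ⟩?)))
        ≡⟨ ∑-cong (λ u → trans (∑-cong λ v → 𝟙-× (¬? (0ᵥ ≟ u) ×-dec Span? x y u) (Span? x y v ×-dec ¬? (v ∈F⟨ u ⟩?))) (trans (∑-*ˡ (𝟙 (¬? (0ᵥ ≟ u) ×-dec Span? x y u)) _)
             (𝟙-*-cong (¬? (0ᵥ ≟ u) ×-dec Span? x y u) λ (0≢u , u∈) → count-Span∖F⟨⟩ 0≢u u∈))) ⟩
      ∑[ u ] (𝟙 (¬? (0ᵥ ≟ u) ×-dec Span? x y u) * (q * k))
        ≡⟨ ∑-*ʳ (q * k) _ ⟩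
      count (λ u → ¬? (0ᵥ ≟ u) ×-dec Span? x y u) * (q * k)
        ≡⟨ cong (_* (q * k)) count-Span∖0 ⟩
      G ∎

  -- A set of lines recognised by a decidable relation on ordered bases. `∈⇒R` speaks only of the
  -- basis stored with a line.
  record Family {a} (𝓛 : Pred Line a) : Set (lsuc 0ℓ ⊔ a) where
    field
      R      : V → V → Set
      R?     : ∀ u v → Dec (R u v)
      R⇒∉F   : ∀ {u v} → 0ᵥ ≢ u → R u v → ¬ (v ∈F⟨ u ⟩)
      𝓛-resp   : ∀ {ℓ s} → Member ℓ ≐ Member s → 𝓛 ℓ → 𝓛 s
      R⇒∈    : ∀ {u v} (ind : Independent u v) → R u v → 𝓛 (span u v ind)
      ∈⇒R    : ∀ ℓ → 𝓛 ℓ → R (fst ℓ) (snd ℓ)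

    -- `span u v ind` has the same members as ℓ and stores (u , v) as its basis, so `𝓛-resp` and
    -- then `∈⇒R` apply. Hence R holds for every ordered basis of a line or for none.
    basis-R : ∀ {ℓ u v} → 𝓛 ℓ → Independent u v → u ∈ Member ℓ → v ∈ Member ℓ → R u v
    basis-R {ℓ} {u} {v} p ind u∈ v∈ = ∈⇒R (span u v ind)
      (𝓛-resp {ℓ} {span u v ind} (≐-trans (Member-≐ ℓ) (≐-sym (Span-≐ (basis-independent ℓ) ind (proj₁ (Member-≐ ℓ) u∈) (proj₁ (Member-≐ ℓ) v∈)))) p)

    R⇒∈-line : ∀ ℓ → R (fst ℓ) (snd ℓ) → 𝓛 ℓ
    R⇒∈-line ℓ p = 𝓛-resp {span _ _ (basis-independent ℓ)} {ℓ} (≐-sym (Member-≐ ℓ)) (R⇒∈ (basis-independent ℓ) p)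

  module _ {a} {𝓛 : Pred Line a} (fam : Family 𝓛) where
    open Family fam

    -- The total counts the pairs of `W` that satisfy R. By `basis-R`, the pairs with a given span
    -- are all the `G` ordered bases of that line.
    numberOfLinesIn : ∀ {ℓ m} (let open Perp (fst ℓ) (snd ℓ) (basis-independent ℓ)) →
      ∑[ u ] (𝟙 (W*? u) * count (λ v → W? v ×-dec R? u v)) ≡ m * G →
      NumberOfLines (λ s → s ∈ 𝓛 × Member s ⊆ perp (Member ℓ)) m
    numberOfLinesIn {ℓ} {m} total = numberOfLines id Q? Q⇒independent {P = λ s → s ∈ 𝓛 × Member s ⊆ perp (Member ℓ)}
        (λ { {u , v} qx@((_ , wu) , wv , r) → R⇒∈ (Q⇒independent {u , v} qx) r , λ w∈ → Span⊆perp wu wv w∈ })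
        (λ s (s∈ , s⊆) → (fst s , snd s) , ((independent⇒0≢ (basis-independent s) , perp⇒W (s⊆ (fst∈ s))) , perp⇒W (s⊆ (snd∈ s)) , ∈⇒R s s∈) , Member-≐ s)
        G≢0 classSize
        (trans (∑-× (λ u v → 𝟙 (Q? (u , v)))) (trans (∑-cong λ u → trans (∑-cong λ v → 𝟙-× (W*? u) (W? v ×-dec R? u v)) (∑-*ˡ (𝟙 (W*? u)) _)) total))
      where
      open Perp (fst ℓ) (snd ℓ) (basis-independent ℓ)
      Q : V × V → Set
      Q (u , v) = (0ᵥ ≢ u × W u) × W v × R u v
      Q? : ∀ z → Dec (Q z)
      Q? (u , v) = W*? u ×-dec (W? v ×-dec R? u v)
      Q⇒independent : ∀ {z} → Q z → Independent (proj₁ z) (proj₂ z)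
      Q⇒independent ((0≢u , _) , _ , r) = ∉F⇒independent 0≢u (R⇒∉F 0≢u r)
      perp⇒W : ∀ {v} → perp (Member ℓ) v → W v
      perp⇒W p = b≡0⇒g≡0 (p _ (fst∈ ℓ)) , b≡0⇒g≡0 (p _ (snd∈ ℓ))
      W-Span : ∀ {u v} → W u → W v → Span u v ⊆ W
      W-Span {u} {v} wu wv ((c , d) , refl) = lin⇒W λ b → g-sym0 (trans (g-+ʳ _ _ _) (trans (cong₂ F._+ᶠ_
        (trans (g-ι•ʳ c _ u) (trans (cong (c F.*ᶠ_) (g-sym0 (W⇒lin wu b))) (Fp.zeroʳ c)))
        (trans (g-ι•ʳ d _ v) (trans (cong (d F.*ᶠ_) (g-sym0 (W⇒lin wv b))) (Fp.zeroʳ d)))) (Fp.+-identityˡ _)))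
      Span⊆perp : ∀ {u v} → W u → W v → Span u v ⊆ perp (Member ℓ)
      Span⊆perp wu wv v∈ w w∈ = let (a , eq) = proj₁ (Member-≐ ℓ) w∈ in
        g≡0⇒b≡0 (trans (cong (g _) (sym eq)) (W⇒lin (W-Span wu wv v∈) a))
      classSize : ∀ z → Q z → count (λ z′ → Q? z′ ×-dec (_∼?_ id Q? Q⇒independent z′ z)) ≡ G
      classSize (u , v) qz@((_ , wu) , wv , r) = trans
        (count-cong _ (λ (u′ , v′) → (¬? (0ᵥ ≟ u′) ×-dec Span? u v u′) ×-dec (Span? u v v′ ×-dec ¬? (v′ ∈F⟨ u′ ⟩?))) to from)
        (count-bases ind)
        where
        ind = Q⇒independent {u , v} qz
        to : ∀ z′ → Q z′ × (Span _ _ ≐ Span u v) → _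
        to (u′ , v′) (((0≢u′ , _) , _ , r′) , (⊆ , _)) = (0≢u′ , ⊆ (∈Span-left u′ v′)) , ⊆ (∈Span-right u′ v′) , R⇒∉F 0≢u′ r′
        from : ∀ z′ → _ → Q z′ × (Span _ _ ≐ Span u v)
        from (u′ , v′) ((0≢u′ , u′∈) , v′∈ , v′∉) =
          ((0≢u′ , W-Span wu wv u′∈) , W-Span wu wv v′∈ , basis-R {span u v ind} (R⇒∈ ind r) ind′ u′∈ v′∈) , Span-≐ ind ind′ u′∈ v′∈
          where ind′ = ∉F⇒independent 0≢u′ v′∉

    -- With p as first basis vector, a line through p is met once for each of its q² - q vectors
    -- outside F p. Such a vector can be taken from the stored basis, since `fst ℓ` and `snd ℓ` are
    -- not both multiples of p.
    numberOfLinesThrough : ∀ {P : Point} {p} → 0ᵥ ≢ p → p ∈ Member P → (∀ {ℓ : Line} → p ∈ Member ℓ → Member P ⊆ Member ℓ) →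
      ∀ {m} → count (R? p) ≡ m * (q * k) → NumberOfLines (λ ℓ → ℓ ∈ 𝓛 × Member P ⊆ Member ℓ) m
    numberOfLinesThrough {P} {p} 0≢p p∈P P⊆ total = numberOfLines (p ,_) (R? p) R⇒independent {P = λ ℓ → ℓ ∈ 𝓛 × Member P ⊆ Member ℓ}
        (λ r → R⇒∈ (R⇒independent r) r , λ v∈ → P⊆ {span _ _ (R⇒independent r)} (∈Span-left p _) v∈)
        complete q*k≢0 classSize total
      where
      R⇒independent : ∀ {v} → R p v → Independent p v
      R⇒independent r = ∉F⇒independent 0≢p (R⇒∉F 0≢p r)
      complete : ∀ ℓ → ℓ ∈ 𝓛 × Member P ⊆ Member ℓ → ∃ λ v → R p v × Member ℓ ≐ Span p v
      complete ℓ (ℓ∈ , P⊆ℓ) = v , basis-R {ℓ} ℓ∈ ind p∈ℓ v∈ℓ ,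
          ≐-trans (Member-≐ ℓ) (≐-sym (Span-≐ (basis-independent ℓ) ind (proj₁ (Member-≐ ℓ) p∈ℓ) (proj₁ (Member-≐ ℓ) v∈ℓ)))
        where
        p∈ℓ = P⊆ℓ p∈P
        choice : ∃ λ v → v ∈ Member ℓ × ¬ (v ∈F⟨ p ⟩)
        choice with snd ℓ ∈F⟨ p ⟩?
        ... | no ¬s = snd ℓ , snd∈ ℓ , ¬s
        ... | yes (c , cp≡y) = fst ℓ , fst∈ ℓ , λ (d , dp≡x) → independent⇒∉F (basis-independent ℓ) (proportional c d cp≡y dp≡x)
          where
          proportional : ∀ c d → ι c • p ≡ snd ℓ → ι d • p ≡ fst ℓ → snd ℓ ∈F⟨ fst ℓ ⟩
          proportional c d cp≡y dp≡x with d ≟ F.0#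
          ... | yes refl = contradiction (sym (trans (sym dp≡x) (trans (cong (_• p) ι-0) (0• p)))) (independent⇒0≢ (basis-independent ℓ))
          ... | no d≢0 = c F.*ᶠ Fp.inv d d≢0 , (begin
            ι (c F.*ᶠ Fp.inv d d≢0) • fst ℓ              ≡⟨ cong (ι (c F.*ᶠ Fp.inv d d≢0) •_) dp≡x ⟨
            ι (c F.*ᶠ Fp.inv d d≢0) • ι d • p            ≡⟨ •-assoc _ _ p ⟨
            (ι (c F.*ᶠ Fp.inv d d≢0) *ᶠ ι d) • p         ≡⟨ cong (_• p) (trans (sym (ι-* _ _)) (cong ι (trans (Fp.*-assoc _ _ _) (trans (cong (c F.*ᶠ_) (proj₁ (proj₂ (F.invertible d d≢0)))) (Fp.*-identityʳ c))))) ⟩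
            ι c • p                                      ≡⟨ cp≡y ⟩
            snd ℓ                                        ∎)
        v = proj₁ choice
        v∈ℓ = proj₁ (proj₂ choice)
        ind = ∉F⇒independent 0≢p (proj₂ (proj₂ choice))
      classSize : ∀ v → R p v → count (λ v′ → R? p v′ ×-dec (_∼?_ (p ,_) (R? p) R⇒independent v′ v)) ≡ q * k
      classSize v r = trans (count-cong _ (λ v′ → Span? p v v′ ×-dec ¬? (v′ ∈F⟨ p ⟩?)) to from) (count-Span∖F⟨⟩ ind 0≢p (∈Span-left p v))
        where
        ind = R⇒independent r
        to : ∀ v′ → R p v′ × (Span p v′ ≐ Span p v) → v′ ∈ Span p v × ¬ (v′ ∈F⟨ p ⟩)
        to v′ (r′ , ⊆ , _) = ⊆ (∈Span-right p v′) , R⇒∉F 0≢p r′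
        from : ∀ v′ → v′ ∈ Span p v × ¬ (v′ ∈F⟨ p ⟩) → R p v′ × (Span p v′ ≐ Span p v)
        from v′ (v′∈ , v′∉) = basis-R {span p v ind} (R⇒∈ ind r) ind′ (∈Span-left p v) v′∈ , Span-≐ ind ind′ (∈Span-left p v) v′∈
          where ind′ = ∉F⇒independent 0≢p v′∉

  -- Recognising 𝓕, 𝓞₁ and 𝓞₂ from a basis

  g≡0⇒isotropic : ∀ ℓ → g (snd ℓ) (fst ℓ) ≡ F.0# → IsotropicLine ℓ
  g≡0⇒isotropic ℓ p {v} v∈ w w∈ with proj₁ (Member-≐ ℓ) v∈ | proj₁ (Member-≐ ℓ) w∈
  ... | (c , d) , refl | (c′ , d′) , refl = g≡0⇒b≡0 (begin
    tr₀ (f (lin (fst ℓ) (snd ℓ) (c , d)) (lin (fst ℓ) (snd ℓ) (c′ , d′)))   ≡⟨ cong tr₀ (f-lin (fst ℓ) (snd ℓ) c d c′ d′) ⟩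
    tr₀ (ι _ *ᶠ f (fst ℓ) (snd ℓ))                                          ≡⟨ tr₀-ι* _ _ ⟩
    _ F.*ᶠ g (fst ℓ) (snd ℓ)                                                ≡⟨ trans (cong₂ F._*ᶠ_ refl (g-sym0 p)) (Fp.zeroʳ _) ⟩
    F.0#                                                                    ∎)

  isotropic⇒g≡0 : ∀ ℓ → IsotropicLine ℓ → g (snd ℓ) (fst ℓ) ≡ F.0#
  isotropic⇒g≡0 ℓ p = b≡0⇒g≡0 (p (snd∈ ℓ) _ (fst∈ ℓ))

  IsotropicLine-resp : ∀ {ℓ s} → Member ℓ ≐ Member s → IsotropicLine ℓ → IsotropicLine s
  IsotropicLine-resp (ℓ⊆s , s⊆ℓ) p v∈ w w∈ = p (s⊆ℓ v∈) w (s⊆ℓ w∈)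

  𝓕-resp : ∀ {ℓ s} → Member ℓ ≐ Member s → 𝓕 ℓ → 𝓕 s
  𝓕-resp ℓ≐s (S , ℓ≐S) = S , ≐-trans (≐-sym ℓ≐s) ℓ≐S

  𝓕⇒multiple : ∀ {s} → 𝓕 s → ∀ {v w} → v ≢ 0ᵥ → v ∈ Member s → w ∈ Member s → w ∈⟨ v ⟩
  𝓕⇒multiple (S , s⊆S , _) {v} {w} v≢0 v∈ w∈ with VectorSpace.Subspace.basis S | Equivalence.to (VectorSpace.Subspace.spans S v) (s⊆S v∈) | Equivalence.to (VectorSpace.Subspace.spans S w) (s⊆S w∈)
  ... | σ ∷ [] | α ∷ [] , p | β ∷ [] , p′ = β *ᶠ Ep.inv α α≢0 , (begin
    (β *ᶠ Ep.inv α α≢0) • v                ≡⟨ •-assoc _ _ v ⟩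
    β • Ep.inv α α≢0 • v                   ≡⟨ cong (λ u → β • Ep.inv α α≢0 • u) (trans (sym p) (+ᵥ-identityʳ _)) ⟩
    β • Ep.inv α α≢0 • α • σ               ≡⟨ cong (β •_) (inv-• α α≢0 σ) ⟩
    β • σ                                  ≡⟨ trans (sym (+ᵥ-identityʳ _)) p′ ⟩
    w                                      ∎)
    where
    α≢0 : α ≢ 0#
    α≢0 refl = v≢0 (trans (sym p) (trans (+ᵥ-identityʳ _) (0• σ)))

  multiple⇒𝓕 : ∀ {s} → 𝓕 s → ∀ {v} → v ∈ Member s → ∀ e → e • v ∈ Member s
  multiple⇒𝓕 (S , s⊆S , S⊆s) {v} v∈ e with VectorSpace.Subspace.basis S | Equivalence.to (VectorSpace.Subspace.spans S v) (s⊆S v∈) | VectorSpace.Subspace.spans S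
  ... | σ ∷ [] | α ∷ [] , p | spans = S⊆s (Equivalence.from (spans (e • v)) (e *ᶠ α ∷ [] , (begin
    (e *ᶠ α) • σ +ᵥ 0ᵥ        ≡⟨ trans (+ᵥ-identityʳ _) (•-assoc e α σ) ⟩
    e • α • σ                 ≡⟨ cong (e •_) (trans (sym (+ᵥ-identityʳ _)) p) ⟩
    e • v                     ∎)))

  E-span : ∀ x → x ≢ 0ᵥ → VectorSpace.Subspace E (2 * n) E id 1
  E-span x x≢0 = record
    { Member      = _∈⟨ x ⟩
    ; basis       = x ∷ []
    ; independent = λ { (a ∷ []) p → cong (_∷ []) (•-injectiveˡ x≢0 a 0# (trans (sym (+ᵥ-identityʳ _)) (trans p (sym (0• x))))) }
    ; spans       = λ v → mk⇔ (λ (a , p) → a ∷ [] , trans (+ᵥ-identityʳ _) p) (λ { (a ∷ [] , p) → a , trans (sym (+ᵥ-identityʳ _)) p })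
    }

  span∈𝓕 : ∀ {x y} (ind : Independent x y) → y ∈⟨ x ⟩ → 𝓕 (span x y ind)
  span∈𝓕 {x} {y} ind (e , p) = E-span x x≢0 , (λ { ((c , d) , refl) → ι c +ᶠ ι d *ᶠ e , sym (lin≡ c d) }) ,
      λ { (a , refl) → let ((c , d) , eq) = decompose e (Evaluate.y∈⟨x⟩⇒∉F x y ind p) a in (c , d) , trans (lin≡ c d) (cong (_• x) eq) }
    where
    x≢0 = independent⇒0≢ ind ∘ sym
    lin≡ : ∀ c d → lin x y (c , d) ≡ (ι c +ᶠ ι d *ᶠ e) • x
    lin≡ c d = trans (cong (ι c • x +ᵥ_) (trans (cong (ι d •_) (sym p)) (sym (•-assoc _ _ x)))) (sym (•-distribʳ _ _ x))

  -- For ω outside F, the vectors x and ω x form an F-basis of E x.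
  spreadLine : ∀ x → x ≢ 0ᵥ → ∃ λ s → 𝓕 s × x ∈ Member s
  spreadLine x x≢0 = s , s∈𝓕 , ∈Span-left x (ω • x)
    where
    ω = proj₁ QE.outside
    ind : Independent x (ω • x)
    ind = ∉F⇒independent (x≢0 ∘ sym) λ (c , p) → proj₂ QE.outside (c , •-injectiveˡ x≢0 _ _ p)
    s = span x (ω • x) ind
    s∈𝓕 = span∈𝓕 ind (ω , refl)

  f-multiple : ∀ u e → f (e • u) u ≡ 0#
  f-multiple u e = trans (•-homoˡ e u u) (trans (cong (e *ᶠ_) (alternating u)) (Ep.zeroʳ e))

  -- The spread line is E v for the common vector v, so f u (e v) = e f u v vanishes together with f
  -- on ℓ.
  f≡0⇒conjugate : ∀ ℓ s → 𝓕 s → MeetsNontrivially ℓ s → f (snd ℓ) (fst ℓ) ≡ 0# → Conjugate ℓ s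
  f≡0⇒conjugate ℓ s s∈𝓕 (v , v≢0 , v∈ℓ , v∈s) p {u} u∈ℓ w w∈s
    with proj₁ (Member-≐ ℓ) v∈ℓ | proj₁ (Member-≐ ℓ) u∈ℓ | 𝓕⇒multiple {s} s∈𝓕 v≢0 v∈s w∈s
  ... | a , refl | a′ , refl | e , refl = g≡0⇒b≡0 (trans (cong tr₀ (trans (•-homoʳ e _ _)
          (trans (cong (e *ᶠ_) (Evaluate.f-lin0 (fst ℓ) (snd ℓ) (basis-independent ℓ) (f-sym0 p) a′ a)) (Ep.zeroʳ e)))) tr-0)

  -- s contains every e v, so nondegeneracy of the trace turns orthogonality for `b` into f u v = 0
  -- for all u on ℓ. If f y x ≠ 0, testing v = c x + d y with u = y and u = x gives c = d = 0.
  conjugate⇒f≡0 : ∀ ℓ s → 𝓕 s → MeetsNontrivially ℓ s → Conjugate ℓ s → f (snd ℓ) (fst ℓ) ≡ 0#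
  conjugate⇒f≡0 ℓ s s∈𝓕 (v , v≢0 , v∈ℓ , v∈s) conj with proj₁ (Member-≐ ℓ) v∈ℓ
  ... | (c , d) , refl with f y x ≟ 0#
    where
    x = fst ℓ
    y = snd ℓ
  ...   | yes p = p
  ...   | no p  = contradiction (trans (cong₂ (λ c d → lin (fst ℓ) (snd ℓ) (c , d)) c≡0 d≡0) (lin-0 _ _)) v≢0
    where
    x = fst ℓ
    y = snd ℓ
    f-v : ∀ {u} → u ∈ Member ℓ → f u (lin x y (c , d)) ≡ 0#
    f-v {u} u∈ = tr₀-nondegenerate _ λ e → trans (cong tr₀ (sym (•-homoʳ e u _))) (b≡0⇒g≡0 (conj u∈ _ (multiple⇒𝓕 {s} s∈𝓕 v∈s e)))
    f-lin-right : ∀ u → f u (lin x y (c , d)) ≡ ι c *ᶠ f u x +ᶠ ι d *ᶠ f u y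
    f-lin-right u = trans (+-homoʳ u _ _) (cong₂ _+ᶠ_ (•-homoʳ _ _ _) (•-homoʳ _ _ _))
    c≡0 : c ≡ F.0#
    c≡0 = ι≡0⇒≡0 (Ep.xy≡0⇒y≡0 p (trans (Ep.*-comm _ _) (trans (sym (trans (f-lin-right y)
      (trans (cong (ι c *ᶠ f y x +ᶠ_) (trans (cong (ι d *ᶠ_) (alternating y)) (Ep.zeroʳ _))) (Ep.+-identityʳ _)))) (f-v (snd∈ ℓ)))))
    d≡0 : d ≡ F.0#
    d≡0 = ι≡0⇒≡0 (Ep.xy≡0⇒y≡0 (p ∘ f-sym0) (trans (Ep.*-comm _ _) (trans (sym (trans (f-lin-right x)
      (trans (cong (_+ᶠ ι d *ᶠ f x y) (trans (cong (ι c *ᶠ_) (alternating x)) (Ep.zeroʳ _))) (Ep.+-identityˡ _)))) (f-v (fst∈ ℓ)))))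

  ∈𝓕⇒multiple : ∀ ℓ → 𝓕 ℓ → snd ℓ ∈⟨ fst ℓ ⟩
  ∈𝓕⇒multiple ℓ ℓ∈𝓕 = 𝓕⇒multiple {ℓ} ℓ∈𝓕 (independent⇒0≢ (basis-independent ℓ) ∘ sym) (fst∈ ℓ) (snd∈ ℓ)

  ∈𝓕⇒f≡0 : ∀ ℓ → 𝓕 ℓ → f (snd ℓ) (fst ℓ) ≡ 0#
  ∈𝓕⇒f≡0 ℓ ℓ∈𝓕 = let (e , p) = ∈𝓕⇒multiple ℓ ℓ∈𝓕 in trans (cong (λ y → f y (fst ℓ)) (sym p)) (f-multiple _ e)

  family-𝓕 : Family 𝓕
  family-𝓕 = record
    { R      = λ u v → (v ∈⟨ u ⟩) × ¬ (v ∈F⟨ u ⟩)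
    ; R?     = λ u v → (v ∈⟨ u ⟩?) ×-dec ¬? (v ∈F⟨ u ⟩?)
    ; R⇒∉F   = λ _ → proj₂
    ; 𝓛-resp = λ {ℓ} {s} → 𝓕-resp {ℓ} {s}
    ; R⇒∈    = λ ind (p , _) → span∈𝓕 ind p
    ; ∈⇒R    = λ ℓ p → ∈𝓕⇒multiple ℓ p , independent⇒∉F (basis-independent ℓ)
    }

  -- ℓ is conjugate to a spread line that it meets exactly if f vanishes on ℓ, hence to all such
  -- spread lines or to none. The spread line through `fst ℓ` is the test case which keeps the
  -- condition from being vacuous; the same holds for 𝓞₂.
  family-𝓞₁ : Family 𝓞₁
  family-𝓞₁ = record
    { R      = λ u v → g v u ≡ F.0# × f v u ≢ 0#
    ; R?     = λ u v → (g v u ≟ F.0#) ×-dec ¬? (f v u ≟ 0#)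
    ; R⇒∉F   = λ { _ (_ , p) (c , refl) → p (f-multiple _ (ι c)) }
    ; 𝓛-resp = λ {ℓ} {s} ℓ≐s (iso , ∉𝓕 , ¬conj) → IsotropicLine-resp {ℓ} {s} ℓ≐s iso , (λ s∈ → ∉𝓕 (𝓕-resp {s} {ℓ} (≐-sym ℓ≐s) s∈)) ,
        λ t t∈ (v , v≢0 , v∈s , v∈t) conj → ¬conj t t∈ (v , v≢0 , proj₂ ℓ≐s v∈s , v∈t) (λ u∈ → conj (proj₁ ℓ≐s u∈))
    ; R⇒∈    = λ ind (p , p′) → let ℓ = span _ _ ind in
        g≡0⇒isotropic ℓ p , (λ ℓ∈ → p′ (∈𝓕⇒f≡0 ℓ ℓ∈)) , λ s s∈ meets conj → p′ (conjugate⇒f≡0 ℓ s s∈ meets conj)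
    ; ∈⇒R    = λ ℓ (iso , _ , ¬conj) → isotropic⇒g≡0 ℓ iso , λ p →
        let x≢0 = independent⇒0≢ (basis-independent ℓ) ∘ sym
            (s , s∈ , x∈s) = spreadLine (fst ℓ) x≢0
            meets = fst ℓ , x≢0 , fst∈ ℓ , x∈s
        in ¬conj s s∈ meets (f≡0⇒conjugate ℓ s s∈ meets p)
    }

  family-𝓞₂ : Family 𝓞₂
  family-𝓞₂ = record
    { R      = λ u v → f v u ≡ 0# × ¬ (v ∈⟨ u ⟩)
    ; R?     = λ u v → (f v u ≟ 0#) ×-dec ¬? (v ∈⟨ u ⟩?)
    ; R⇒∉F   = λ _ (_ , p) (c , eq) → p (ι c , eq)
    ; 𝓛-resp = λ {ℓ} {s} ℓ≐s (iso , ∉𝓕 , conj) → IsotropicLine-resp {ℓ} {s} ℓ≐s iso , (λ s∈ → ∉𝓕 (𝓕-resp {s} {ℓ} (≐-sym ℓ≐s) s∈)) ,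
        λ t t∈ (v , v≢0 , v∈s , v∈t) u∈ → conj t t∈ (v , v≢0 , proj₂ ℓ≐s v∈s , v∈t) (proj₂ ℓ≐s u∈)
    ; R⇒∈    = λ ind (p , p′) → let ℓ = span _ _ ind in
        g≡0⇒isotropic ℓ (trans (cong tr₀ p) tr-0) , (λ ℓ∈ → p′ (∈𝓕⇒multiple ℓ ℓ∈)) , λ s s∈ meets → f≡0⇒conjugate ℓ s s∈ meets p
    ; ∈⇒R    = λ ℓ (iso , ∉𝓕 , conj) →
        let x≢0 = independent⇒0≢ (basis-independent ℓ) ∘ sym
            (s , s∈ , x∈s) = spreadLine (fst ℓ) x≢0
        in conjugate⇒f≡0 ℓ s s∈ (fst ℓ , x≢0 , fst∈ ℓ , x∈s) (conj s s∈ (fst ℓ , x≢0 , fst∈ ℓ , x∈s)) ,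
           λ p → ∉𝓕 (𝓕-resp {span _ _ (basis-independent ℓ)} {ℓ} (≐-sym (Member-≐ ℓ)) (span∈𝓕 (basis-independent ℓ) p))
    }

  -- The covers and their duals

  module _ (C : ℕ) (0<C : 0 < C) (∣V∣≡ : ∣ V ∣ ≡ q * q * (q * q) * (1 + (k + k * q) * C))
    (θ≡ : θ q (r ∸ 4) ≡ C * suc q) (q^≡ : q ^ (r ∸ 3) ≡ 1 + (k + k * q) * C)
    where

    X : ℕ
    X = 1 + (k + k * q) * C

    isCover : ∀ {a} {𝓛 : Pred Line a} (fam : Family 𝓛) {m} → 0 < m → (∀ ℓ → ℓ ∈ 𝓛 → IsotropicLine ℓ) →
      (∀ p → 0ᵥ ≢ p → count (Family.R? fam p) ≡ m * (q * k)) → IsCover m 𝓛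
    isCover {𝓛 = 𝓛} fam {m} 0<m iso total = 0<m , iso , through
      where
      through : (P : Point) → NumberOfLines (λ ℓ → ℓ ∈ 𝓛 × Member P ⊆ Member ℓ) m
      through P with VectorSpace.Subspace.basis P | VectorSpace.Subspace.independent P | VectorSpace.Subspace.spans P
      ... | p ∷ [] | ind | spans = numberOfLinesThrough fam {P} {p} 0≢p
          (Equivalence.from (spans p) (F.1# ∷ [] , trans (+ᵥ-identityʳ _) (trans (cong (_• p) ι-1) (1• p))))
          (λ {ℓ} p∈ {v} v∈ → multiple ℓ p∈ (Equivalence.to (spans v) v∈)) (total p 0≢p)
        where
        0≢p : 0ᵥ ≢ p
        0≢p eq = F.1#≢0# (cong head (ind (F.1# ∷ []) (trans (+ᵥ-identityʳ _) (trans (cong (ι F.1# •_) (sym eq)) (•0 _)))))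
        multiple : ∀ ℓ → p ∈ Member ℓ → ∀ {v} → (∃ λ cs → VectorSpace.Subspace.combination P cs (p ∷ []) ≡ v) → v ∈ Member ℓ
        multiple ℓ p∈ (c ∷ [] , refl) = let (a , eq) = proj₁ (Member-≐ ℓ) p∈ in
          proj₂ (Member-≐ ℓ) (_ , trans (IsLinear.⊙-homo (lin-linear _ _) c a) (trans (cong (ι c •_) eq) (sym (+ᵥ-identityʳ _))))

    -- θ q (r ∸ 4) is C (q + 1), so the division is exact with quotient m C, and `X` is q^(r-3).
    isDual : ∀ {a} {𝓛 : Pred Line a} (fam : Family 𝓛) m (let open Family fam) →
      (∀ x y ind (let open Perp x y ind ; T = ∑[ u ] (𝟙 (W*? u) * count (λ v → W? v ×-dec R? u v))) →
         (R x y → T ≡ (m * C + X) * G) × (¬ R x y → T ≡ m * C * G)) →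
      IsDualOfSymplecticType m 𝓛
    isDual {𝓛 = 𝓛} fam m total ℓ =
        (λ ℓ∈ → numberOfLinesIn fam {ℓ} (trans (proj₁ (total _ _ (basis-independent ℓ)) (∈⇒R ℓ ℓ∈)) (cong (_* G) (sym (cong₂ _+_ quotient q^≡)))))
      , (λ ℓ∉ → numberOfLinesIn fam {ℓ} (trans (proj₂ (total _ _ (basis-independent ℓ)) λ R → ℓ∉ (R⇒∈-line ℓ R)) (cong (_* G) (sym quotient))))
      where
      open Family fam
      quotient : m * θ q (r ∸ 4) / suc q ≡ m * C
      quotient = trans (cong (λ t → m * t / suc q) θ≡) (trans (cong (_/ suc q) (sym (ℕ.*-assoc m C (suc q)))) (m*n/n≡m (m * C) (suc q)))

    private
      SF = scalarsF
      SE = scalarsE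

      count-f≡0 : ∀ p → 0ᵥ ≢ p → count (λ v → f v p ≟ 0#) ≡ q * q * X
      count-f≡0 p 0≢p = ℕ.*-cancelʳ-≡ _ _ (q ^ 2) (trans
        (ScalarCounts.count-Orth scalarsE p (0≢p ∘ sym) (λ v → f v p ≟ 0#)
          (λ v eq s → trans (cong tr₀ (trans (cong (s *ᶠ_) eq) (Ep.zeroʳ s))) tr-0) (λ v → tr₀-nondegenerate _))
        (trans ∣V∣≡ (lemma q X)))
        where
        lemma : ∀ q X → q * q * (q * q) * X ≡ q * q * X * (q * (q * 1))
        lemma = ℕSolver.solve-∀

      count-g≡0 : ∀ p → 0ᵥ ≢ p → count (λ v → g v p ≟ F.0#) ≡ q * q * q * X
      count-g≡0 p 0≢p = ℕ.*-cancelʳ-≡ _ _ q (trans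
        (ScalarCounts.count-Orth scalarsF p (0≢p ∘ sym) (λ v → g v p ≟ F.0#)
          (λ v eq s → trans (tr₀-ι* s _) (trans (cong (s F.*ᶠ_) eq) (Fp.zeroʳ s)))
          (λ v z → trans (cong tr₀ (sym (trans (cong (_*ᶠ f v p) ι-1) (Ep.*-identityˡ _)))) (z F.1#)))
        (trans ∣V∣≡ (lemma q X)))
        where
        lemma : ∀ q X → q * q * (q * q) * X ≡ q * q * q * X * q
        lemma = ℕSolver.solve-∀

      subtract : ∀ {A B D R} → A + B ≡ D → ∀ {B′ D′} → B ≡ B′ → D ≡ D′ → D′ ≡ R + B′ → A ≡ R
      subtract {B = B} eq refl refl eq′ = ℕ.+-cancelʳ-≡ B _ _ (trans eq eq′)

    -- There are q³ X vectors with g v p = 0 and q² X with f v p = 0. Their difference is m (q² - q)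
    -- with m = q X = q^(4n-3).
    through-𝓞₁ : ∀ p → 0ᵥ ≢ p → count (Family.R? family-𝓞₁ p) ≡ q * X * (q * k)
    through-𝓞₁ p 0≢p = subtract (count-∖ (λ v → f v p ≟ 0#) (λ v → g v p ≟ F.0#) (λ v eq → trans (cong tr₀ eq) tr-0))
      (count-f≡0 p 0≢p) (count-g≡0 p 0≢p) (lemma k X)
      where
      lemma : ∀ k X → suc k * suc k * suc k * X ≡ suc k * X * (suc k * k) + suc k * suc k * X
      lemma = ℕSolver.solve-∀

    -- The q² X vectors with f v p = 0, less the q² vectors of E p, leave q² (q² - 1) C = m (q² -
    -- q), with m = q (q + 1) C = q θ_{4n-5,q}.
    through-𝓞₂ : ∀ p → 0ᵥ ≢ p → count (Family.R? family-𝓞₂ p) ≡ q * suc q * C * (q * k)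
    through-𝓞₂ p 0≢p = subtract (count-∖ (λ v → v ∈⟨ p ⟩?) (λ v → f v p ≟ 0#) (λ { _ (e , refl) → f-multiple p e }))
      (count-image (_• p) (•-injectiveˡ (0≢p ∘ sym))) (count-f≡0 p 0≢p) (lemma k C)
      where
      lemma : ∀ k C → suc k * suc k * (1 + (k + k * suc k) * C) ≡ suc k * suc (suc k) * C * (suc k * k) + suc k * (suc k * 1)
      lemma = ℕSolver.solve-∀

    through-𝓕 : ∀ p → 0ᵥ ≢ p → count (Family.R? family-𝓕 p) ≡ 1 * (q * k)
    through-𝓕 p 0≢p = trans (count-∈⟨⟩∖∈F⟨⟩ p (0≢p ∘ sym)) (sym (ℕ.*-identityˡ _))

    𝓕-isotropic : ∀ ℓ → 𝓕 ℓ → IsotropicLine ℓ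
    𝓕-isotropic ℓ ℓ∈ = g≡0⇒isotropic ℓ (trans (cong tr₀ (∈𝓕⇒f≡0 ℓ ℓ∈)) tr-0)

    dual-𝓕 : Γ.IsDualCoverOfSymplecticType 𝓕
    dual-𝓕 = 1 , isCover family-𝓕 (s≤s z≤n) 𝓕-isotropic through-𝓕 , isDual family-𝓕 1 λ x y ind →
      let open Evaluate.Sizes x y ind C ∣V∣≡ in
      (λ (p , _) → T-𝓕-in p) , λ ¬R → T-𝓕-out λ p → ¬R (p , independent⇒∉F ind)

    dual-𝓞₁ : Γ.IsDualCoverOfSymplecticType 𝓞₁
    dual-𝓞₁ = q * X , isCover family-𝓞₁ (s≤s z≤n) (λ ℓ → proj₁) through-𝓞₁ , isDual family-𝓞₁ (q * X) λ x y ind →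
      let open Evaluate.Sizes x y ind C ∣V∣≡ in
      (λ (p , p′) → T-𝓞₁-in (g-sym0 p) (p′ ∘ f-sym0)) , λ ¬R → T-𝓞₁-out λ (p , p′) → ¬R (g-sym0 p , p′ ∘ f-sym0)

    dual-𝓞₂ : Γ.IsDualCoverOfSymplecticType 𝓞₂
    dual-𝓞₂ = q * suc q * C , isCover family-𝓞₂ (ℕ.*-mono-< {0} {q * suc q} (s≤s z≤n) 0<C) (λ ℓ → proj₁) through-𝓞₂ , isDual family-𝓞₂ (q * suc q * C) λ x y ind →
      let open Evaluate.Sizes x y ind C ∣V∣≡ in
      (λ (p , p′) → T-𝓞₂-in (f-sym0 p) p′) , λ ¬R → T-𝓞₂-out λ (p , p′) → ¬R (f-sym0 p , p′)

-- Sums of even powers of q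

module _ (k : ℕ) where
  private
    q = suc k

  -- At i this is 1 + q² + ... + q^(2i). It equals θ_{2i+1,q} / (q + 1), the quotient in the dual
  -- condition, and also (q^(2i+2) - 1) / (q² - 1), which ties it to ∣V∣.
  evenPowerSum : ℕ → ℕ
  evenPowerSum zero    = 1
  evenPowerSum (suc i) = q ^ (2 + 2 * i) + evenPowerSum i

  0<evenPowerSum : ∀ i → 0 < evenPowerSum i
  0<evenPowerSum zero    = s≤s z≤n
  0<evenPowerSum (suc i) = ℕ.≤-trans (0<evenPowerSum i) (ℕ.m≤n+m _ _)

  -- The powers up to q^(2i+1) are grouped in pairs q^(2t) + q^(2t+1) = q^(2t) (q + 1).
  θ≡evenPowerSum : ∀ i → θ q (1 + 2 * i) ≡ evenPowerSum i * suc q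
  θ≡evenPowerSum zero    = lemma k
    where
    lemma : ∀ k → suc k * 1 + 1 ≡ 1 * suc (suc k)
    lemma = ℕSolver.solve-∀
  θ≡evenPowerSum (suc i) = begin
    θ q (1 + 2 * suc i)
      ≡⟨ cong (λ j → θ q (1 + j)) (ℕ.*-suc 2 i) ⟩
    q * t + (t + θ q (1 + 2 * i))
      ≡⟨ cong (λ u → q * t + (t + u)) (θ≡evenPowerSum i) ⟩
    q * t + (t + evenPowerSum i * suc q)
      ≡⟨ lemma q t (evenPowerSum i) ⟩
    (t + evenPowerSum i) * suc q ∎
    where
    open ≡-Reasoning
    t = q ^ (2 + 2 * i)
    lemma : ∀ q t s → q * t + (t + s * suc q) ≡ (t + s) * suc q
    lemma = ℕSolver.solve-∀

  -- The sum telescopes: (q² - 1) q^(2t) is the difference of consecutive even powers.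
  q^≡evenPowerSum : ∀ i → q ^ (2 + 2 * i) ≡ 1 + (k + k * q) * evenPowerSum i
  q^≡evenPowerSum zero    = lemma k
    where
    lemma : ∀ k → suc k * (suc k * 1) ≡ 1 + (k + k * suc k) * 1
    lemma = ℕSolver.solve-∀
  q^≡evenPowerSum (suc i) = begin
    q ^ (2 + 2 * suc i)
      ≡⟨ cong (λ j → q ^ (2 + j)) (ℕ.*-suc 2 i) ⟩
    q * (q * t)
      ≡⟨ lemma k t ⟩
    t + (k + k * q) * t
      ≡⟨ cong (_+ (k + k * q) * t) (q^≡evenPowerSum i) ⟩
    1 + (k + k * q) * evenPowerSum i + (k + k * q) * t
      ≡⟨ lemma′ (k + k * q) (evenPowerSum i) t ⟩
    1 + (k + k * q) * (t + evenPowerSum i) ∎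
    where
    open ≡-Reasoning
    t = q ^ (2 + 2 * i)
    lemma : ∀ k t → suc k * (suc k * t) ≡ t + (k + k * suc k) * t
    lemma = ℕSolver.solve-∀
    lemma′ : ∀ m s t → 1 + m * s + m * t ≡ 1 + m * (t + s)
    lemma′ = ℕSolver.solve-∀

corollary3p10 : ∀ (n q : ℕ) → 2 ≤ n → IsPrimePower q →
    ∀ (F E : Field) → HasOrder F q → HasOrder E (q ^ 2) →
    ∀ (ι : Field.Carrier F → Field.Carrier E) → IsFieldHomomorphism F E ι →
    ∀ (f : VectorSpace.V E (2 * n) → VectorSpace.V E (2 * n) → Field.Carrier E) →
    VectorSpace.IsNondegenerateAlternating E (2 * n) f →
    ∀ (λ₀ : Field.Carrier E) → λ₀ ≢ Field.0# E →
    let open Geometry n q F E ι f λ₀ in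
    IsDualCoverOfSymplecticType 𝓕 ×
    IsDualCoverOfSymplecticType 𝓞₁ ×
    IsDualCoverOfSymplecticType 𝓞₂
corollary3p10 n zero _ primePower = contradiction (IsPrimePower⇒2≤ primePower) λ ()
corollary3p10 (suc zero) (suc k) (s≤s ())
corollary3p10 (suc (suc j)) (suc k) _ primePower F E ordF ordE ι ι-hom f f-alt λ₀ λ₀≢0 =
    dual-𝓕 C 0<C ∣V∣≡ θ≡ q^≡ , dual-𝓞₁ C 0<C ∣V∣≡ θ≡ q^≡ , dual-𝓞₂ C 0<C ∣V∣≡ θ≡ q^≡
  where
  n = suc (suc j)
  q = suc k
  -- i = 2n - 3, so that 1 + 2 i = r - 4 and 2 + 2 i = r - 3.
  i = 1 + 2 * j
  C = evenPowerSum k i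
  0<C = 0<evenPowerSum k i
  open Main n k primePower F E ordF ordE ι ι-hom f f-alt λ₀ λ₀≢0 using (dual-𝓕; dual-𝓞₁; dual-𝓞₂)
  4n-1≡ : 4 * n ∸ 1 ≡ 5 + 2 * i
  4n-1≡ = cong (_∸ 1) (lemma j)
    where
    lemma : ∀ j → 4 * suc (suc j) ≡ 6 + 2 * (1 + 2 * j)
    lemma = ℕSolver.solve-∀
  ∣V∣≡ : ∣ Vec (Field.Carrier E) (2 * n) ∣ {{finite-Vec {{finite (q ^ 2) ordE}}}} ≡ q * q * (q * q) * (1 + (k + k * q) * C)
  ∣V∣≡ = begin
    ∣ Vec (Field.Carrier E) (2 * n) ∣ {{finite-Vec {{finite (q ^ 2) ordE}}}}
      ≡⟨ ∣Vec∣ (Field.Carrier E) {{finite (q ^ 2) ordE}} (2 * n) ⟩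
    (q ^ 2) ^ (2 * n)
      ≡⟨ trans (ℕ.^-*-assoc q 2 (2 * n)) (cong (q ^_) (lemma j)) ⟩
    q * (q * (q * (q * q ^ (2 + 2 * i))))
      ≡⟨ lemma′ q (q ^ (2 + 2 * i)) ⟩
    q * q * (q * q) * q ^ (2 + 2 * i)
      ≡⟨ cong (q * q * (q * q) *_) (q^≡evenPowerSum k i) ⟩
    q * q * (q * q) * (1 + (k + k * q) * C) ∎
    where
    open ≡-Reasoning
    lemma : ∀ j → 2 * (2 * suc (suc j)) ≡ 6 + 2 * (1 + 2 * j)
    lemma = ℕSolver.solve-∀
    lemma′ : ∀ q t → q * (q * (q * (q * t))) ≡ q * q * (q * q) * t
    lemma′ = ℕSolver.solve-∀
  θ≡ : θ q (4 * n ∸ 1 ∸ 4) ≡ C * suc q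
  θ≡ = trans (cong (λ t → θ q (t ∸ 4)) 4n-1≡) (θ≡evenPowerSum k i)
  q^≡ : q ^ (4 * n ∸ 1 ∸ 3) ≡ 1 + (k + k * q) * C
  q^≡ = trans (cong (λ t → q ^ (t ∸ 3)) 4n-1≡) (q^≡evenPowerSum k i)
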